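{- Let $G=(V,E)$ be a simple connected graph on $|V|=N\ge 3$ vertices, and let $\mathrm{I}(k)$ be the number of spanning forests of $G$ with $k$ edges. Then $$\frac{\mathrm I(N-2)^2}{\mathrm I(N-3)\cdot \mathrm I(N-1)}\ \ge\ \frac32\Bigl(1+\frac{1}{N-2}\Bigr),$$ and equality holds if and only if $G$ is an $N$-cycle.
   Context: A spanning forest with $k$ edges is a set of $k$ edges of $G$ containing no cycle (equivalently, an independent set of size $k$ in the graphical matroid of $G$). -}

module Defs where

open import Data.Fin.Base using (Fin; toℕ)
import Data.Fin.Properties as Fin
open import Data.Fin.Permutation using (Permutation′; _⟨$⟩ʳ_)
open import Data.Fin.Subset using (Subset; _∈_; ∣_∣; inside; outside)
open import Data.Fin.Subset.Properties using (_∈?_)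
open import Data.List.Base as List using (List; []; _∷_; _++_; length; filter; allFin; cartesianProduct)
open import Data.Nat.Base using (ℕ; zero; suc; _≤_; s≤s; _∸_; NonZero; >-nonZero)
open import Data.Nat.DivMod using (_mod_)
import Data.Nat.Properties as ℕ
open import Data.Product.Base using (∃; ∃-syntax; Σ-syntax; _×_; _,_)
open import Data.Product.Properties using (≡-dec)
open import Data.Sum.Base using (_⊎_)
open import Data.Vec.Base using (Vec; []; _∷_; lookup)
open import Data.Vec.Relation.Unary.AllPairs using (allPairs?)
open import Data.Vec.Relation.Unary.Unique.Propositional using (Unique)
open import Data.Vec.Relation.Unary.Unique.Propositional.Properties using (lookup-injective)
open import Function.Bundles using (_⇔_)
open import Level using (0ℓ)
open import Relation.Binary.Core using (Rel)
import Relation.Binary.Definitions as B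
open import Relation.Binary.Construct.Closure.ReflexiveTransitive using (Star)
open import Relation.Binary.PropositionalEquality using (_≡_)
open import Relation.Nullary.Decidable using (Dec; map′; ¬?; _×-dec_; _⊎-dec_)
open import Relation.Nullary.Negation using (¬_)
open import Relation.Unary using (Pred; Decidable)

record SimpleGraph (n : ℕ) : Set₁ where
  field
    Adj    : Rel (Fin n) 0ℓ
    adj?   : B.Decidable Adj
    symm   : B.Symmetric Adj
    irrefl : B.Irreflexive _≡_ Adj

open SimpleGraph public

Connected : ∀ {n} → SimpleGraph n → Set
Connected G = ∀ u v → Star (Adj G) u v

-- The cyclic successor i ↦ i + 1 mod ℓ.
next : ∀ {ℓ} → Fin ℓ → Fin ℓ
next {suc ℓ} i = suc (toℕ i) mod suc ℓ

-- Adjacency in the standard cycle on Fin n (a simple graph for n ≥ 3).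
CycleAdj : ∀ n → Rel (Fin n) 0ℓ
CycleAdj n i j = j ≡ next i ⊎ i ≡ next j

-- G is isomorphic to the standard cycle on all n of its vertices.
IsCycleGraph : ∀ {n} → SimpleGraph n → Set
IsCycleGraph {n} G =
  Σ[ σ ∈ Permutation′ n ] (∀ u v → Adj G u v ⇔ CycleAdj n (σ ⟨$⟩ʳ u) (σ ⟨$⟩ʳ v))

-- Every edge is listed exactly once, with its smaller endpoint first.
edges : ∀ {n} → SimpleGraph n → List (Fin n × Fin n)
edges {n} G =
  filter (λ (u , v) → u Fin.<? v ×-dec adj? G u v) (cartesianProduct (allFin n) (allFin n))

-- A set of edges of G is a set of positions in the list `edges G`.
EdgeSet : ∀ {n} → SimpleGraph n → Set
EdgeSet G = Subset (length (edges G))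

module _ {n} (G : SimpleGraph n) (S : EdgeSet G) where

  -- u and v are the two endpoints of some edge in S.
  Joined : Rel (Fin n) 0ℓ
  Joined u v = ∃[ e ] e ∈ S × (List.lookup (edges G) e ≡ (u , v) ⊎ List.lookup (edges G) e ≡ (v , u))

  -- c lists, in cyclic order, the vertices of a cycle all of whose edges lie in S.
  CycleThrough : ∀ {ℓ} → Vec (Fin n) ℓ → Set
  CycleThrough c = Unique c × (∀ i → Joined (lookup c i) (lookup c (next i)))

  HasCycle : Set
  HasCycle = ∃[ ℓ ] 3 ≤ ℓ × Σ[ c ∈ Vec (Fin n) ℓ ] CycleThrough c

  IsForest : Set
  IsForest = ¬ HasCycle

anyVec? : ∀ {n} ℓ {P : Pred (Vec (Fin n) ℓ) 0ℓ} → Decidable P → Dec (∃ P)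
anyVec? zero    P? = map′ (λ p → [] , p) (λ { ([] , p) → p }) (P? [])
anyVec? (suc ℓ) P? =
  map′ (λ (x , xs , p) → x ∷ xs , p) (λ { (x ∷ xs , p) → x , xs , p })
    (Fin.any? λ x → anyVec? ℓ λ xs → P? (x ∷ xs))

module _ {n} (G : SimpleGraph n) (S : EdgeSet G) where

  joined? : B.Decidable (Joined G S)
  joined? u v = Fin.any? λ e →
    e ∈? S ×-dec (≡-dec Fin._≟_ Fin._≟_ _ _ ⊎-dec ≡-dec Fin._≟_ Fin._≟_ _ _)

  cycleThrough? : ∀ {ℓ} → Decidable (CycleThrough G S {ℓ})
  cycleThrough? c =
    allPairs? (λ u v → ¬? (u Fin.≟ v)) c ×-dec
    Fin.all? λ i → joined? (lookup c i) (lookup c (next i))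

  -- A cycle has distinct vertices, so only lengths at most n need to be searched.
  hasCycle? : Dec (HasCycle G S)
  hasCycle? =
    map′ (λ (ℓ , _ , found) → ℓ , found)
         (λ { (ℓ , 3≤ℓ , c , uniq , joins) →
              ℓ , s≤s (Fin.injective⇒≤ λ {i} {j} → lookup-injective uniq i j)
                , 3≤ℓ , c , uniq , joins })
         (ℕ.anyUpTo? (λ ℓ → 3 ℕ.≤? ℓ ×-dec anyVec? ℓ cycleThrough?) (suc n))

  isForest? : Dec (IsForest G S)
  isForest? = ¬? hasCycle?

subsets : ∀ m → List (Subset m)
subsets zero    = [] ∷ []
subsets (suc m) = List.map (outside ∷_) (subsets m) ++ List.map (inside ∷_) (subsets m)

-- The number of spanning forests of G with k edges.
I : ∀ {n} → SimpleGraph n → ℕ → ℕ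
I G k =
  length (filter (λ S → ∣ S ∣ ℕ.≟ k ×-dec isForest? G S) (subsets (length (edges G))))

∸-nonZero : ∀ {m n} → suc m ≤ n → NonZero (n ∸ m)
∸-nonZero m<n = >-nonZero (ℕ.m<n⇒0<n∸m m<n)

{-# OPTIONS --safe #-}
-- Let r = N - 1.  For a word w of edges forming a forest let A_j(w) be the number of words of j edges
-- extending w to a forest, so that A_j of the empty word is j! I(j).  For |w| + j = r - 2 consider the
-- quadratic form on ℤ^E ⊕ ℤ with Gram matrix entries 2 A_j(few), 2 A_j(ew), 3 A_j(w).  It is hyperbolic:
-- nonpositive on the orthogonal complement of (1, …, 1; 0).  For j = 0 contracting w leaves three
-- vertices, hence at most three parallel classes of edges, and this is Cauchy-Schwarz.  For larger j the form
-- of w is the sum of the forms of the words ew, whose degrees are its rows; solving a Laplacian system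
-- turns their hyperbolicity into that of the sum, with no spectral theory.  The reverse Cauchy-Schwarz inequality
-- between (1, …, 1; 0) and (0; 1) for the empty word is 3 (N-1) I(N-3) I(N-1) ≤ 2 (N-2) I(N-2)².
--
-- Equality passes from w to every ew, down to the forests with N - 3 edges, where it says that the three
-- parallel classes have equal size.  Some such forest leaves two vertices isolated; as G is simple, its
-- classes have size one.  This spreads over a spanning tree T containing it and shows that there is a
-- single edge outside T and that G minus any edge is a forest, so the cycle of G passes through every edge.
module Submission where

open import Defs
open import Data.Bool.Base using (true; false; if_then_else_)
open import Data.Fin.Base as Fin using (Fin; zero; suc; toℕ; inject₁; fromℕ; punchIn; punchOut)
open import Data.Fin.Permutation using (permutation; _⟨$⟩ʳ_; _⟨$⟩ˡ_; inverseˡ; inverseʳ)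
import Data.Fin.Properties as Fin
open import Data.Fin.Relation.Unary.Top using (view; ‵fromℕ; ‵inject₁)
open import Data.Fin.Subset as Subset using (Subset; inside; outside; ∣_∣; ⊥)
import Data.Fin.Subset.Properties as Subset
open import Data.Integer.Base as ℤ using (ℤ; +_; -[1+_]; 0ℤ; 1ℤ; +≤+; +<+)
import Data.Integer.Properties as ℤ
import Data.Integer.Tactic.RingSolver as ℤ-Ring
open import Data.List.Base as List using (List; []; _∷_; _++_; length; filter; map; allFin; cartesianProduct)
open import Data.List.Membership.Propositional using (_∈_; _∉_; find)
import Data.List.Membership.DecPropositional as DecMembership
open import Data.List.Membership.Propositional.Properties
  using (∈-filter⁺; ∈-filter⁻; ∈-cartesianProduct⁺; ∈-allFin; ∈-lookup)
open import Data.List.Properties using (length-++; filter-++)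
open import Data.List.Relation.Binary.Permutation.Propositional as Perm using (_↭_; ↭-sym; ↭-refl)
open import Data.List.Relation.Binary.Permutation.Propositional.Properties using (∈-resp-↭; drop-∷; ↭-length)
open import Data.List.Relation.Binary.Subset.Propositional using (_⊆_)
open import Data.List.Relation.Unary.All as All using (All; []; _∷_)
open import Data.List.Relation.Unary.All.Properties using (¬Any⇒All¬)
open import Data.List.Relation.Unary.AllPairs.Core using ([]; _∷_)
open import Data.List.Relation.Unary.Any as Any using (here; there; any?)
open import Data.List.Relation.Unary.Any.Properties using (lookup-index)
open import Data.List.Relation.Unary.Unique.Propositional using (Unique)
import Data.List.Relation.Unary.Unique.Propositional.Properties as Unique
open import Data.Nat.Base as ℕ using (ℕ; zero; suc; _!; NonZero; z≤n; s≤s)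
open import Data.Nat.DivMod using (_%_; m<n⇒m%n≡m; n%n≡0)
import Data.Nat.Properties as ℕ
import Data.Nat.Tactic.RingSolver as ℕ-Ring
open import Data.Product.Base using (∃; ∃₂; ∃-syntax; Σ-syntax; _×_; _,_; proj₁; proj₂)
open import Data.Rational.Base as ℚ using (_/_; 1ℚ; _≥_; toℚᵘ)
import Data.Rational.Properties as ℚ
open import Data.Rational.Unnormalised.Base as ℚᵘ using (mkℚᵘ; *≡*; *≤*; _≃_)
import Data.Rational.Unnormalised.Properties as ℚᵘ
open import Data.Sum.Base as Sum using (_⊎_; inj₁; inj₂; [_,_]′)
open import Data.Unit.Base using (⊤; tt)
open import Data.Vec.Base using (Vec; []; _∷_; lookup; _[_]≔_)
import Data.Vec.Membership.Propositional as Vec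
import Data.Vec.Properties as Vec
import Data.Vec.Relation.Unary.All as VecAll
open import Data.Vec.Relation.Unary.AllPairs.Core using ([]; _∷_)
import Data.Vec.Relation.Unary.Any as Vec
import Data.Vec.Relation.Unary.Unique.Propositional as VecUnique
open import Data.Vec.Relation.Unary.Unique.Propositional.Properties using (lookup-injective)
open import Function.Base using (_∘_; id; const; case_of_)
open import Function.Bundles using (_⇔_; mk⇔; Equivalence)
open import Level using (0ℓ)
open import Relation.Binary.Construct.Closure.ReflexiveTransitive as Star using (Star; ε; _◅_; _◅◅_)
open import Relation.Binary.Core using (Rel)
open import Relation.Binary.Definitions using (tri<; tri≈; tri>)
open import Relation.Binary.PropositionalEquality
open import Relation.Binary.Structures using (IsEquivalence)
open import Relation.Nullary using (¬_; Dec; yes; no; does; contradiction)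
open import Relation.Nullary.Decidable
  using (¬?; _×-dec_; _⊎-dec_; _→-dec_; decidable-stable; dec-true; dec-false; from-yes; toSum)
open import Relation.Unary using (Decidable)

-- The constant 3 is where graphs enter. If e₁ and e₂ are the elementary symmetric functions of the
-- sizes of k ≥ 2 parallel classes, then e₁² ≥ 2k/(k-1) e₂; three vertices allow k = 3 at most, and
-- the Gram entries 2, 2, 3 are scaled so that the base case is e₁² ≥ 3 e₂. Words are used rather
-- than sets because A_{j+1}(w) is the plain sum of A_j(ew), so the same entries serve at every
-- level. The obstacle is that each link form is nonpositive only on its own hyperplane, while a
-- vector (v; t) orthogonal for the sum need not lie in any of these. So the link forms are
-- evaluated elsewhere, at (u; a t), where L u = a (D v + t h), D is the diagonal of degrees and L =
-- D - K. With w = u - a v, reverse Cauchy-Schwarz bounds the form of the link of e there by D_e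
-- w_e². What these bounds leave over, together with the Laplacian energy of w, is exactly -a² times
-- the form at (v; t). The integer a > 0 stands in for a denominator.

private variable n : ℕ

-- Hyperbolic quadratic forms over ℤ

module _ where

  open import Data.Integer.Base using (_+_; _-_; _*_; -_; _≤_; _<_; positive; nonNegative)
  open import Data.Integer.Properties
  open import Algebra.Properties.Semiring.Sum ℤ.+-*-semiring using (sum; sum-cong-≗; ∑-distrib-+; ∑-comm; *-distribˡ-sum; *-distribʳ-sum)

  indicator : ∀ {P : Set} → Dec P → ℤ
  indicator d = if does d then 1ℤ else 0ℤ

  indicator-true : ∀ {P : Set} (d : Dec P) → P → indicator d ≡ 1ℤ
  indicator-true d p rewrite dec-true d p = refl

  indicator-false : ∀ {P : Set} (d : Dec P) → ¬ P → indicator d ≡ 0ℤ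
  indicator-false d ¬p rewrite dec-false d ¬p = refl

  indicator-⇔ : ∀ {P Q : Set} (d : Dec P) (d′ : Dec Q) → (P → Q) → (Q → P) → indicator d ≡ indicator d′
  indicator-⇔ (yes p) d′ f g = sym (indicator-true d′ (f p))
  indicator-⇔ (no ¬p) d′ f g = sym (indicator-false d′ (¬p ∘ g))

  indicator-nn : ∀ {P : Set} (d : Dec P) → 0ℤ ≤ indicator d
  indicator-nn (yes _) = +≤+ ℕ.z≤n
  indicator-nn (no _)  = +≤+ ℕ.z≤n

  ∑-*ˡ : ∀ c (f : Fin n → ℤ) → sum (λ i → c * f i) ≡ c * sum f
  ∑-*ˡ c f = sym (*-distribˡ-sum c f)

  ∑-*ʳ : ∀ c (f : Fin n → ℤ) → sum (λ i → f i * c) ≡ sum f * c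
  ∑-*ʳ c f = sym (*-distribʳ-sum c f)

  ∑-neg : (f : Fin n → ℤ) → sum (λ i → - f i) ≡ - sum f
  ∑-neg f = trans (sum-cong-≗ λ i → sym (-1*i≡-i (f i))) (trans (∑-*ˡ (- 1ℤ) f) (-1*i≡-i (sum f)))

  ∑-sub : (f g : Fin n → ℤ) → sum (λ i → f i - g i) ≡ sum f - sum g
  ∑-sub f g = trans (∑-distrib-+ f (λ i → - g i)) (cong (λ x → sum f + x) (∑-neg g))

  ∑-0 : {f : Fin n → ℤ} → (∀ i → f i ≡ 0ℤ) → sum f ≡ 0ℤ
  ∑-0 {zero}  eq = refl
  ∑-0 {suc n} eq = cong₂ _+_ (eq zero) (∑-0 (eq ∘ suc))

  ∑-mono : {f g : Fin n → ℤ} → (∀ i → f i ≤ g i) → sum f ≤ sum g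
  ∑-mono {zero}  le = ≤-refl
  ∑-mono {suc n} le = +-mono-≤ (le zero) (∑-mono (le ∘ suc))

  ∑-nonneg : {f : Fin n → ℤ} → (∀ i → 0ℤ ≤ f i) → 0ℤ ≤ sum f
  ∑-nonneg {n} {f} le = subst (_≤ sum f) (∑-0 {n} {λ _ → 0ℤ} λ _ → refl) (∑-mono le)

  +-nonneg : ∀ {x y} → 0ℤ ≤ x → 0ℤ ≤ y → 0ℤ ≤ x + y
  +-nonneg p q = +-mono-≤ p q

  *-nonneg : ∀ {x y} → 0ℤ ≤ x → 0ℤ ≤ y → 0ℤ ≤ x * y
  *-nonneg {x} {y} p q = subst (_≤ x * y) (*-zeroʳ x) (*-monoˡ-≤-nonNeg x {{nonNegative p}} q)

  *-pos : ∀ {x y} → 0ℤ < x → 0ℤ < y → 0ℤ < x * y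
  *-pos {x} {y} p q = subst (_< x * y) (*-zeroʳ x) (*-monoˡ-<-pos x {{positive p}} q)

  square-nonneg : ∀ x → 0ℤ ≤ x * x
  square-nonneg (+ k)          = subst (0ℤ ≤_) (pos-* k k) (+≤+ ℕ.z≤n)
  square-nonneg (-[1+ _ ]) = +≤+ ℕ.z≤n

  nonneg-+-≡0 : ∀ {x y} → 0ℤ ≤ x → 0ℤ ≤ y → x + y ≡ 0ℤ → x ≡ 0ℤ × y ≡ 0ℤ
  nonneg-+-≡0 {x} {y} p q eq =
    ≤-antisym (subst₂ _≤_ (+-identityʳ x) eq (+-monoʳ-≤ x q)) p ,
    ≤-antisym (subst₂ _≤_ (+-identityˡ y) eq (+-monoˡ-≤ y p)) q

  ∑-nonneg-≡0 : {f : Fin n → ℤ} → (∀ i → 0ℤ ≤ f i) → sum f ≡ 0ℤ → ∀ i → f i ≡ 0ℤ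
  ∑-nonneg-≡0 {suc n} le eq zero    = proj₁ (nonneg-+-≡0 (le zero) (∑-nonneg (le ∘ suc)) eq)
  ∑-nonneg-≡0 {suc n} le eq (suc i) =
    ∑-nonneg-≡0 (le ∘ suc) (proj₂ (nonneg-+-≡0 (le zero) (∑-nonneg (le ∘ suc)) eq)) i

  pos⊎≡0 : ∀ {x} → 0ℤ ≤ x → (0ℤ < x) ⊎ (x ≡ 0ℤ)
  pos⊎≡0 {+ zero}  _ = inj₂ refl
  pos⊎≡0 {+ suc _} _ = inj₁ (+<+ (ℕ.s≤s ℕ.z≤n))

  *-cancelˡ-≡0 : ∀ {x y} → 0ℤ < x → x * y ≡ 0ℤ → y ≡ 0ℤ
  *-cancelˡ-≡0 {x} {y} p eq with i*j≡0⇒i≡0∨j≡0 x eq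
  ... | inj₁ refl = contradiction p (<-irrefl refl)
  ... | inj₂ y≡0  = y≡0

  ≡0-by-square : ∀ {x} → x * x ≡ 0ℤ → x ≡ 0ℤ
  ≡0-by-square {x} eq with i*j≡0⇒i≡0∨j≡0 x eq
  ... | inj₁ p = p
  ... | inj₂ p = p

  -- For symmetric nonnegative `K` these vectors are the kernel of its Laplacian, so orthogonality
  -- to them is the solvability condition of a Laplacian system.
  LocallyConstant : (Fin n → Fin n → ℤ) → (Fin n → ℤ) → Set
  LocallyConstant K z = ∀ i j → 0ℤ < K i j → z i ≡ z j

  -- Gaussian elimination of vertex 0 turns the Laplacian of K into (a multiple of) the Laplacian of
  -- c K i j + K i 0 K 0 j, where c is the degree of vertex 0; it preserves the orthogonality hypothesis.
  laplacian-solvable :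
    ∀ n (K : Fin n → Fin n → ℤ) (b : Fin n → ℤ) →
    (∀ i j → K i j ≡ K j i) → (∀ i j → 0ℤ ≤ K i j) →
    (∀ z → LocallyConstant K z → sum (λ i → b i * z i) ≡ 0ℤ) →
    ∃ λ a → Σ[ u ∈ (Fin n → ℤ) ] 0ℤ < a × (∀ i → sum (λ j → K i j * (u i - u j)) ≡ a * b i)
  laplacian-solvable zero    K b sy nn orth = 1ℤ , (λ ()) , +<+ (ℕ.s≤s ℕ.z≤n) , λ ()
  laplacian-solvable (suc n) K b sy nn orth = answer (pos⊎≡0 (∑-nonneg (λ j → nn zero (suc j))))
    where
    K₀ : Fin n → ℤ
    K₀ j = K zero (suc j)
    c  = sum K₀
    b₀ = b zero

    answer : (0ℤ < c) ⊎ (c ≡ 0ℤ) → ∃ λ a → Σ[ u ∈ (Fin (suc n) → ℤ) ] 0ℤ < a × (∀ i → sum (λ j → K i j * (u i - u j)) ≡ a * b i)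
    -- Vertex 0 is isolated: its indicator `δ` is locally constant, which forces `b₀` to vanish, and
    -- the value 0 is given to `u` there.
    answer (inj₂ c≡0) = a , u , 0<a , solves
      where
      K₀≡0 : ∀ j → K₀ j ≡ 0ℤ
      K₀≡0 = ∑-nonneg-≡0 (λ j → nn zero (suc j)) c≡0

      δ : Fin (suc n) → ℤ
      δ zero    = 1ℤ
      δ (suc _) = 0ℤ

      δ-const : LocallyConstant K δ
      δ-const zero    zero    p = refl
      δ-const zero    (suc j) p = contradiction p (<-irrefl (sym (K₀≡0 j)))
      δ-const (suc i) zero    p = contradiction p (<-irrefl (sym (trans (sy (suc i) zero) (K₀≡0 i))))
      δ-const (suc i) (suc j) p = refl

      b₀≡0 : b₀ ≡ 0ℤ
      b₀≡0 = trans (sym (trans (cong₂ _+_ (*-identityʳ b₀) (∑-0 λ i → *-zeroʳ (b (suc i)))) (+-identityʳ b₀)))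
                   (orth δ δ-const)

      extend : (Fin n → ℤ) → Fin (suc n) → ℤ
      extend z zero    = 0ℤ
      extend z (suc i) = z i

      extend-const : ∀ z → LocallyConstant (λ i j → K (suc i) (suc j)) z → LocallyConstant K (extend z)
      extend-const z lc zero    zero    p = refl
      extend-const z lc zero    (suc j) p = contradiction p (<-irrefl (sym (K₀≡0 j)))
      extend-const z lc (suc i) zero    p = contradiction p (<-irrefl (sym (trans (sy (suc i) zero) (K₀≡0 i))))
      extend-const z lc (suc i) (suc j) p = lc i j p

      rec = laplacian-solvable n (λ i j → K (suc i) (suc j)) (b ∘ suc) (λ i j → sy _ _) (λ i j → nn _ _)
              (λ z lc → trans (sym (trans (cong (_+ sum (λ i → b (suc i) * z i)) (*-zeroʳ b₀)) (+-identityˡ _)))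
                              (orth (extend z) (extend-const z lc)))
      a   = proj₁ rec
      0<a = proj₁ (proj₂ (proj₂ rec))
      u   = extend (proj₁ (proj₂ rec))

      solves : ∀ i → sum (λ j → K i j * (u i - u j)) ≡ a * b i
      solves zero    = begin
        K zero zero * 0ℤ + sum (λ j → K₀ j * (0ℤ - u (suc j)))
          ≡⟨ cong₂ _+_ (*-zeroʳ (K zero zero)) (∑-0 λ j → cong (_* (0ℤ - u (suc j))) (K₀≡0 j)) ⟩
        0ℤ     ≡⟨ sym (*-zeroʳ a) ⟩
        a * 0ℤ ≡⟨ cong (a *_) (sym b₀≡0) ⟩
        a * b₀ ∎
        where open ≡-Reasoning
      solves (suc i) = trans (cong (_+ rest) (cong (_* (u (suc i) - 0ℤ)) (trans (sy (suc i) zero) (K₀≡0 i))))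
                         (trans (+-identityˡ rest) (proj₂ (proj₂ (proj₂ rec)) i))
        where rest = sum (λ j → K (suc i) (suc j) * (u (suc i) - u (suc j)))

    answer (inj₁ 0<c) = c * a′ , u , *-pos 0<c 0<a′ , solves
      where
      K′ : Fin n → Fin n → ℤ
      K′ i j = c * K (suc i) (suc j) + K₀ i * K₀ j
      b′ : Fin n → ℤ
      b′ i = c * b (suc i) + K₀ i * b₀

      0≤c = <⇒≤ 0<c

      nn′ : ∀ i j → 0ℤ ≤ K′ i j
      nn′ i j = +-nonneg (*-nonneg 0≤c (nn _ _)) (*-nonneg (nn _ _) (nn _ _))

      -- The value at vertex 0 is the K₀-weighted average of the values at its neighbours (all equal), times c.
      extend : (Fin n → ℤ) → Fin (suc n) → ℤ
      extend z zero    = sum (λ j → K₀ j * z j)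
      extend z (suc i) = c * z i

      average : ∀ z → LocallyConstant K′ z → ∀ i → 0ℤ < K₀ i → extend z zero ≡ c * z i
      average z lc i 0<K₀i = trans (sum-cong-≗ same) (∑-*ʳ (z i) K₀)
        where
        same : ∀ j → K₀ j * z j ≡ K₀ j * z i
        same j with pos⊎≡0 (nn zero (suc j))
        ... | inj₂ eq    = trans (cong (_* z j) eq) (cong (_* z i) (sym eq))
        ... | inj₁ 0<K₀j = cong (K₀ j *_) (lc j i (<-≤-trans (*-pos 0<K₀j 0<K₀i)
                             (subst (_≤ K′ j i) (+-identityˡ _) (+-monoˡ-≤ (K₀ j * K₀ i) (*-nonneg 0≤c (nn (suc j) (suc i)))))))

      extend-const : ∀ z → LocallyConstant K′ z → LocallyConstant K (extend z)
      extend-const z lc zero    zero    p = refl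
      extend-const z lc zero    (suc j) p = average z lc j p
      extend-const z lc (suc i) zero    p = sym (average z lc i (subst (0ℤ <_) (sy (suc i) zero) p))
      extend-const z lc (suc i) (suc j) p = cong (c *_) (lc i j
        (<-≤-trans (*-pos 0<c p) (subst (_≤ K′ i j) (+-identityʳ _) (+-monoʳ-≤ (c * K (suc i) (suc j)) (*-nonneg (nn zero (suc i)) (nn zero (suc j)))))))

      orth′ : ∀ z → LocallyConstant K′ z → sum (λ i → b′ i * z i) ≡ 0ℤ
      orth′ z lc = begin
        sum (λ i → b′ i * z i)
          ≡⟨ sum-cong-≗ (λ i → rearrange c (b (suc i)) (K₀ i) b₀ (z i)) ⟩
        sum (λ i → b₀ * (K₀ i * z i) + b (suc i) * (c * z i))
          ≡⟨ ∑-distrib-+ (λ i → b₀ * (K₀ i * z i)) _ ⟩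
        sum (λ i → b₀ * (K₀ i * z i)) + sum (λ i → b (suc i) * (c * z i))
          ≡⟨ cong (_+ sum (λ i → b (suc i) * (c * z i))) (∑-*ˡ b₀ (λ i → K₀ i * z i)) ⟩
        sum (λ i → b i * extend z i)
          ≡⟨ orth (extend z) (extend-const z lc) ⟩
        0ℤ ∎
        where
        open ≡-Reasoning
        rearrange : ∀ c b k b₀ z → (c * b + k * b₀) * z ≡ b₀ * (k * z) + b * (c * z)
        rearrange = ℤ-Ring.solve-∀

      rec = laplacian-solvable n K′ b′
              (λ i j → cong₂ _+_ (cong (c *_) (sy _ _)) (*-comm (K₀ i) (K₀ j))) nn′ orth′
      a′    = proj₁ rec
      u′    = proj₁ (proj₂ rec)
      0<a′  = proj₁ (proj₂ (proj₂ rec))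
      sol′  = proj₂ (proj₂ (proj₂ rec))

      -- Back substitution. With `u′` scaled by `c`, row 0 asks that `c * u₀` exceed `c` times the
      -- `K₀`-weighted sum of `u′` by `c * a′ * b₀`, so no division remains.
      u₀ = a′ * b₀ + sum (λ j → K₀ j * u′ j)
      u : Fin (suc n) → ℤ
      u zero    = u₀
      u (suc i) = c * u′ i

      split : ∀ x → sum (λ j → K₀ j * (x - u′ j)) ≡ c * x - sum (λ j → K₀ j * u′ j)
      split x = begin
        sum (λ j → K₀ j * (x - u′ j))       ≡⟨ sum-cong-≗ (λ j → *-distribˡ-- (K₀ j) x (u′ j)) ⟩
        sum (λ j → K₀ j * x - K₀ j * u′ j)  ≡⟨ ∑-sub (λ j → K₀ j * x) (λ j → K₀ j * u′ j) ⟩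
        sum (λ j → K₀ j * x) - sum (λ j → K₀ j * u′ j) ≡⟨ cong (_- sum (λ j → K₀ j * u′ j)) (∑-*ʳ x K₀) ⟩
        c * x - sum (λ j → K₀ j * u′ j) ∎
        where
        open ≡-Reasoning
        *-distribˡ-- : ∀ k x y → k * (x - y) ≡ k * x - k * y
        *-distribˡ-- = ℤ-Ring.solve-∀

      split₀ : ∀ x → sum (λ j → K₀ j * (x - c * u′ j)) ≡ c * x - c * sum (λ j → K₀ j * u′ j)
      split₀ x = begin
        sum (λ j → K₀ j * (x - c * u′ j))       ≡⟨ sum-cong-≗ (λ j → rearrange (K₀ j) x c (u′ j)) ⟩
        sum (λ j → K₀ j * x - c * (K₀ j * u′ j))  ≡⟨ ∑-sub (λ j → K₀ j * x) _ ⟩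
        sum (λ j → K₀ j * x) - sum (λ j → c * (K₀ j * u′ j)) ≡⟨ cong₂ _-_ (∑-*ʳ x K₀) (∑-*ˡ c (λ j → K₀ j * u′ j)) ⟩
        c * x - c * sum (λ j → K₀ j * u′ j) ∎
        where
        open ≡-Reasoning
        rearrange : ∀ k x c y → k * (x - c * y) ≡ k * x - c * (k * y)
        rearrange = ℤ-Ring.solve-∀

      solves : ∀ i → sum (λ j → K i j * (u i - u j)) ≡ c * a′ * b i
      solves zero = begin
        K zero zero * (u₀ - u₀) + sum (λ j → K₀ j * (u₀ - c * u′ j))
          ≡⟨ cong₂ _+_ (cong (K zero zero *_) (+-inverseʳ u₀)) (split₀ u₀) ⟩
        K zero zero * 0ℤ + (c * u₀ - c * S)  ≡⟨ finish (K zero zero) c a′ b₀ S ⟩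
        c * a′ * b₀ ∎
        where
        open ≡-Reasoning
        S = sum (λ j → K₀ j * u′ j)
        finish : ∀ k c a b s → k * 0ℤ + (c * (a * b + s) - c * s) ≡ c * a * b
        finish = ℤ-Ring.solve-∀
      solves (suc i) = begin
        K (suc i) zero * (c * u′ i - u₀) + sum (λ j → K (suc i) (suc j) * (c * u′ i - c * u′ j))
          ≡⟨ cong₂ _+_ (cong (_* (c * u′ i - u₀)) (sy (suc i) zero)) lemma ⟩
        K₀ i * (c * u′ i - u₀) + (a′ * b′ i - K₀ i * (c * u′ i - S))
          ≡⟨ finish (K₀ i) c (u′ i) a′ b₀ S (b (suc i)) ⟩
        c * a′ * b (suc i) ∎
        where
        open ≡-Reasoning
        S = sum (λ j → K₀ j * u′ j)
        finish : ∀ k c x a b₀ s b → k * (c * x - (a * b₀ + s)) + (a * (c * b + k * b₀) - k * (c * x - s)) ≡ c * a * b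
        finish = ℤ-Ring.solve-∀
        rearrange : ∀ c K k k′ x y → K * (c * x - c * y) ≡ (c * K + k * k′) * (x - y) - k * (k′ * (x - y))
        rearrange = ℤ-Ring.solve-∀
        lemma : sum (λ j → K (suc i) (suc j) * (c * u′ i - c * u′ j)) ≡ a′ * b′ i - K₀ i * (c * u′ i - S)
        lemma = begin
          sum (λ j → K (suc i) (suc j) * (c * u′ i - c * u′ j))
            ≡⟨ sum-cong-≗ (λ j → rearrange c (K (suc i) (suc j)) (K₀ i) (K₀ j) (u′ i) (u′ j)) ⟩
          sum (λ j → K′ i j * (u′ i - u′ j) - K₀ i * (K₀ j * (u′ i - u′ j)))
            ≡⟨ ∑-sub (λ j → K′ i j * (u′ i - u′ j)) _ ⟩
          sum (λ j → K′ i j * (u′ i - u′ j)) - sum (λ j → K₀ i * (K₀ j * (u′ i - u′ j)))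
            ≡⟨ cong₂ _-_ (sol′ i) (trans (∑-*ˡ (K₀ i) (λ j → K₀ j * (u′ i - u′ j))) (cong (K₀ i *_) (split (u′ i)))) ⟩
          a′ * b′ i - K₀ i * (c * u′ i - S) ∎

  ∑-pos : {f : Fin n → ℤ} → (∀ i → 0ℤ ≤ f i) → 0ℤ < sum f → ∃ λ i → 0ℤ < f i
  ∑-pos {zero}  nn p = contradiction p (<-irrefl refl)
  ∑-pos {suc n} {f} nn p with pos⊎≡0 (nn zero)
  ... | inj₁ q = zero , q
  ... | inj₂ q with i , r ← ∑-pos (nn ∘ suc) (subst (0ℤ <_) (trans (cong (_+ sum (f ∘ suc)) q) (+-identityˡ _)) p) = suc i , r

  term≤∑ : {f : Fin n → ℤ} → (∀ i → 0ℤ ≤ f i) → ∀ i → f i ≤ sum f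
  term≤∑ {suc n} {f} nn zero    = subst (_≤ sum f) (+-identityʳ _) (+-monoʳ-≤ (f zero) (∑-nonneg (nn ∘ suc)))
  term≤∑ {suc n} {f} nn (suc i) = ≤-trans (term≤∑ (nn ∘ suc) i)
    (subst (_≤ sum f) (+-identityˡ _) (+-monoˡ-≤ (sum (f ∘ suc)) (nn zero)))

  -- Hyperbolic forms and the reverse Cauchy-Schwarz inequality

  Matrix : ℕ → Set
  Matrix n = Fin n → Fin n → ℤ

  Symmetric : Matrix n → Set
  Symmetric K = ∀ i j → K i j ≡ K j i

  Nonneg : Matrix n → Set
  Nonneg K = ∀ i j → 0ℤ ≤ K i j

  dot : (Fin n → ℤ) → (Fin n → ℤ) → ℤ
  dot x y = sum (λ i → x i * y i)

  bil : Matrix n → (Fin n → ℤ) → (Fin n → ℤ) → ℤ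
  bil K x y = sum (λ i → x i * dot (K i) y)

  deg : Matrix n → Fin n → ℤ
  deg K i = sum (K i)

  -- The quadratic form with Gram matrix [K h; hᵀ q] on ℤⁿ ⊕ ℤ.
  quad : Matrix n → (Fin n → ℤ) → ℤ → (Fin n → ℤ) → ℤ → ℤ
  quad K h q v t = bil K v v + (+ 2 * t * dot h v + t * t * q)

  -- The Gram pairing of (1, …, 1; 0) with (v; t).
  pairing : Matrix n → (Fin n → ℤ) → (Fin n → ℤ) → ℤ → ℤ
  pairing K h v t = dot (deg K) v + t * sum h

  Hyperbolic : Matrix n → (Fin n → ℤ) → ℤ → Set
  Hyperbolic K h q = ∀ v t → pairing K h v t ≡ 0ℤ → quad K h q v t ≤ 0ℤ

  -- The form is `sum (deg K)` at (1, ..., 1; 0) and `q` at (0; 1), and these vectors pair to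
  -- `sum h`: this is equality in their reverse Cauchy-Schwarz inequality.
  Tight : Matrix n → (Fin n → ℤ) → ℤ → Set
  Tight K h q = q * sum (deg K) ≡ sum h * sum h

  dot-congʳ : ∀ x {y z : Fin n → ℤ} → y ≗ z → dot x y ≡ dot x z
  dot-congʳ x eq = sum-cong-≗ λ i → cong (x i *_) (eq i)

  dot-lin : ∀ c (x y z : Fin n → ℤ) → dot x (λ i → c * y i - z i) ≡ c * dot x y - dot x z
  dot-lin c x y z = begin
    dot x (λ i → c * y i - z i)            ≡⟨ sum-cong-≗ (λ i → expand c (x i) (y i) (z i)) ⟩
    sum (λ i → c * (x i * y i) - x i * z i) ≡⟨ ∑-sub (λ i → c * (x i * y i)) (λ i → x i * z i) ⟩
    sum (λ i → c * (x i * y i)) - dot x z   ≡⟨ cong (_- dot x z) (∑-*ˡ c (λ i → x i * y i)) ⟩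
    c * dot x y - dot x z ∎
    where
    open ≡-Reasoning
    expand : ∀ c x y z → x * (c * y - z) ≡ c * (x * y) - x * z
    expand = ℤ-Ring.solve-∀

  bil-linʳ : ∀ K c (x y z : Fin n → ℤ) → bil K x (λ i → c * y i - z i) ≡ c * bil K x y - bil K x z
  bil-linʳ K c x y z = trans (sum-cong-≗ λ i → cong (x i *_) (dot-lin c (K i) y z))
                             (dot-lin c x (λ i → dot (K i) y) (λ i → dot (K i) z))

  bil-sym : ∀ {K : Matrix n} → Symmetric K → ∀ x y → bil K x y ≡ bil K y x
  bil-sym {K = K} sy x y = begin
    sum (λ i → x i * dot (K i) y)              ≡⟨ sum-cong-≗ (λ i → sym (∑-*ˡ (x i) (λ j → K i j * y j))) ⟩
    sum (λ i → sum (λ j → x i * (K i j * y j))) ≡⟨ ∑-comm (λ i j → x i * (K i j * y j)) ⟩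
    sum (λ j → sum (λ i → x i * (K i j * y j)))
      ≡⟨ sum-cong-≗ (λ j → sum-cong-≗ (λ i → trans (cong (λ k → x i * (k * y j)) (sy i j)) (swap (x i) (K j i) (y j)))) ⟩
    sum (λ j → sum (λ i → y j * (K j i * x i))) ≡⟨ sum-cong-≗ (λ j → ∑-*ˡ (y j) (λ i → K j i * x i)) ⟩
    bil K y x ∎
    where
    open ≡-Reasoning
    swap : ∀ x k y → x * (k * y) ≡ y * (k * x)
    swap = ℤ-Ring.solve-∀

  bil-sub : ∀ {K : Matrix n} → Symmetric K → ∀ c v w →
    bil K (λ i → c * v i - w i) (λ i → c * v i - w i) ≡
    c * c * bil K v v - + 2 * c * bil K w v + bil K w w
  bil-sub {K = K} sy c v w = begin
    bil K y y                     ≡⟨ bil-linʳ K c y v w ⟩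
    c * bil K y v - bil K y w     ≡⟨ cong₂ (λ a b → c * a - b) (trans (bil-sym sy y v) (bil-linʳ K c v v w))
                                                              (trans (bil-sym sy y w) (bil-linʳ K c w v w)) ⟩
    c * (c * bil K v v - bil K v w) - (c * bil K w v - bil K w w)
      ≡⟨ cong (λ a → c * (c * bil K v v - a) - (c * bil K w v - bil K w w)) (bil-sym sy v w) ⟩
    c * (c * bil K v v - bil K w v) - (c * bil K w v - bil K w w)
      ≡⟨ collect c (bil K v v) (bil K w v) (bil K w w) ⟩
    c * c * bil K v v - + 2 * c * bil K w v + bil K w w ∎
    where
    open ≡-Reasoning
    y = λ i → c * v i - w i
    collect : ∀ c a b d → c * (c * a - b) - (c * b - d) ≡ c * c * a - + 2 * c * b + d
    collect = ℤ-Ring.solve-∀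

  dot-constʳ : ∀ (x : Fin n → ℤ) p → dot x (const p) ≡ sum x * p
  dot-constʳ x p = ∑-*ʳ p x

  bil-constʳ : ∀ (K : Matrix n) x p → bil K x (const p) ≡ dot (deg K) x * p
  bil-constʳ K x p = trans (sum-cong-≗ λ i → trans (cong (x i *_) (dot-constʳ (K i) p)) (rearrange (x i) (deg K i) p))
                           (∑-*ʳ p (λ i → deg K i * x i))
    where
    rearrange : ∀ x d p → x * (d * p) ≡ d * x * p
    rearrange = ℤ-Ring.solve-∀

  bil-const : ∀ (K : Matrix n) p → bil K (const p) (const p) ≡ sum (deg K) * p * p
  bil-const K p = trans (bil-constʳ K (const p) p) (cong (_* p) (dot-constʳ (deg K) p))

  -- Project (v; t) along (1, ..., 1; 0) and clear the denominator: (κ v - p; κ t) is orthogonal,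
  -- and its form is κ (κ Q(v; t) - p²).
  hyperbolic⇒reverse-cauchy-schwarz :
    ∀ {K : Matrix n} {h q} → Symmetric K → Hyperbolic K h q → 0ℤ < sum (deg K) →
    ∀ v t → sum (deg K) * quad K h q v t ≤ pairing K h v t * pairing K h v t
  hyperbolic⇒reverse-cauchy-schwarz {K = K} {h} {q} sy hyp 0<κ v t =
    i-j≤0⇒i≤j (*-cancelˡ-≤-pos _ _ κ {{positive 0<κ}}
      (subst₂ _≤_ expand (sym (*-zeroʳ κ)) (hyp v′ (κ * t) orthogonal)))
    where
    κ = sum (deg K)
    p = pairing K h v t
    v′ = λ i → κ * v i - p
    orthogonal : pairing K h v′ (κ * t) ≡ 0ℤ
    orthogonal = begin
      dot (deg K) v′ + κ * t * sum h
        ≡⟨ cong (_+ κ * t * sum h) (trans (dot-lin κ (deg K) v (const p)) (cong (λ x → κ * dot (deg K) v - x) (dot-constʳ (deg K) p))) ⟩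
      κ * dot (deg K) v - κ * (dot (deg K) v + t * sum h) + κ * t * sum h ≡⟨ cancel κ (dot (deg K) v) t (sum h) ⟩
      0ℤ ∎
      where
      open ≡-Reasoning
      cancel : ∀ κ d t s → κ * d - κ * (d + t * s) + κ * t * s ≡ 0ℤ
      cancel = ℤ-Ring.solve-∀
    expand : quad K h q v′ (κ * t) ≡ κ * (κ * quad K h q v t - p * p)
    expand = begin
      bil K v′ v′ + (+ 2 * (κ * t) * dot h v′ + κ * t * (κ * t) * q)
        ≡⟨ cong₂ (λ a b → a + (+ 2 * (κ * t) * b + κ * t * (κ * t) * q))
             (trans (bil-sub sy κ v (const p)) (cong₂ (λ a b → κ * κ * bil K v v - + 2 * κ * a + b)
               (trans (bil-sym sy (const p) v) (bil-constʳ K v p)) (bil-const K p)))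
             (trans (dot-lin κ h v (const p)) (cong (λ x → κ * dot h v - x) (dot-constʳ h p))) ⟩
      κ * κ * bil K v v - + 2 * κ * (dot (deg K) v * p) + κ * p * p +
        (+ 2 * (κ * t) * (κ * dot h v - sum h * p) + κ * t * (κ * t) * q)
        ≡⟨ collect κ (bil K v v) (dot (deg K) v) p t (dot h v) (sum h) q refl ⟩
      κ * (κ * quad K h q v t - p * p) ∎
      where
      open ≡-Reasoning
      collect : ∀ κ b d p t x s q → p ≡ d + t * s →
        κ * κ * b - + 2 * κ * (d * p) + κ * p * p + (+ 2 * (κ * t) * (κ * x - s * p) + κ * t * (κ * t) * q) ≡
        κ * (κ * (b + (+ 2 * t * x + t * t * q)) - p * p)
      collect κ b d .(d + t * s) t x s q refl = go κ b d t x s q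
        where
        go : ∀ κ b d t x s q →
          κ * κ * b - + 2 * κ * (d * (d + t * s)) + κ * (d + t * s) * (d + t * s) + (+ 2 * (κ * t) * (κ * x - s * (d + t * s)) + κ * t * (κ * t) * q) ≡
          κ * (κ * (b + (+ 2 * t * x + t * t * q)) - (d + t * s) * (d + t * s))
        go = ℤ-Ring.solve-∀

  -- Each pair is counted in both orders, so this is twice the Laplacian form of `K`; hence the
  -- factors 2 in `quad-identity`.
  dirichlet : Matrix n → (Fin n → ℤ) → ℤ
  dirichlet K w = sum (λ i → sum (λ j → K i j * ((w i - w j) * (w i - w j))))

  dirichlet-expand : ∀ {K : Matrix n} → Symmetric K → ∀ w →
    dirichlet K w ≡ + 2 * sum (λ i → deg K i * (w i * w i)) - + 2 * bil K w w
  dirichlet-expand {K = K} sy w = begin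
    dirichlet K w
      ≡⟨ sum-cong-≗ (λ i → trans (sum-cong-≗ λ j → expand (K i j) (w i) (w j))
           (trans (∑-sub (λ j → K i j * (w i * w i) + K i j * (w j * w j)) (λ j → + 2 * w i * (K i j * w j)))
                  (cong₂ _-_ (∑-distrib-+ (λ j → K i j * (w i * w i)) (λ j → K i j * (w j * w j)))
                             (∑-*ˡ (+ 2 * w i) (λ j → K i j * w j))))) ⟩
    sum (λ i → (sum (λ j → K i j * (w i * w i)) + sum (λ j → K i j * (w j * w j))) - + 2 * w i * dot (K i) w)
      ≡⟨ ∑-sub (λ i → sum (λ j → K i j * (w i * w i)) + sum (λ j → K i j * (w j * w j))) (λ i → + 2 * w i * dot (K i) w) ⟩
    sum (λ i → sum (λ j → K i j * (w i * w i)) + sum (λ j → K i j * (w j * w j))) - sum (λ i → + 2 * w i * dot (K i) w)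
      ≡⟨ cong₂ _-_ (trans (∑-distrib-+ (λ i → sum (λ j → K i j * (w i * w i))) (λ i → sum (λ j → K i j * (w j * w j))))
                          (cong₂ _+_ (sum-cong-≗ λ i → ∑-*ʳ (w i * w i) (K i)) transposed))
                   (trans (sum-cong-≗ λ i → *-assoc (+ 2) (w i) (dot (K i) w)) (∑-*ˡ (+ 2) (λ i → w i * dot (K i) w))) ⟩
    S + S - + 2 * bil K w w ≡⟨ cong (_- + 2 * bil K w w) (double S) ⟩
    + 2 * S - + 2 * bil K w w ∎
    where
    open ≡-Reasoning
    S = sum (λ i → deg K i * (w i * w i))
    expand : ∀ k x y → k * ((x - y) * (x - y)) ≡ k * (x * x) + k * (y * y) - + 2 * x * (k * y)
    expand = ℤ-Ring.solve-∀
    double : ∀ s → s + s ≡ + 2 * s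
    double = ℤ-Ring.solve-∀
    transposed : sum (λ i → sum (λ j → K i j * (w j * w j))) ≡ S
    transposed = trans (∑-comm (λ i j → K i j * (w j * w j)))
      (sum-cong-≗ λ j → trans (sum-cong-≗ λ i → cong (_* (w j * w j)) (sy i j)) (∑-*ʳ (w j * w j) (K j)))

  -- Kᵉ, hᵉ, qᵉ stand for the form of the link of e: these forms add up to the form K, h, q,
  -- and the pairing of the link form with (1, …, 1; 0) is row e of K and h.
  module LocalToGlobal
    (K : Matrix n) (h : Fin n → ℤ) (q : ℤ)
    (Kᵉ : Fin n → Matrix n) (hᵉ : Fin n → Fin n → ℤ) (qᵉ : Fin n → ℤ)
    (K-sym   : Symmetric K)
    (Kᵉ-sym  : ∀ e → Symmetric (Kᵉ e))
    (Kᵉ-nn   : ∀ e → Nonneg (Kᵉ e))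
    (hᵉ-nn   : ∀ e i → 0ℤ ≤ hᵉ e i)
    (K-sum   : ∀ i j → sum (λ e → Kᵉ e i j) ≡ K i j)
    (h-sum   : ∀ i → sum (λ e → hᵉ e i) ≡ h i)
    (q-sum   : sum qᵉ ≡ q)
    (Kᵉ-deg  : ∀ e i → deg (Kᵉ e) i ≡ K e i)
    (hᵉ-deg  : ∀ e → sum (hᵉ e) ≡ h e)
    (isolated : ∀ e → deg K e ≡ 0ℤ → h e ≡ 0ℤ × qᵉ e ≡ 0ℤ)
    (connected : ∀ z → LocallyConstant K z → ∀ e f → 0ℤ < deg K e → 0ℤ < deg K f → z e ≡ z f)
    (hyperbolic : ∀ e → 0ℤ < deg K e → Hyperbolic (Kᵉ e) (hᵉ e) (qᵉ e))
    where

    K-nn : Nonneg K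
    K-nn i j = subst (0ℤ ≤_) (K-sum i j) (∑-nonneg λ e → Kᵉ-nn e i j)

    deg-nn : ∀ e → 0ℤ ≤ deg K e
    deg-nn e = ∑-nonneg (K-nn e)

    K≡0 : ∀ {i} → deg K i ≡ 0ℤ → ∀ j → K i j ≡ 0ℤ
    K≡0 = ∑-nonneg-≡0 (K-nn _)

    Kᵉ≡0 : ∀ {i} → deg K i ≡ 0ℤ → ∀ e j → Kᵉ e i j ≡ 0ℤ
    Kᵉ≡0 d e j = ∑-nonneg-≡0 (λ e → Kᵉ-nn e _ j) (trans (K-sum _ j) (K≡0 d j)) e

    hᵉ≡0 : ∀ {i} → deg K i ≡ 0ℤ → ∀ e → hᵉ e i ≡ 0ℤ
    hᵉ≡0 d = ∑-nonneg-≡0 (λ e → hᵉ-nn e _) (trans (h-sum _) (proj₁ (isolated _ d)))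

    quad-sum : ∀ v t → sum (λ e → quad (Kᵉ e) (hᵉ e) (qᵉ e) v t) ≡ quad K h q v t
    quad-sum v t = begin
      sum (λ e → bil (Kᵉ e) v v + (+ 2 * t * dot (hᵉ e) v + t * t * qᵉ e))
        ≡⟨ ∑-distrib-+ (λ e → bil (Kᵉ e) v v) _ ⟩
      sum (λ e → bil (Kᵉ e) v v) + sum (λ e → + 2 * t * dot (hᵉ e) v + t * t * qᵉ e)
        ≡⟨ cong₂ _+_ bil-sum (trans (∑-distrib-+ (λ e → + 2 * t * dot (hᵉ e) v) (λ e → t * t * qᵉ e))
             (cong₂ _+_ (trans (∑-*ˡ (+ 2 * t) (λ e → dot (hᵉ e) v)) (cong (+ 2 * t *_) (dot-sum h hᵉ h-sum)))
                        (trans (∑-*ˡ (t * t) qᵉ) (cong (t * t *_) q-sum)))) ⟩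
      quad K h q v t ∎
      where
      open ≡-Reasoning
      dot-sum : ∀ x (xᵉ : Fin n → Fin n → ℤ) → (∀ i → sum (λ e → xᵉ e i) ≡ x i) → sum (λ e → dot (xᵉ e) v) ≡ dot x v
      dot-sum x xᵉ eq = trans (∑-comm (λ e i → xᵉ e i * v i))
        (sum-cong-≗ λ i → trans (∑-*ʳ (v i) (λ e → xᵉ e i)) (cong (_* v i) (eq i)))
      bil-sum : sum (λ e → bil (Kᵉ e) v v) ≡ bil K v v
      bil-sum = trans (∑-comm (λ e i → v i * dot (Kᵉ e i) v))
        (sum-cong-≗ λ i → trans (∑-*ˡ (v i) (λ e → dot (Kᵉ e i) v))
          (cong (v i *_) (dot-sum (K i) (λ e → Kᵉ e i) (K-sum i))))

    module Solution (v : Fin n → ℤ) (t : ℤ) (orthogonal : pairing K h v t ≡ 0ℤ) where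

      demand : Fin n → ℤ
      demand i = deg K i * v i + t * h i

      demand≡0 : ∀ {i} → deg K i ≡ 0ℤ → demand i ≡ 0ℤ
      demand≡0 {i} d = cong₂ _+_ (cong (_* v i) d) (trans (cong (t *_) (proj₁ (isolated i d))) (*-zeroʳ t))

      -- By `connected`, `z` is constant where degrees are positive, and `demand` vanishes
      -- elsewhere; the sum is therefore a multiple of the pairing of (1, ..., 1; 0) with (v; t).
      demand-orthogonal : ∀ z → LocallyConstant K z → sum (λ i → demand i * z i) ≡ 0ℤ
      demand-orthogonal z lc with pos⊎≡0 (∑-nonneg deg-nn)
      ... | inj₂ κ≡0 = ∑-0 λ i → cong (_* z i) (demand≡0 (∑-nonneg-≡0 deg-nn κ≡0 i))
      ... | inj₁ 0<κ with e , 0<e ← ∑-pos deg-nn 0<κ = begin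
        sum (λ i → demand i * z i) ≡⟨ sum-cong-≗ same ⟩
        sum (λ i → demand i * z e) ≡⟨ ∑-*ʳ (z e) demand ⟩
        sum demand * z e           ≡⟨ cong (_* z e) (trans (∑-distrib-+ (λ i → deg K i * v i) (λ i → t * h i))
                                        (trans (cong (λ x → dot (deg K) v + x) (∑-*ˡ t h)) orthogonal)) ⟩
        0ℤ ∎
        where
        open ≡-Reasoning
        same : ∀ i → demand i * z i ≡ demand i * z e
        same i with pos⊎≡0 (deg-nn i)
        ... | inj₁ 0<i = cong (demand i *_) (connected z lc i e 0<i 0<e)
        ... | inj₂ d   = trans (cong (_* z i) (demand≡0 d)) (cong (_* z e) (sym (demand≡0 d)))

      solution = laplacian-solvable n K demand K-sym K-nn demand-orthogonal
      a   = proj₁ solution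
      u   = proj₁ (proj₂ solution)
      0<a = proj₁ (proj₂ (proj₂ solution))
      s   = a * t

      w : Fin n → ℤ
      w i = u i - a * v i

      -- By `Kᵉ-deg` and `hᵉ-deg` the right-hand side is the pairing of (1, ..., 1; 0) with (u; s)
      -- in the link of `i`. The Laplacian system for `u` is chosen to give it this value.
      deg*w : ∀ i → deg K i * w i ≡ dot (K i) u + s * h i
      deg*w i = begin
        deg K i * (u i - a * v i)                                  ≡⟨ add (deg K i) (u i) a (v i) (dot (K i) u) ⟩
        (deg K i * u i - dot (K i) u) + dot (K i) u - a * (deg K i * v i)
          ≡⟨ cong (λ x → x + dot (K i) u - a * (deg K i * v i)) (trans (sym laplacian) (proj₂ (proj₂ (proj₂ solution)) i)) ⟩
        a * (deg K i * v i + t * h i) + dot (K i) u - a * (deg K i * v i)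
          ≡⟨ cancel a (deg K i * v i) t (h i) (dot (K i) u) ⟩
        dot (K i) u + s * h i ∎
        where
        open ≡-Reasoning
        add : ∀ d u a v x → d * (u - a * v) ≡ d * u - x + x - a * (d * v)
        add = ℤ-Ring.solve-∀
        cancel : ∀ a y t h x → a * (y + t * h) + x - a * y ≡ x + a * t * h
        cancel = ℤ-Ring.solve-∀
        sub : ∀ k x y → k * (x - y) ≡ k * x - k * y
        sub = ℤ-Ring.solve-∀
        laplacian : sum (λ j → K i j * (u i - u j)) ≡ deg K i * u i - dot (K i) u
        laplacian = trans (sum-cong-≗ λ j → sub (K i j) (u i) (u j))
          (trans (∑-sub (λ j → K i j * u i) (λ j → K i j * u j)) (cong (_- dot (K i) u) (∑-*ʳ (u i) (K i))))

      gap : Fin n → ℤ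
      gap e = deg K e * (w e * w e) - quad (Kᵉ e) (hᵉ e) (qᵉ e) u s

      -- In the link of `e`, reverse Cauchy-Schwarz at (u; s) reads deg · Q ≤ (deg · w)², and one
      -- factor deg cancels. If the degree is zero, the whole link form vanishes.
      gap-nn : ∀ e → 0ℤ ≤ gap e
      gap-nn e with pos⊎≡0 (deg-nn e)
      ... | inj₂ d = ≤-reflexive (sym (cong₂ _-_ (cong (_* (w e * w e)) d) quad≡0))
        where
        hᵉe≡0 : ∀ i → hᵉ e i ≡ 0ℤ
        hᵉe≡0 = ∑-nonneg-≡0 (hᵉ-nn e) (trans (hᵉ-deg e) (proj₁ (isolated e d)))
        Kᵉe≡0 : ∀ i j → Kᵉ e i j ≡ 0ℤ
        Kᵉe≡0 i = ∑-nonneg-≡0 (Kᵉ-nn e i) (trans (Kᵉ-deg e i) (K≡0 d i))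
        quad≡0 : quad (Kᵉ e) (hᵉ e) (qᵉ e) u s ≡ 0ℤ
        quad≡0 = cong₂ _+_
          (∑-0 λ i → trans (cong (u i *_) (∑-0 λ j → cong (_* u j) (Kᵉe≡0 i j))) (*-zeroʳ (u i)))
          (cong₂ _+_ (trans (cong (+ 2 * s *_) (∑-0 λ i → cong (_* u i) (hᵉe≡0 i))) (*-zeroʳ (+ 2 * s)))
                     (trans (cong (s * s *_) (proj₂ (isolated e d))) (*-zeroʳ (s * s))))
      ... | inj₁ 0<e = i≤j⇒0≤j-i (*-cancelˡ-≤-pos _ _ (deg K e) {{positive 0<e}}
                         (subst₂ _≤_ (cong (_* quad (Kᵉ e) (hᵉ e) (qᵉ e) u s) κᵉ) (trans (cong₂ _*_ pᵉ pᵉ) (rearrange (deg K e) (w e)))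
                           (hyperbolic⇒reverse-cauchy-schwarz (Kᵉ-sym e) (hyperbolic e 0<e)
                             (subst (0ℤ <_) (sym κᵉ) 0<e) u s)))
        where
        κᵉ : sum (deg (Kᵉ e)) ≡ deg K e
        κᵉ = sum-cong-≗ (Kᵉ-deg e)
        pᵉ : pairing (Kᵉ e) (hᵉ e) u s ≡ deg K e * w e
        pᵉ = trans (cong₂ _+_ (sum-cong-≗ λ i → cong (_* u i) (Kᵉ-deg e i)) (cong (s *_) (hᵉ-deg e))) (sym (deg*w e))
        rearrange : ∀ d w → d * w * (d * w) ≡ d * (d * (w * w))
        rearrange = ℤ-Ring.solve-∀

      energy-nn : ∀ i j → 0ℤ ≤ K i j * ((w i - w j) * (w i - w j))
      energy-nn i j = *-nonneg (K-nn i j) (square-nonneg (w i - w j))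

      -- With L the Laplacian of K, u solves L u = a (deg · v + t h); then w = u - a v measures how far the
      -- link forms at (u; s) are from their reverse Cauchy-Schwarz bounds, and the form at (v; t) is minus
      -- a sum of nonnegative terms.
      quad-identity : + 2 * sum gap + dirichlet K w + + 2 * (a * a) * quad K h q v t ≡ 0ℤ
      quad-identity = begin
        + 2 * sum gap + dirichlet K w + + 2 * (a * a) * quad K h q v t
          ≡⟨ cong₂ (λ x y → + 2 * x + y + + 2 * (a * a) * quad K h q v t)
               (trans (∑-sub (λ e → deg K e * (w e * w e)) _) (cong (λ x → S - x) (quad-sum u s))) (dirichlet-expand K-sym w) ⟩
        + 2 * (S - (bil K u u + (+ 2 * s * dot h u + s * s * q))) + (+ 2 * S - + 2 * bil K w w)
          + + 2 * (a * a) * (bil K v v + (+ 2 * t * dot h v + t * t * q))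
          ≡⟨ collect S (bil K u u) a t (dot h u) q (bil K w w) (bil K v v) (dot h v) ⟩
        + 4 * S - + 2 * (bil K u u + bil K w w - a * a * bil K v v) - + 4 * (a * t) * (dot h u - a * dot h v)
          ≡⟨ cong₂ (λ x y → + 4 * S - + 2 * (bil K u u + bil K w w - x) - + 4 * (a * t) * y) expand-v expand-h ⟩
        + 4 * S - + 2 * (bil K u u + bil K w w - (bil K u u - + 2 * bil K w u + bil K w w)) - + 4 * (a * t) * dot h w
          ≡⟨ cong (λ x → + 4 * x - + 2 * (bil K u u + bil K w w - (bil K u u - + 2 * bil K w u + bil K w w)) - + 4 * (a * t) * dot h w) expand-S ⟩
        + 4 * (bil K w u + a * t * dot h w) - + 2 * (bil K u u + bil K w w - (bil K u u - + 2 * bil K w u + bil K w w)) - + 4 * (a * t) * dot h w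
          ≡⟨ cancel (bil K w u) (a * t) (dot h w) (bil K u u) (bil K w w) ⟩
        0ℤ ∎
        where
        open ≡-Reasoning
        S = sum (λ i → deg K i * (w i * w i))
        collect : ∀ S U a t x q W V y →
          + 2 * (S - (U + (+ 2 * (a * t) * x + a * t * (a * t) * q))) + (+ 2 * S - + 2 * W) + + 2 * (a * a) * (V + (+ 2 * t * y + t * t * q)) ≡
          + 4 * S - + 2 * (U + W - a * a * V) - + 4 * (a * t) * (x - a * y)
        collect = ℤ-Ring.solve-∀
        cancel : ∀ b s d U W → + 4 * (b + s * d) - + 2 * (U + W - (U - + 2 * b + W)) - + 4 * s * d ≡ 0ℤ
        cancel = ℤ-Ring.solve-∀
        expand-S : S ≡ bil K w u + a * t * dot h w
        expand-S = trans (sum-cong-≗ λ i → trans (move (deg K i) (w i)) (trans (cong (w i *_) (deg*w i)) (distr (w i) (dot (K i) u) s (h i))))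
          (trans (∑-distrib-+ (λ i → w i * dot (K i) u) (λ i → s * (h i * w i))) (cong (λ x → bil K w u + x) (∑-*ˡ s (λ i → h i * w i))))
          where
          move : ∀ d w → d * (w * w) ≡ w * (d * w)
          move = ℤ-Ring.solve-∀
          distr : ∀ w x s h → w * (x + s * h) ≡ w * x + s * (h * w)
          distr = ℤ-Ring.solve-∀
        av : ∀ i → 1ℤ * u i - w i ≡ a * v i - 0ℤ
        av i = simp (u i) (a * v i)
          where
          simp : ∀ u x → 1ℤ * u - (u - x) ≡ x - 0ℤ
          simp = ℤ-Ring.solve-∀
        bil-0 : ∀ y → bil K (const 0ℤ) y ≡ 0ℤ
        bil-0 y = ∑-0 λ i → *-zeroˡ (dot (K i) y)
        expand-v : a * a * bil K v v ≡ bil K u u - + 2 * bil K w u + bil K w w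
        expand-v = begin
          a * a * bil K v v ≡⟨ simp a (bil K v v) ⟩
          a * a * bil K v v - + 2 * a * 0ℤ + 0ℤ
            ≡⟨ sym (cong₂ (λ x y → a * a * bil K v v - + 2 * a * x + y) (bil-0 v) (bil-0 (const 0ℤ))) ⟩
          a * a * bil K v v - + 2 * a * bil K (const 0ℤ) v + bil K (const 0ℤ) (const 0ℤ)
            ≡⟨ sym (bil-sub K-sym a v (const 0ℤ)) ⟩
          bil K (λ i → a * v i - 0ℤ) (λ i → a * v i - 0ℤ)
            ≡⟨ sym (sum-cong-≗ λ i → cong₂ _*_ (av i) (dot-congʳ (K i) av)) ⟩
          bil K (λ i → 1ℤ * u i - w i) (λ i → 1ℤ * u i - w i)
            ≡⟨ bil-sub K-sym 1ℤ u w ⟩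
          1ℤ * 1ℤ * bil K u u - + 2 * 1ℤ * bil K w u + bil K w w ≡⟨ ones (bil K u u) (bil K w u) (bil K w w) ⟩
          bil K u u - + 2 * bil K w u + bil K w w ∎
          where
          simp : ∀ a b → a * a * b ≡ a * a * b - + 2 * a * 0ℤ + 0ℤ
          simp = ℤ-Ring.solve-∀
          ones : ∀ x y z → 1ℤ * 1ℤ * x - + 2 * 1ℤ * y + z ≡ x - + 2 * y + z
          ones = ℤ-Ring.solve-∀
        expand-h : dot h u - a * dot h v ≡ dot h w
        expand-h = begin
          dot h u - a * dot h v     ≡⟨ cong (λ x → dot h u - x) (sym (∑-*ˡ a (λ i → h i * v i))) ⟩
          dot h u - sum (λ i → a * (h i * v i)) ≡⟨ sym (∑-sub (λ i → h i * u i) (λ i → a * (h i * v i))) ⟩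
          sum (λ i → h i * u i - a * (h i * v i)) ≡⟨ sum-cong-≗ (λ i → factor (h i) (u i) a (v i)) ⟩
          dot h w ∎
          where
          factor : ∀ h u a v → h * u - a * (h * v) ≡ h * (u - a * v)
          factor = ℤ-Ring.solve-∀

      0<2a² : 0ℤ < + 2 * (a * a)
      0<2a² = *-pos {+ 2} (+<+ (ℕ.s≤s ℕ.z≤n)) (*-pos 0<a 0<a)

      defect-nn : 0ℤ ≤ + 2 * sum gap
      defect-nn = *-nonneg {+ 2} (+≤+ ℕ.z≤n) (∑-nonneg gap-nn)

      energy-sum-nn : 0ℤ ≤ dirichlet K w
      energy-sum-nn = ∑-nonneg λ i → ∑-nonneg (energy-nn i)

      quad≤0 : quad K h q v t ≤ 0ℤ
      quad≤0 = *-cancelˡ-≤-pos _ _ (+ 2 * (a * a)) {{positive 0<2a²}}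
        (subst (+ 2 * (a * a) * quad K h q v t ≤_) (trans quad-identity (sym (*-zeroʳ (+ 2 * (a * a)))))
          (subst (_≤ + 2 * sum gap + dirichlet K w + + 2 * (a * a) * quad K h q v t) (+-identityˡ (+ 2 * (a * a) * quad K h q v t))
            (+-monoˡ-≤ (+ 2 * (a * a) * quad K h q v t) (+-nonneg defect-nn energy-sum-nn))))

      module Equality (quad≡0 : quad K h q v t ≡ 0ℤ) where

        both≡0 : + 2 * sum gap ≡ 0ℤ × dirichlet K w ≡ 0ℤ
        both≡0 = nonneg-+-≡0 defect-nn energy-sum-nn
          (trans (sym (trans (cong (λ x → + 2 * sum gap + dirichlet K w + x)
                        (trans (cong (+ 2 * (a * a) *_) quad≡0) (*-zeroʳ (+ 2 * (a * a))))) (+-identityʳ _)))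
                 quad-identity)

        gap≡0 : ∀ e → gap e ≡ 0ℤ
        gap≡0 = ∑-nonneg-≡0 gap-nn (*-cancelˡ-≡0 {+ 2} (+<+ (ℕ.s≤s ℕ.z≤n)) (proj₁ both≡0))

        w-locally-constant : LocallyConstant K w
        w-locally-constant i j 0<K = i-j≡0⇒i≡j _ _ (≡0-by-square (*-cancelˡ-≡0 0<K
          (∑-nonneg-≡0 (energy-nn i) (∑-nonneg-≡0 (λ i → ∑-nonneg (energy-nn i)) (proj₂ both≡0) i) j)))

    hyperbolic-global : Hyperbolic K h q
    hyperbolic-global v t orthogonal = Solution.quad≤0 v t orthogonal

    -- The test vector is (-H; κ) = κ (0; 1) - H (1, ..., 1; 0), the projection of (0; 1); tightness
    -- makes its form zero. Then all gaps vanish and `w` is constant on the support, hence so is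
    -- `u = w + a v`, with value `γ`. In the link of `e` the vanishing gap becomes k (k γ² + 2 s h γ
    -- + s² q) = (k γ + s h)², that is, s² (q k - h²) = 0.
    tight-local : 0ℤ < sum (deg K) → Tight K h q → ∀ e → Tight (Kᵉ e) (hᵉ e) (qᵉ e)
    tight-local 0<κ tight e with pos⊎≡0 (deg-nn e)
    ... | inj₂ d = trans (cong (_* sum (deg (Kᵉ e))) (proj₂ (isolated e d)))
                     (sym (cong (λ x → x * x) (trans (hᵉ-deg e) (proj₁ (isolated e d)))))
    ... | inj₁ 0<e = begin
        qᵉ e * sum (deg (Kᵉ e)) ≡⟨ cong (qᵉ e *_) (sum-cong-≗ (Kᵉ-deg e)) ⟩
        qᵉ e * k                ≡⟨ i-j≡0⇒i≡j _ _ (*-cancelˡ-≡0 (*-pos 0<s 0<s) final) ⟩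
        h e * h e               ≡⟨ sym (cong (λ x → x * x) (hᵉ-deg e)) ⟩
        sum (hᵉ e) * sum (hᵉ e) ∎
      where
      open ≡-Reasoning
      κ = sum (deg K)
      H = sum h
      k = deg K e

      orthogonal : pairing K h (const (- H)) κ ≡ 0ℤ
      orthogonal = trans (cong (_+ κ * H) (dot-constʳ (deg K) (- H))) (cancel κ H)
        where
        cancel : ∀ κ H → κ * (- H) + κ * H ≡ 0ℤ
        cancel = ℤ-Ring.solve-∀

      open Solution (const (- H)) κ orthogonal

      quad≡0 : quad K h q (const (- H)) κ ≡ 0ℤ
      quad≡0 = begin
        bil K (const (- H)) (const (- H)) + (+ 2 * κ * dot h (const (- H)) + κ * κ * q)
          ≡⟨ cong₂ (λ x y → x + (+ 2 * κ * y + κ * κ * q)) (bil-const K (- H)) (dot-constʳ h (- H)) ⟩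
        κ * (- H) * (- H) + (+ 2 * κ * (H * (- H)) + κ * κ * q) ≡⟨ collect κ H q ⟩
        κ * (q * κ - H * H) ≡⟨ cong (κ *_) (i≡j⇒i-j≡0 tight) ⟩
        κ * 0ℤ ≡⟨ *-zeroʳ κ ⟩
        0ℤ ∎
        where
        collect : ∀ κ H q → κ * (- H) * (- H) + (+ 2 * κ * (H * (- H)) + κ * κ * q) ≡ κ * (q * κ - H * H)
        collect = ℤ-Ring.solve-∀

      open Equality quad≡0

      0<s : 0ℤ < s
      0<s = *-pos 0<a 0<κ

      γ : ℤ
      γ = w e + a * (- H)

      u≡γ : ∀ i → 0ℤ < deg K i → u i ≡ γ
      u≡γ i 0<i = trans (simp (u i) (a * (- H))) (cong (_+ a * (- H)) (connected w w-locally-constant i e 0<i 0<e))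
        where
        simp : ∀ u x → u ≡ u - x + x
        simp = ℤ-Ring.solve-∀

      on-support : (x : Fin n → ℤ) → (∀ {i} → deg K i ≡ 0ℤ → x i ≡ 0ℤ) → ∀ i → x i * u i ≡ x i * γ
      on-support x zero-off i =
        [ (λ 0<i → cong (x i *_) (u≡γ i 0<i))
        , (λ d → trans (cong (_* u i) (zero-off d)) (sym (cong (_* γ) (zero-off d)))) ]′ (pos⊎≡0 (deg-nn i))

      quad-local : quad (Kᵉ e) (hᵉ e) (qᵉ e) u s ≡ k * γ * γ + (+ 2 * s * (h e * γ) + s * s * qᵉ e)
      quad-local = cong₂ (λ x y → x + (+ 2 * s * y + s * s * qᵉ e)) bil-local
        (trans (sum-cong-≗ (on-support (hᵉ e) (λ d → hᵉ≡0 d e))) (trans (dot-constʳ (hᵉ e) γ) (cong (_* γ) (hᵉ-deg e))))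
        where
        bil-local : bil (Kᵉ e) u u ≡ k * γ * γ
        bil-local = begin
          sum (λ i → u i * dot (Kᵉ e i) u)
            ≡⟨ sum-cong-≗ (λ i → trans (cong (u i *_) (trans (sum-cong-≗ (on-support (Kᵉ e i) (λ {j} d → trans (Kᵉ-sym e i j) (Kᵉ≡0 d e i))))
                   (trans (dot-constʳ (Kᵉ e i) γ) (cong (_* γ) (Kᵉ-deg e i))))) (rotate (u i) (K e i) γ)) ⟩
          sum (λ i → K e i * u i * γ)
            ≡⟨ sum-cong-≗ (λ i → cong (_* γ) (on-support (K e) (λ {j} d → trans (K-sym e j) (K≡0 d e)) i)) ⟩
          sum (λ i → K e i * γ * γ) ≡⟨ trans (∑-*ʳ γ (λ i → K e i * γ)) (cong (_* γ) (∑-*ʳ γ (K e))) ⟩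
          k * γ * γ ∎
          where
          rotate : ∀ u x γ → u * (x * γ) ≡ x * u * γ
          rotate = ℤ-Ring.solve-∀

      kw : k * w e ≡ k * γ + s * h e
      kw = trans (deg*w e) (cong (_+ s * h e) (trans (sum-cong-≗ (on-support (K e) (λ {j} d → trans (K-sym e j) (K≡0 d e)))) (dot-constʳ (K e) γ)))

      final : s * s * (qᵉ e * k - h e * h e) ≡ 0ℤ
      final = begin
        s * s * (qᵉ e * k - h e * h e) ≡⟨ complete k γ s (h e) (qᵉ e) ⟩
        k * (k * γ * γ + (+ 2 * s * (h e * γ) + s * s * qᵉ e)) - (k * γ + s * h e) * (k * γ + s * h e)
          ≡⟨ cong₂ _-_ (cong (k *_) (trans (sym quad-local) (sym (i-j≡0⇒i≡j _ _ (gap≡0 e))))) (sym (cong (λ x → x * x) kw)) ⟩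
        k * (k * (w e * w e)) - k * w e * (k * w e) ≡⟨ cancel k (w e) ⟩
        0ℤ ∎
        where
        complete : ∀ k γ s h q → s * s * (q * k - h * h) ≡
          k * (k * γ * γ + (+ 2 * s * (h * γ) + s * s * q)) - (k * γ + s * h) * (k * γ + s * h)
        complete = ℤ-Ring.solve-∀
        cancel : ∀ k w → k * (k * (w * w)) - k * w * (k * w) ≡ 0ℤ
        cancel = ℤ-Ring.solve-∀

  hyperbolic⇒bound : ∀ {n} {K : Matrix n} {h q} → Symmetric K → Hyperbolic K h q → 0ℤ ℤ.< sum (deg K) →
    q ℤ.* sum (deg K) ℤ.≤ sum h ℤ.* sum h
  hyperbolic⇒bound {n} {K} {h} {q} sy hyp 0<κ = subst₂ ℤ._≤_
    (trans (cong (sum (deg K) ℤ.*_) quad-0-1) (ℤ.*-comm (sum (deg K)) q))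
    (cong (λ x → x ℤ.* x) (trans (cong₂ ℤ._+_ (∑-0 λ i → ℤ.*-zeroʳ (deg K i)) (ℤ.*-identityˡ (sum h))) (ℤ.+-identityˡ (sum h))))
    (hyperbolic⇒reverse-cauchy-schwarz sy hyp 0<κ (const 0ℤ) 1ℤ)
    where
    quad-0-1 : quad K h q (const 0ℤ) 1ℤ ≡ q
    quad-0-1 = trans (cong₂ (λ x y → x ℤ.+ (+ 2 ℤ.* 1ℤ ℤ.* y ℤ.+ 1ℤ ℤ.* 1ℤ ℤ.* q))
        (∑-0 λ i → ℤ.*-zeroˡ (dot (K i) (const 0ℤ))) (∑-0 λ i → ℤ.*-zeroʳ (h i)))
      (ring q)
      where
      ring : ∀ q → 0ℤ ℤ.+ (+ 2 ℤ.* 1ℤ ℤ.* 0ℤ ℤ.+ 1ℤ ℤ.* 1ℤ ℤ.* q) ≡ q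
      ring = ℤ-Ring.solve-∀

  -- Three parallel classes with indicator vectors p₀, p₁, p₂: the form is 4 e₂ + 4 t e₁ + 3 t² in the class sums.
  module ThreeClasses (p₀ p₁ p₂ : Fin n → ℤ)
    (K : Matrix n) (h : Fin n → ℤ)
    (K-def : ∀ e f → K e f ≡ + 2 * (p₁ e + p₂ e) * p₀ f + + 2 * (p₀ e + p₂ e) * p₁ f + + 2 * (p₀ e + p₁ e) * p₂ f)
    (h-def : ∀ e → h e ≡ + 2 * p₀ e + + 2 * p₁ e + + 2 * p₂ e)
    where

    n₀ n₁ n₂ : ℤ
    n₀ = sum p₀
    n₁ = sum p₁
    n₂ = sum p₂

    e₂ : ℤ → ℤ → ℤ → ℤ
    e₂ x y z = x * y + y * z + x * z

    dot-combine : ∀ {g : Fin n → ℤ} a b c → (∀ e → g e ≡ a * p₀ e + b * p₁ e + c * p₂ e) →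
      ∀ x → dot g x ≡ a * dot p₀ x + b * dot p₁ x + c * dot p₂ x
    dot-combine {g} a b c eq x = begin
      dot g x
        ≡⟨ sum-cong-≗ (λ e → trans (cong (_* x e) (eq e)) (expand a b c (p₀ e) (p₁ e) (p₂ e) (x e))) ⟩
      sum (λ e → a * (p₀ e * x e) + b * (p₁ e * x e) + c * (p₂ e * x e))
        ≡⟨ ∑-distrib-+ (λ e → a * (p₀ e * x e) + b * (p₁ e * x e)) _ ⟩
      sum (λ e → a * (p₀ e * x e) + b * (p₁ e * x e)) + sum (λ e → c * (p₂ e * x e))
        ≡⟨ cong₂ _+_ (trans (∑-distrib-+ (λ e → a * (p₀ e * x e)) _)
             (cong₂ _+_ (∑-*ˡ a (λ e → p₀ e * x e)) (∑-*ˡ b (λ e → p₁ e * x e)))) (∑-*ˡ c (λ e → p₂ e * x e)) ⟩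
      a * dot p₀ x + b * dot p₁ x + c * dot p₂ x ∎
      where
      open ≡-Reasoning
      expand : ∀ a b c p q r x → (a * p + b * q + c * r) * x ≡ a * (p * x) + b * (q * x) + c * (r * x)
      expand = ℤ-Ring.solve-∀

    bil-classes : ∀ x y → bil K x y ≡ + 2 * (dot p₁ y + dot p₂ y) * dot p₀ x +
                                      + 2 * (dot p₀ y + dot p₂ y) * dot p₁ x + + 2 * (dot p₀ y + dot p₁ y) * dot p₂ x
    bil-classes x y = trans (sum-cong-≗ λ e → *-comm (x e) (dot (K e) y))
      (dot-combine (+ 2 * (dot p₁ y + dot p₂ y)) (+ 2 * (dot p₀ y + dot p₂ y)) (+ 2 * (dot p₀ y + dot p₁ y))
        (λ e → trans (dot-combine (+ 2 * (p₁ e + p₂ e)) (+ 2 * (p₀ e + p₂ e)) (+ 2 * (p₀ e + p₁ e)) (K-def e) y)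
                     (regroup (p₀ e) (p₁ e) (p₂ e) (dot p₀ y) (dot p₁ y) (dot p₂ y))) x)
      where
      regroup : ∀ p q r a b c → + 2 * (q + r) * a + + 2 * (p + r) * b + + 2 * (p + q) * c ≡
                                + 2 * (b + c) * p + + 2 * (a + c) * q + + 2 * (a + b) * r
      regroup = ℤ-Ring.solve-∀

    dot-h : ∀ x → dot h x ≡ + 2 * dot p₀ x + + 2 * dot p₁ x + + 2 * dot p₂ x
    dot-h = dot-combine (+ 2) (+ 2) (+ 2) h-def

    dot-1 : ∀ (x : Fin n → ℤ) → dot x (const 1ℤ) ≡ sum x
    dot-1 x = sum-cong-≗ λ i → *-identityʳ (x i)

    sum-h : sum h ≡ + 2 * n₀ + + 2 * n₁ + + 2 * n₂
    sum-h = trans (sym (dot-1 h)) (trans (dot-h (const 1ℤ))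
      (cong₂ _+_ (cong₂ (λ a b → + 2 * a + + 2 * b) (dot-1 p₀) (dot-1 p₁)) (cong (+ 2 *_) (dot-1 p₂))))

    dot-deg : ∀ x → dot (deg K) x ≡ + 2 * (n₁ + n₂) * dot p₀ x + + 2 * (n₀ + n₂) * dot p₁ x + + 2 * (n₀ + n₁) * dot p₂ x
    dot-deg x = trans (sym (*-identityʳ _)) (trans (sym (bil-constʳ K x 1ℤ)) (trans (bil-classes x (const 1ℤ))
      (substitute (dot-1 p₀) (dot-1 p₁) (dot-1 p₂))))
      where
      substitute : ∀ {a b c a′ b′ c′} → a ≡ a′ → b ≡ b′ → c ≡ c′ →
        + 2 * (b + c) * dot p₀ x + + 2 * (a + c) * dot p₁ x + + 2 * (a + b) * dot p₂ x ≡
        + 2 * (b′ + c′) * dot p₀ x + + 2 * (a′ + c′) * dot p₁ x + + 2 * (a′ + b′) * dot p₂ x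
      substitute refl refl refl = refl

    sum-deg : sum (deg K) ≡ + 4 * e₂ n₀ n₁ n₂
    sum-deg = trans (sym (dot-1 (deg K))) (trans (dot-deg (const 1ℤ)) (collect (dot-1 p₀) (dot-1 p₁) (dot-1 p₂)))
      where
      ring : ∀ a b c → + 2 * (b + c) * a + + 2 * (a + c) * b + + 2 * (a + b) * c ≡ + 4 * (a * b + b * c + a * c)
      ring = ℤ-Ring.solve-∀
      collect : ∀ {a b c} → a ≡ n₀ → b ≡ n₁ → c ≡ n₂ →
        + 2 * (n₁ + n₂) * a + + 2 * (n₀ + n₂) * b + + 2 * (n₀ + n₁) * c ≡ + 4 * e₂ n₀ n₁ n₂
      collect refl refl refl = ring n₀ n₁ n₂

    Δ : ℤ → ℤ → ℤ → ℤ
    Δ x y z = (x - y) * (x - y) + (y - z) * (y - z) + (x - z) * (x - z)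

    Δ-nn : ∀ x y z → 0ℤ ≤ Δ x y z
    Δ-nn x y z = +-nonneg (+-nonneg (square-nonneg (x - y)) (square-nonneg (y - z))) (square-nonneg (x - z))

    classes-hyperbolic : (∀ e → 0ℤ ≤ p₀ e) → (∀ e → 0ℤ ≤ p₁ e) → (∀ e → 0ℤ ≤ p₂ e) → 0ℤ < n₀ + n₁ + n₂ →
      Hyperbolic K h (+ 3)
    classes-hyperbolic nn₀ nn₁ nn₂ 0<s v t orthogonal = *-cancelˡ-≤-pos _ _ (s * s) {{positive (*-pos 0<s 0<s)}}
      (subst₂ _≤_ (sym negative) (sym (*-zeroʳ (s * s)))
        (neg-mono-≤ (+-nonneg (*-nonneg {+ 2 * e₂ n₀ n₁ n₂} (*-nonneg {+ 2} (+≤+ ℕ.z≤n) e₂-nn) (Δ-nn a b c)) (square-nonneg d))))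
      where
      s = n₀ + n₁ + n₂
      a = dot p₀ v
      b = dot p₁ v
      c = dot p₂ v
      -- The determinant of the consecutive differences of (n₀, n₁, n₂) and (a, b, c): three times
      -- its square is the defect in the Cauchy-Schwarz inequality for `Δ`.
      d = (n₀ - n₁) * (b - c) - (n₁ - n₂) * (a - b)
      e₂-nn : 0ℤ ≤ e₂ n₀ n₁ n₂
      e₂-nn = +-nonneg (+-nonneg (*-nonneg (∑-nonneg nn₀) (∑-nonneg nn₁)) (*-nonneg (∑-nonneg nn₁) (∑-nonneg nn₂)))
                       (*-nonneg (∑-nonneg nn₀) (∑-nonneg nn₂))
      polar : ℤ
      polar = (n₁ + n₂) * a + (n₀ + n₂) * b + (n₀ + n₁) * c + t * s
      polar≡0 : polar ≡ 0ℤ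
      polar≡0 = *-cancelˡ-≡0 {+ 2} (+<+ (ℕ.s≤s ℕ.z≤n))
        (trans (trans (ring n₀ n₁ n₂ a b c t) (sym (cong₂ (λ x y → x + t * y) (dot-deg v) sum-h))) orthogonal)
        where
        ring : ∀ x y z a b c t → + 2 * ((y + z) * a + (x + z) * b + (x + y) * c + t * (x + y + z)) ≡
          + 2 * (y + z) * a + + 2 * (x + z) * b + + 2 * (x + y) * c + t * (+ 2 * x + + 2 * y + + 2 * z)
        ring = ℤ-Ring.solve-∀
      -- Cauchy-Schwarz for the positive semidefinite form Δ.
      key : ∀ x y z a b c t →
        (x + y + z) * (x + y + z) * ((+ 2 * (b + c) * a + + 2 * (a + c) * b + + 2 * (a + b) * c) +
          (+ 2 * t * (+ 2 * a + + 2 * b + + 2 * c) + t * t * + 3)) ≡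
        - (+ 2 * (x * y + y * z + x * z) * ((a - b) * (a - b) + (b - c) * (b - c) + (a - c) * (a - c)) +
           ((x - y) * (b - c) - (y - z) * (a - b)) * ((x - y) * (b - c) - (y - z) * (a - b)))
        + ((y + z) * a + (x + z) * b + (x + y) * c + t * (x + y + z)) *
          ((x + y + z) * (+ 2 * (a + b + c) + + 3 * t) + ((x - y) * (a - b) + (y - z) * (b - c) + (x - z) * (a - c)))
      key = ℤ-Ring.solve-∀
      negative : s * s * quad K h (+ 3) v t ≡ - (+ 2 * e₂ n₀ n₁ n₂ * Δ a b c + d * d)
      negative = trans (cong₂ (λ x y → s * s * (x + (+ 2 * t * y + t * t * + 3))) (bil-classes v v) (dot-h v))
        (trans (key n₀ n₁ n₂ a b c t)
          (trans (cong (λ x → - (+ 2 * e₂ n₀ n₁ n₂ * Δ a b c + d * d) +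
                   x * (s * (+ 2 * (a + b + c) + + 3 * t) + ((n₀ - n₁) * (a - b) + (n₁ - n₂) * (b - c) + (n₀ - n₂) * (a - c)))) polar≡0)
                 (+-identityʳ _)))

    -- The two sides of `Tight` differ by `+ 2 * Δ n₀ n₁ n₂`, a sum of squares of differences.
    classes-tight : Tight K h (+ 3) → n₀ ≡ n₁ × n₁ ≡ n₂
    classes-tight tight =
      i-j≡0⇒i≡j n₀ n₁ (≡0-by-square (proj₁ xy≡0)) , i-j≡0⇒i≡j n₁ n₂ (≡0-by-square (proj₂ xy≡0))
      where
      ring : ∀ x y z → + 2 * ((x - y) * (x - y) + (y - z) * (y - z) + (x - z) * (x - z)) ≡
        (+ 2 * x + + 2 * y + + 2 * z) * (+ 2 * x + + 2 * y + + 2 * z) - + 3 * (+ 4 * (x * y + y * z + x * z))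
      ring = ℤ-Ring.solve-∀
      Δ≡0 : Δ n₀ n₁ n₂ ≡ 0ℤ
      Δ≡0 = *-cancelˡ-≡0 {+ 2} (+<+ (ℕ.s≤s ℕ.z≤n)) (trans (ring n₀ n₁ n₂)
        (trans (sym (cong₂ (λ x y → x * x - + 3 * y) sum-h sum-deg)) (i≡j⇒i-j≡0 (sym tight))))
      xy≡0 = nonneg-+-≡0 (square-nonneg (n₀ - n₁)) (square-nonneg (n₁ - n₂))
        (proj₁ (nonneg-+-≡0 (+-nonneg (square-nonneg (n₀ - n₁)) (square-nonneg (n₁ - n₂))) (square-nonneg (n₀ - n₂)) Δ≡0))

-- Forests of a multigraph as words of edges

module Multigraph {N m : ℕ} (src tgt : Fin m → Fin N) where

  private
    V = Fin N
    E = Fin m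

  -- Union-find: the representative of v in its component of the graph with edges w.
  rep : List E → V → V
  rep []      v = v
  rep (e ∷ w) v with rep w v Fin.≟ rep w (tgt e)
  ... | yes _ = rep w (src e)
  ... | no  _ = rep w v

  Linked : List E → Rel V 0ℓ
  Linked w u v = rep w u ≡ rep w v

  linked? : ∀ w u v → Dec (Linked w u v)
  linked? w u v = rep w u Fin.≟ rep w v

  -- Letters are added from the right. A loop or a repeated letter has linked ends and so counts as
  -- a cycle; the acyclic words are thus the orderings of forests.
  Acyclic : List E → Set
  Acyclic []      = ⊤
  Acyclic (e ∷ w) = ¬ Linked w (src e) (tgt e) × Acyclic w

  acyclic? : ∀ w → Dec (Acyclic w)
  acyclic? []      = yes tt
  acyclic? (e ∷ w) = ¬? (linked? w (src e) (tgt e)) ×-dec acyclic? w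

  rep-yes : ∀ e w {v} → Linked w v (tgt e) → rep (e ∷ w) v ≡ rep w (src e)
  rep-yes e w {v} p with rep w v Fin.≟ rep w (tgt e)
  ... | yes _ = refl
  ... | no ¬p = contradiction p ¬p

  rep-no : ∀ e w {v} → ¬ Linked w v (tgt e) → rep (e ∷ w) v ≡ rep w v
  rep-no e w {v} ¬p with rep w v Fin.≟ rep w (tgt e)
  ... | yes p = contradiction p ¬p
  ... | no _  = refl

  linked-weaken : ∀ e w {u v} → Linked w u v → Linked (e ∷ w) u v
  linked-weaken e w {u} {v} p with linked? w u (tgt e)
  ... | yes q = sym (rep-yes e w (trans (sym p) q))
  ... | no ¬q = trans p (sym (rep-no e w (¬q ∘ trans p)))

  linked-head : ∀ e w → Linked (e ∷ w) (src e) (tgt e)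
  linked-head e w with linked? w (src e) (tgt e)
  ... | yes _ = sym (rep-yes e w refl)
  ... | no  _ = sym (rep-yes e w refl)

  linked-edge : ∀ {e w} → e ∈ w → Linked w (src e) (tgt e)
  linked-edge {w = e ∷ w} (here refl) = linked-head e w
  linked-edge {w = e ∷ w} (there e∈w) = linked-weaken e w (linked-edge e∈w)

  -- Following the merges in `rep` relates every vertex to its representative by `R`. Most uses take
  -- for `R` the kernel of a function on vertices.
  linked-universal : ∀ {ℓ} {R : Rel V ℓ} → IsEquivalence R → ∀ w → (∀ {e} → e ∈ w → R (src e) (tgt e)) →
    ∀ {u v} → Linked w u v → R u v
  linked-universal {R = R} R-equiv w edge {u} {v} p =
    trans′ (sym′ (to-rep w edge u)) (subst (λ x → R x v) (sym p) (to-rep w edge v))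
    where
    open IsEquivalence R-equiv renaming (refl to refl′; sym to sym′; trans to trans′)
    to-rep : ∀ w → (∀ {e} → e ∈ w → R (src e) (tgt e)) → ∀ v → R (rep w v) v
    to-rep []      edge v = refl′
    to-rep (e ∷ w) edge v with rep w v Fin.≟ rep w (tgt e)
    ... | no  _ = to-rep w (edge ∘ there) v
    ... | yes p = trans′ (to-rep w (edge ∘ there) (src e)) (trans′ (edge (here refl))
                    (trans′ (sym′ (to-rep w (edge ∘ there) (tgt e)))
                      (subst (λ x → R x v) p (to-rep w (edge ∘ there) v))))

  kernel-isEquivalence : ∀ {A : Set} (f : V → A) → IsEquivalence (λ u v → f u ≡ f v)
  kernel-isEquivalence f = record { refl = refl ; sym = sym ; trans = trans }

  linked-mono : ∀ {w w′} → w ⊆ w′ → ∀ {u v} → Linked w u v → Linked w′ u v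
  linked-mono {w} {w′} w⊆w′ = linked-universal (kernel-isEquivalence (rep w′)) w (linked-edge ∘ w⊆w′)

  linked-∷⁻ : ∀ e w {u v} → Linked (e ∷ w) u v → ¬ Linked w u v →
    (Linked w u (src e) × Linked w v (tgt e)) ⊎ (Linked w u (tgt e) × Linked w v (src e))
  linked-∷⁻ e w {u} {v} p ¬q with linked? w u (tgt e) | linked? w v (tgt e)
  ... | yes a | yes b = contradiction (trans a (sym b)) ¬q
  ... | yes a | no  _ = inj₂ (a , sym p)
  ... | no  _ | yes b = inj₁ (p , b)
  ... | no  _ | no  _ = contradiction p ¬q

  -- If `f` closed a cycle with `e ∷ w`, that cycle would use `e`, and the rest of it would link the
  -- ends of `e` in `f ∷ w`.
  acyclic-swap : ∀ e f w → Acyclic (e ∷ f ∷ w) → Acyclic (f ∷ e ∷ w)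
  acyclic-swap e f w (¬e , ¬f , acyclic) = ¬f′ , ¬e ∘ linked-weaken f w , acyclic
    where
    ¬f′ : ¬ Linked (e ∷ w) (src f) (tgt f)
    ¬f′ p with linked-∷⁻ e w p ¬f
    ... | inj₁ (a , b) = ¬e (trans (linked-weaken f w (sym a)) (trans (linked-head f w) (linked-weaken f w b)))
    ... | inj₂ (a , b) = ¬e (trans (linked-weaken f w (sym b)) (trans (sym (linked-head f w)) (linked-weaken f w a)))

  acyclic-↭ : ∀ {w w′} → w ↭ w′ → Acyclic w → Acyclic w′
  acyclic-↭ Perm.refl         a        = a
  acyclic-↭ (Perm.prep e p)   (¬e , a) = ¬e ∘ linked-mono (∈-resp-↭ (Perm.↭-sym p)) , acyclic-↭ p a
  acyclic-↭ (Perm.swap e f p) (¬e , ¬f , a) =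
    acyclic-swap e f _ (¬e ∘ linked-mono (∈-resp-↭ (Perm.prep f (Perm.↭-sym p))) ,
                        ¬f ∘ linked-mono (∈-resp-↭ (Perm.↭-sym p)) , acyclic-↭ p a)
  acyclic-↭ (Perm.trans p q)  a        = acyclic-↭ q (acyclic-↭ p a)

  acyclic⇒∉ : ∀ {e w} → Acyclic (e ∷ w) → e ∉ w
  acyclic⇒∉ (¬e , _) e∈w = ¬e (linked-edge e∈w)

  acyclic⇒unique : ∀ {w} → Acyclic w → Unique w
  acyclic⇒unique {[]}    _ = []
  acyclic⇒unique {e ∷ w} a@(_ , aw) =
    All.tabulate (λ x∈w e≡x → acyclic⇒∉ a (subst (_∈ w) (sym e≡x) x∈w)) ∷ acyclic⇒unique aw

  -- A bijection between the components of `w` and `Fin k`, presented on vertices.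
  record Labelling (w : List E) (k : ℕ) : Set where
    field
      label      : V → Fin k
      surjective : ∀ i → ∃ λ v → label v ≡ i
      sound      : ∀ {u v} → Linked w u v → label u ≡ label v
      complete   : ∀ {u v} → label u ≡ label v → Linked w u v

  open Labelling

  -- The label of `tgt e` is punched out, and its vertices take over the label of `src e`.
  merge : ∀ {e w k} → ¬ Linked w (src e) (tgt e) → Labelling w (suc k) → Labelling (e ∷ w) k
  merge {e} {w} {k} ¬e L = record { label = label′ ; surjective = surj ; sound = λ {u} {v} → sound′ u v ; complete = λ {u} {v} → complete′ u v }
    where
    b≢a : label L (tgt e) ≢ label L (src e)
    b≢a p = ¬e (complete L (sym p))

    label′ : V → Fin k
    label′ v with label L (tgt e) Fin.≟ label L v
    ... | yes _ = punchOut b≢a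
    ... | no ¬p = punchOut ¬p

    label-yes : ∀ {v} → label L (tgt e) ≡ label L v → label′ v ≡ punchOut b≢a
    label-yes {v} p with label L (tgt e) Fin.≟ label L v
    ... | yes _ = refl
    ... | no ¬p = contradiction p ¬p

    label-no : ∀ {v} (¬p : label L (tgt e) ≢ label L v) → label′ v ≡ punchOut ¬p
    label-no {v} ¬p with label L (tgt e) Fin.≟ label L v
    ... | yes p = contradiction p ¬p
    ... | no _  = Fin.punchOut-cong (label L (tgt e)) refl

    surj : ∀ i → ∃ λ v → label′ v ≡ i
    surj i with v , eq ← surjective L (punchIn (label L (tgt e)) i) =
      v , trans (label-no ¬p) (trans (Fin.punchOut-cong (label L (tgt e)) eq) (Fin.punchOut-punchIn (label L (tgt e))))
      where
      ¬p : label L (tgt e) ≢ label L v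
      ¬p p = Fin.punchInᵢ≢i (label L (tgt e)) i (trans (sym eq) (sym p))

    sound′ : ∀ u v → Linked (e ∷ w) u v → label′ u ≡ label′ v
    sound′ u v = linked-universal (kernel-isEquivalence label′) (e ∷ w) edge
      where
      edge : ∀ {x} → x ∈ e ∷ w → label′ (src x) ≡ label′ (tgt x)
      edge (here refl) = trans (label-no b≢a) (sym (label-yes refl))
      edge {x} (there x∈w) with label L (tgt e) Fin.≟ label L (src x)
      ... | yes p = sym (label-yes (trans p (sound L (linked-edge x∈w))))
      ... | no ¬p = sym (trans (label-no (λ q → ¬p (trans q (sym (sound L (linked-edge x∈w))))))
                               (Fin.punchOut-cong (label L (tgt e)) (sym (sound L (linked-edge x∈w)))))

    complete′ : ∀ u v → label′ u ≡ label′ v → Linked (e ∷ w) u v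
    complete′ u v p with label L (tgt e) Fin.≟ label L u | label L (tgt e) Fin.≟ label L v
    ... | yes a | yes b = linked-weaken e w (complete L (trans (sym a) b))
    ... | yes a | no ¬b = trans (linked-weaken e w (complete L (sym a))) (trans (sym (linked-head e w))
                            (linked-weaken e w (complete L (Fin.punchOut-injective b≢a ¬b p))))
    ... | no ¬a | yes b = trans (linked-weaken e w (complete L (Fin.punchOut-injective ¬a b≢a p)))
                            (trans (linked-head e w) (linked-weaken e w (complete L b)))
    ... | no ¬a | no ¬b = linked-weaken e w (complete L (Fin.punchOut-injective ¬a ¬b p))

  labelling : ∀ w k → Acyclic w → length w ℕ.+ k ≡ N → Labelling w k
  labelling []      k _        refl = record
    { label = id ; surjective = λ i → i , refl ; sound = id ; complete = id }
  labelling (e ∷ w) k (¬e , a) eq   = merge ¬e (labelling w (suc k) a (trans (ℕ.+-suc (length w) k) eq))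

  acyclic-length : ∀ w → Acyclic w → length w ℕ.≤ N
  acyclic-length []      _ = z≤n
  acyclic-length (e ∷ w) (¬e , a) with ℕ.m≤n⇒∃[o]m+o≡n (acyclic-length w a)
  ... | zero  , eq = contradiction (label (labelling w 0 a eq) (src e)) Fin.¬Fin0
  ... | suc k , eq = ℕ.m+n≤o⇒m≤o (suc (length w)) (ℕ.≤-reflexive (trans (sym (ℕ.+-suc (length w) k)) eq))

  acyclic-length< : ∀ {w} → V → Acyclic w → length w ℕ.< N
  acyclic-length< {w} v a with ℕ.m≤n⇒∃[o]m+o≡n (acyclic-length w a)
  ... | zero  , eq = contradiction (label (labelling w 0 a eq) v) Fin.¬Fin0
  ... | suc k , eq = ℕ.m+n≤o⇒m≤o (suc (length w)) (ℕ.≤-reflexive (trans (sym (ℕ.+-suc (length w) k)) eq))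

  surjection⇒≤ : ∀ {j k} (f : Fin j → Fin k) → (∀ i → ∃ λ x → f x ≡ i) → k ℕ.≤ j
  surjection⇒≤ f surj = Fin.injective⇒≤ {f = proj₁ ∘ surj} λ {x} {y} eq →
    trans (sym (proj₂ (surj x))) (trans (cong f eq) (proj₂ (surj y)))

  -- Otherwise every component of `w′` lies in a component of `w`, so `w` has no more components
  -- than `w′`; but a forest with l edges has N - l of them.
  acyclic-augment : ∀ {w w′} → Acyclic w → Acyclic w′ → length w ℕ.< length w′ → ∃ λ e → e ∈ w′ × Acyclic (e ∷ w)
  acyclic-augment {w} {w′} a a′ lt with any? (λ e → ¬? (linked? w (src e) (tgt e))) w′
  ... | yes p with e , e∈w′ , ¬e ← find p = e , e∈w′ , ¬e , a
  ... | no ¬p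
    with k , eq ← ℕ.m≤n⇒∃[o]m+o≡n (acyclic-length w a)
       | k′ , eq′ ← ℕ.m≤n⇒∃[o]m+o≡n (acyclic-length w′ a′) =
    contradiction lt (ℕ.≤⇒≯ (ℕ.+-cancelʳ-≤ k′ _ _ (begin
      length w′ ℕ.+ k′ ≡⟨ trans eq′ (sym eq) ⟩
      length w ℕ.+ k   ≤⟨ ℕ.+-monoʳ-≤ (length w) k≤k′ ⟩
      length w ℕ.+ k′  ∎)))
    where
    open ℕ.≤-Reasoning
    L  = labelling w k a eq
    L′ = labelling w′ k′ a′ eq′
    spanned : ∀ {u v} → Linked w′ u v → Linked w u v
    spanned = linked-universal (kernel-isEquivalence (rep w)) w′ λ {e} e∈w′ →
      decidable-stable (linked? w (src e) (tgt e)) (All.lookup (¬Any⇒All¬ w′ ¬p) e∈w′)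
    k≤k′ : k ℕ.≤ k′
    k≤k′ = surjection⇒≤ (label L ∘ proj₁ ∘ surjective L′) λ i →
      let v , lv≡i = surjective L i
          v′ , eq = surjective L′ (label L′ v)
      in label L′ v , trans (sound L (spanned (complete L′ eq))) lv≡i

  -- Connectedness by the edges satisfying P: every vertex function constant along them is constant.
  Spanning : (E → Set) → Set
  Spanning P = ∀ {k} (f : V → Fin k) → (∀ e → P e → f (src e) ≡ f (tgt e)) → ∀ u v → f u ≡ f v

  -- If every edge satisfying `P` stayed inside a component of `w`, the component labels would be
  -- constant along these edges, hence constant; but the length leaves at least two labels.
  acyclic-extend : ∀ {P : E → Set} → (∀ e → Dec (P e)) → Spanning P →
    ∀ {w} → Acyclic w → suc (length w) ℕ.< N → ∃ λ e → P e × Acyclic (e ∷ w)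
  acyclic-extend P? span {w} a lt with Fin.any? (λ e → P? e ×-dec ¬? (linked? w (src e) (tgt e)))
  ... | yes (e , pe , ¬e) = e , pe , ¬e , a
  ... | no ¬p
    with o , eq ← ℕ.m≤n⇒∃[o]m+o≡n lt
    with L ← labelling w (suc (suc o)) a (trans (ℕ.+-suc _ (suc o)) (trans (cong suc (ℕ.+-suc _ o)) eq)) =
    contradiction (trans (sym (proj₂ (surjective L zero))) (trans (constant _ _) (proj₂ (surjective L (suc zero))))) λ ()
    where
    constant : ∀ u v → label L u ≡ label L v
    constant = span (label L) λ e pe → sound L
      (decidable-stable (linked? w (src e) (tgt e)) λ ¬e → ¬p (e , pe , ¬e))

  acyclic-extend-by : ∀ {P : E → Set} → (∀ e → Dec (P e)) → Spanning P →
    ∀ j {w} → All P w → Acyclic w → j ℕ.+ length w ℕ.< N → ∃ λ w′ → length w′ ≡ j ℕ.+ length w × All P w′ × Acyclic w′ × w ⊆ w′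
  acyclic-extend-by P? span zero    {w} ps a lt = w , refl , ps , a , id
  acyclic-extend-by P? span (suc j) {w} ps a lt
    with w′ , len , ps′ , a′ , w⊆w′ ← acyclic-extend-by P? span j ps a (ℕ.<-trans (ℕ.n<1+n _) lt)
    with e , pe , ae ← acyclic-extend P? span a′ (subst (λ l → suc l ℕ.< N) (sym len) lt) =
    e ∷ w′ , cong suc len , pe ∷ ps′ , ae , there ∘ w⊆w′

-- Counting extensions of forests, and the induction for hyperbolicity

module Extensions {N m : ℕ} (src tgt : Fin m → Fin N) where

  open Multigraph src tgt
  open import Data.Integer.Base using (_+_; _*_; _≤_; _<_)
  open import Data.Integer.Properties using (≤-reflexive; <-irrefl; <-≤-trans)
  open import Algebra.Properties.Semiring.Sum ℤ.+-*-semiring using (sum; sum-cong-≗; ∑-distrib-+)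

  private
    V = Fin N
    E = Fin m

  -- The number of words of j letters that extend w to an acyclic word; each set of j edges is counted j! times.
  extensions : ℕ → List E → ℤ
  extensions zero    w = indicator (acyclic? w)
  extensions (suc j) w = sum (λ e → extensions j (e ∷ w))

  extensions-nn : ∀ j w → 0ℤ ≤ extensions j w
  extensions-nn zero    w = indicator-nn (acyclic? w)
  extensions-nn (suc j) w = ∑-nonneg λ e → extensions-nn j (e ∷ w)

  extensions-↭ : ∀ j {w w′} → w ↭ w′ → extensions j w ≡ extensions j w′
  extensions-↭ zero    p = indicator-⇔ (acyclic? _) (acyclic? _) (acyclic-↭ p) (acyclic-↭ (Perm.↭-sym p))
  extensions-↭ (suc j) p = sum-cong-≗ λ e → extensions-↭ j (Perm.prep e p)

  extensions-cyclic : ∀ j w → ¬ Acyclic w → extensions j w ≡ 0ℤ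
  extensions-cyclic zero    w ¬a = indicator-false (acyclic? _) ¬a
  extensions-cyclic (suc j) w ¬a = ∑-0 λ e → extensions-cyclic j (e ∷ w) (¬a ∘ proj₂)

  rotate₃ : ∀ (e f g : E) w → e ∷ f ∷ g ∷ w ↭ f ∷ g ∷ e ∷ w
  rotate₃ e f g w = Perm.trans (Perm.swap e f Perm.refl) (Perm.prep f (Perm.swap e g Perm.refl))

  form-K : List E → ℕ → Matrix m
  form-K w j e f = + 2 * extensions j (f ∷ e ∷ w)

  form-h : List E → ℕ → E → ℤ
  form-h w j e = + 2 * extensions j (e ∷ w)

  form-q : List E → ℕ → ℤ
  form-q w j = + 3 * extensions j w

  form-deg : ∀ w j e → deg (form-K w j) e ≡ + 2 * extensions (suc j) (e ∷ w)
  form-deg w j e = ∑-*ˡ (+ 2) (λ f → extensions j (f ∷ e ∷ w))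

  form-h-sum : ∀ w j → sum (form-h w j) ≡ + 2 * extensions (suc j) w
  form-h-sum w j = ∑-*ˡ (+ 2) (λ e → extensions j (e ∷ w))

  form-deg-sum : ∀ w j → sum (deg (form-K w j)) ≡ + 2 * extensions (suc (suc j)) w
  form-deg-sum w j = trans (sum-cong-≗ (form-deg w j)) (∑-*ˡ (+ 2) (λ e → extensions (suc j) (e ∷ w)))

  form-K-sym : ∀ w j → Symmetric (form-K w j)
  form-K-sym w j e f = cong (+ 2 *_) (extensions-↭ j (Perm.swap f e Perm.refl))

  double-nn : ∀ {x} → 0ℤ ≤ x → 0ℤ ≤ + 2 * x
  double-nn = *-nonneg {+ 2} (+≤+ z≤n)

  module Classes {w : List E} (a : Acyclic w) (L : Labelling w 3) where
    open Labelling L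

    -- An edge joining two of the three components is classified by the third component.
    omits? : ∀ (i x y : Fin 3) → Dec ((x ≢ y) × (i ≢ x) × (i ≢ y))
    omits? i x y = ¬? (x Fin.≟ y) ×-dec (¬? (i Fin.≟ x) ×-dec ¬? (i Fin.≟ y))

    class : Fin 3 → E → ℤ
    class i e = indicator (omits? i (label (src e)) (label (tgt e)))

    class-nn : ∀ i e → 0ℤ ≤ class i e
    class-nn i e = indicator-nn (omits? i (label (src e)) (label (tgt e)))

    p₀ p₁ p₂ : E → ℤ
    p₀ = class zero
    p₁ = class (suc zero)
    p₂ = class (suc (suc zero))

    extension₁ : ∀ e → extensions 0 (e ∷ w) ≡ p₀ e + p₁ e + p₂ e
    extension₁ e = trans (indicator-⇔ (acyclic? (e ∷ w)) (¬? (label (src e) Fin.≟ label (tgt e)))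
                            (λ (¬e , _) → ¬e ∘ complete) (λ ¬p → ¬p ∘ sound , a))
                         (table (label (src e)) (label (tgt e)))
      where
      lhs rhs : Fin 3 → Fin 3 → ℤ
      lhs x y = indicator (¬? (x Fin.≟ y))
      rhs x y = indicator (omits? zero x y) + indicator (omits? (suc zero) x y) + indicator (omits? (suc (suc zero)) x y)
      table : ∀ x y → lhs x y ≡ rhs x y
      table = from-yes (Fin.all? λ x → Fin.all? λ y → lhs x y ℤ.≟ rhs x y)

    -- Acyclicity of `f ∷ e ∷ w` seen on labels: `e` joins x to y, and `f` joins z to t. The second
    -- edge must not lie within a component, nor be parallel to the first.
    Joinable : (x y z t : Fin 3) → Set
    Joinable x y z t = x ≢ y × ¬ (z ≡ t ⊎ (z ≡ x × t ≡ y) ⊎ (z ≡ y × t ≡ x))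

    joinable? : ∀ x y z t → Dec (Joinable x y z t)
    joinable? x y z t = ¬? (x Fin.≟ y) ×-dec
      ¬? (z Fin.≟ t ⊎-dec ((z Fin.≟ x ×-dec t Fin.≟ y) ⊎-dec (z Fin.≟ y ×-dec t Fin.≟ x)))

    acyclic⇒joinable : ∀ e f → Acyclic (f ∷ e ∷ w) → Joinable (label (src e)) (label (tgt e)) (label (src f)) (label (tgt f))
    acyclic⇒joinable e f (¬f , ¬e , _) = ¬e ∘ complete , λ
      { (inj₁ p)              → ¬f (linked-weaken e w (complete p))
      ; (inj₂ (inj₁ (p , q))) → ¬f (trans (linked-weaken e w (complete p)) (trans (linked-head e w) (linked-weaken e w (complete (sym q)))))
      ; (inj₂ (inj₂ (p , q))) → ¬f (trans (linked-weaken e w (complete p)) (trans (sym (linked-head e w)) (linked-weaken e w (complete (sym q)))))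
      }

    joinable⇒acyclic : ∀ e f → Joinable (label (src e)) (label (tgt e)) (label (src f)) (label (tgt f)) → Acyclic (f ∷ e ∷ w)
    joinable⇒acyclic e f (¬e , ¬f) = ¬f′ , ¬e ∘ sound , a
      where
      ¬f′ : ¬ Linked (e ∷ w) (src f) (tgt f)
      ¬f′ p with linked-∷⁻ e w p (λ q → ¬f (inj₁ (sound q)))
      ... | inj₁ (r , s) = ¬f (inj₂ (inj₁ (sound r , sound s)))
      ... | inj₂ (r , s) = ¬f (inj₂ (inj₂ (sound r , sound s)))

    -- Two edges extend `w` together exactly when each joins two components and their classes
    -- differ. This depends only on four labels in `Fin 3`, so it is decided by enumeration.
    form-K-classes : ∀ e f → form-K w 0 e f ≡
      + 2 * (p₁ e + p₂ e) * p₀ f + + 2 * (p₀ e + p₂ e) * p₁ f + + 2 * (p₀ e + p₁ e) * p₂ f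
    form-K-classes e f = trans
      (cong (+ 2 *_) (indicator-⇔ (acyclic? (f ∷ e ∷ w)) (joinable? (label (src e)) (label (tgt e)) (label (src f)) (label (tgt f)))
        (acyclic⇒joinable e f) (joinable⇒acyclic e f)))
      (table (label (src e)) (label (tgt e)) (label (src f)) (label (tgt f)))
      where
      _∌_,_ : Fin 3 → Fin 3 → Fin 3 → ℤ
      i ∌ x , y = indicator (omits? i x y)
      lhs rhs : (x y z t : Fin 3) → ℤ
      lhs x y z t = + 2 * indicator (joinable? x y z t)
      rhs x y z t =
        + 2 * ((suc zero ∌ x , y) + (suc (suc zero) ∌ x , y)) * (zero ∌ z , t) +
        + 2 * ((zero ∌ x , y) + (suc (suc zero) ∌ x , y)) * (suc zero ∌ z , t) +
        + 2 * ((zero ∌ x , y) + (suc zero ∌ x , y)) * (suc (suc zero) ∌ z , t)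
      table : ∀ x y z t → lhs x y z t ≡ rhs x y z t
      table = from-yes (Fin.all? λ x → Fin.all? λ y → Fin.all? λ z → Fin.all? λ t → lhs x y z t ℤ.≟ rhs x y z t)

    form-h-classes : ∀ e → form-h w 0 e ≡ + 2 * p₀ e + + 2 * p₁ e + + 2 * p₂ e
    form-h-classes e = trans (cong (+ 2 *_) (extension₁ e)) (distr (p₀ e) (p₁ e) (p₂ e))
      where
      distr : ∀ x y z → + 2 * (x + y + z) ≡ + 2 * x + + 2 * y + + 2 * z
      distr = ℤ-Ring.solve-∀

    form-q-classes : form-q w 0 ≡ + 3
    form-q-classes = cong (+ 3 *_) (indicator-true (acyclic? w) a)

    extensions₁ : extensions 1 w ≡ sum p₀ + sum p₁ + sum p₂
    extensions₁ = trans (sum-cong-≗ extension₁)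
      (trans (∑-distrib-+ (λ e → p₀ e + p₁ e) p₂) (cong (_+ sum p₂) (∑-distrib-+ p₀ p₁)))

    module Form = ThreeClasses p₀ p₁ p₂ (form-K w 0) (form-h w 0) form-K-classes form-h-classes

  module _ (spanning : Spanning (λ _ → ⊤)) where

    extend : ∀ {w} → Acyclic w → suc (length w) ℕ.< N → ∃ λ e → Acyclic (e ∷ w)
    extend a lt = let e , _ , ae = acyclic-extend (λ _ → yes tt) spanning a lt in e , ae

    extensions-pos : ∀ j {w} → Acyclic w → j ℕ.+ length w ℕ.< N → 0ℤ < extensions j w
    extensions-pos zero    a lt = subst (0ℤ <_) (sym (indicator-true (acyclic? _) a)) (+<+ (s≤s z≤n))
    extensions-pos (suc j) {w} a lt with e , ae ← extend a (ℕ.≤-trans (s≤s (s≤s (ℕ.m≤n+m (length w) j))) lt) =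
      <-≤-trans (extensions-pos j ae (subst (ℕ._< N) (sym (ℕ.+-suc j (length w))) lt))
                (term≤∑ (λ e → extensions-nn j (e ∷ w)) e)

    -- The link of a letter `e` carries the form of `e ∷ w` at `j`. Positive degree of `e` amounts
    -- to acyclicity of `e ∷ w`, because short forests can be extended in a connected graph; letters
    -- dependent on `w` have vanishing forms.
    module Step (j : ℕ) {w : List E} (a : Acyclic w) (len : 4 ℕ.+ j ℕ.+ length w ≡ N)
      (hyp : ∀ e → Acyclic (e ∷ w) → Hyperbolic (form-K (e ∷ w) j) (form-h (e ∷ w) j) (form-q (e ∷ w) j)) where

      K = form-K w (suc j)

      deg-pos⇒acyclic : ∀ e → 0ℤ < deg K e → Acyclic (e ∷ w)
      deg-pos⇒acyclic e p = decidable-stable (acyclic? (e ∷ w)) λ ¬a →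
        <-irrefl (sym (trans (form-deg w (suc j) e) (cong (+ 2 *_) (extensions-cyclic (2 ℕ.+ j) (e ∷ w) ¬a)))) p

      acyclic⇒deg-pos : ∀ e → Acyclic (e ∷ w) → 0ℤ < deg K e
      acyclic⇒deg-pos e ae = subst (0ℤ <_) (sym (form-deg w (suc j) e)) (*-pos {+ 2} (+<+ (s≤s z≤n))
        (extensions-pos (2 ℕ.+ j) ae (ℕ.≤-reflexive (trans (cong (3 ℕ.+_) (ℕ.+-suc j (length w))) len))))

      acyclic⇒K-pos : ∀ e f → Acyclic (f ∷ e ∷ w) → 0ℤ < K e f
      acyclic⇒K-pos e f a′ = *-pos {+ 2} (+<+ (s≤s z≤n)) (extensions-pos (suc j) a′
        (ℕ.≤-reflexive (trans (cong (2 ℕ.+_) (trans (ℕ.+-suc j (suc (length w))) (cong suc (ℕ.+-suc j (length w))))) len)))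

      isolated : ∀ e → deg K e ≡ 0ℤ → form-h w (suc j) e ≡ 0ℤ × form-q (e ∷ w) j ≡ 0ℤ
      isolated e d = cong (+ 2 *_) (extensions-cyclic (suc j) (e ∷ w) ¬a) , cong (+ 3 *_) (extensions-cyclic j (e ∷ w) ¬a)
        where
        ¬a : ¬ Acyclic (e ∷ w)
        ¬a ae = <-irrefl (sym d) (acyclic⇒deg-pos e ae)

      shift : ∀ l → 3 ℕ.+ l ℕ.+ (1 ℕ.+ j) ≡ 4 ℕ.+ j ℕ.+ l
      shift l = cong (3 ℕ.+_) (trans (ℕ.+-suc l j) (cong suc (ℕ.+-comm l j)))

      -- Two edges that are parallel modulo w have a common neighbour, by augmentation.
      connected : ∀ z → LocallyConstant K z → ∀ e f → 0ℤ < deg K e → 0ℤ < deg K f → z e ≡ z f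
      connected z lc e f 0<e 0<f with acyclic? (f ∷ e ∷ w)
      ... | yes afe = lc e f (acyclic⇒K-pos e f afe)
      ... | no ¬afe
        with g , age ← extend (deg-pos⇒acyclic e 0<e)
                         (ℕ.m+n≤o⇒m≤o (3 ℕ.+ length w) (ℕ.≤-reflexive (trans (shift (length w)) len)))
        with acyclic-augment (deg-pos⇒acyclic f 0<f) age ℕ.≤-refl
      ... | x , here refl , ax =
        trans (lc e x (acyclic⇒K-pos e x age)) (sym (lc f x (acyclic⇒K-pos f x ax)))
      ... | x , there (here refl) , ax = contradiction (acyclic-swap e f w ax) ¬afe
      ... | x , there (there x∈w) , ax = contradiction (there x∈w) (acyclic⇒∉ ax)


      -- The sum conditions hold because the letter summed over can be moved to the front of the
      -- word, where it is the first step of `extensions (suc j)`.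
      module Local = LocalToGlobal K (form-h w (suc j)) (form-q w (suc j))
        (λ e → form-K (e ∷ w) j) (λ e → form-h (e ∷ w) j) (λ e → form-q (e ∷ w) j)
        (form-K-sym w (suc j)) (λ e → form-K-sym (e ∷ w) j)
        (λ e f g → double-nn (extensions-nn j _)) (λ e f → double-nn (extensions-nn j _))
        (λ f g → trans (∑-*ˡ (+ 2) (λ e → extensions j (g ∷ f ∷ e ∷ w)))
                       (cong (+ 2 *_) (sum-cong-≗ λ e → extensions-↭ j (Perm.↭-sym (rotate₃ e g f w)))))
        (λ f → trans (∑-*ˡ (+ 2) (λ e → extensions j (f ∷ e ∷ w)))
                     (cong (+ 2 *_) (sum-cong-≗ λ e → extensions-↭ j (Perm.swap f e Perm.refl))))
        (∑-*ˡ (+ 3) (λ e → extensions j (e ∷ w)))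
        (λ e f → form-deg (e ∷ w) j f) (λ e → form-h-sum (e ∷ w) j)
        isolated connected (λ e 0<e → hyp e (deg-pos⇒acyclic e 0<e))

    form-hyperbolic : ∀ j {w} → Acyclic w → 3 ℕ.+ j ℕ.+ length w ≡ N →
      Hyperbolic (form-K w j) (form-h w j) (form-q w j)
    form-hyperbolic zero {w} a len = subst (Hyperbolic (form-K w 0) (form-h w 0)) (sym form-q-classes)
      (Form.classes-hyperbolic (class-nn zero) (class-nn (suc zero)) (class-nn (suc (suc zero)))
        (subst (0ℤ <_) extensions₁ (extensions-pos 1 a (ℕ.m+n≤o⇒n≤o 1 (ℕ.≤-reflexive len)))))
      where open Classes a (labelling w 3 a (trans (ℕ.+-comm (length w) 3) len))
    form-hyperbolic (suc j) {w} a len = Step.Local.hyperbolic-global j a len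
      λ e ae → form-hyperbolic j ae (trans (cong (3 ℕ.+_) (ℕ.+-suc j (length w))) len)

    -- Tightness descends from the empty word one letter at a time, so the recursion strips letters
    -- while `j` rises. The last hypothesis ranges over `j₀` because the final index is known only
    -- through its equation.
    form-tight : ∀ j w → Acyclic w → 3 ℕ.+ j ℕ.+ length w ≡ N →
      (∀ j₀ → 3 ℕ.+ j₀ ≡ N → Tight (form-K [] j₀) (form-h [] j₀) (form-q [] j₀)) →
      Tight (form-K w j) (form-h w j) (form-q w j)
    form-tight j []      a len top = top j (trans (sym (ℕ.+-identityʳ (3 ℕ.+ j))) len)
    form-tight j (e ∷ w) (¬e , a) len top =
      Step.Local.tight-local j a len′ (λ e ae → form-hyperbolic j ae len)
        (subst (0ℤ <_) (sym (form-deg-sum w (suc j))) (*-pos {+ 2} (+<+ (s≤s z≤n))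
          (extensions-pos (3 ℕ.+ j) a (ℕ.≤-reflexive len′))))
        (form-tight (suc j) w a len′ top) e
      where
      len′ : 4 ℕ.+ j ℕ.+ length w ≡ N
      len′ = trans (cong (3 ℕ.+_) (sym (ℕ.+-suc j (length w)))) len

-- The equality case

module Equality {N m : ℕ} (src tgt : Fin m → Fin N) where

  open Multigraph src tgt
  open Extensions src tgt
  open DecMembership (Fin._≟_ {m}) using (_∈?_)
  open import Data.Integer.Base using (_+_; _*_; _≤_; _<_)
  open import Algebra.Properties.Semiring.Sum ℤ.+-*-semiring using (sum; sum-cong-≗; ∑-distrib-+)

  private
    V = Fin N
    E = Fin m

  count : ∀ {n} {P : Fin n → Set} → Decidable P → ℤ
  count P? = sum (λ x → indicator (P? x))

  count-≟ : ∀ {n} (e : Fin n) → count (Fin._≟ e) ≡ 1ℤ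
  count-≟ {suc n} zero    = cong (λ x → 1ℤ + x) (∑-0 {n} λ _ → refl)
  count-≟ (suc e) = trans (ℤ.+-identityˡ _) (count-≟ e)

  count-∈ : ∀ {xs : List E} → Unique xs → count (_∈? xs) ≡ + length xs
  count-∈ [] = ∑-0 {m} λ _ → refl
  count-∈ {y ∷ xs} (y∉ ∷ uniq) = trans (sum-cong-≗ split)
    (trans (∑-distrib-+ (λ x → indicator (x Fin.≟ y)) (λ x → indicator (x ∈? xs))) (cong₂ _+_ (count-≟ y) (count-∈ uniq)))
    where
    split : ∀ x → indicator (x ∈? y ∷ xs) ≡ indicator (x Fin.≟ y) + indicator (x ∈? xs)
    split x with x Fin.≟ y
    ... | yes refl = sym (cong (λ z → 1ℤ + z) (indicator-false (x ∈? xs) (λ x∈ → All.lookup y∉ x∈ refl)))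
    ... | no _     = sym (ℤ.+-identityˡ _)

  indicator-mono : ∀ {P Q : Set} (d : Dec P) (d′ : Dec Q) → (P → Q) → indicator d ≤ indicator d′
  indicator-mono (yes p) d′ f = ℤ.≤-reflexive (sym (indicator-true d′ (f p)))
  indicator-mono (no _)  d′ f = indicator-nn d′

  length≤count : ∀ {P : E → Set} (P? : Decidable P) {xs} → Unique xs → All P xs → + length xs ≤ count P?
  length≤count P? uniq ps = subst (_≤ count P?) (count-∈ uniq) (∑-mono λ x → indicator-mono (x ∈? _) (P? x) (All.lookup ps))

  count≤1 : ∀ {P : E → Set} (P? : Decidable P) → (∀ {x y} → P x → P y → x ≡ y) → count P? ≤ 1ℤ
  count≤1 P? unique with Fin.any? P?
  ... | yes (x , px) = subst (count P? ≤_) (count-≟ x) (∑-mono λ y → indicator-mono (P? y) (y Fin.≟ x) (λ py → unique py px))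
  ... | no ¬p = subst (_≤ 1ℤ) (sym (∑-0 λ x → indicator-false (P? x) (λ px → ¬p (x , px)))) (+≤+ ℕ.z≤n)

  count≡2⇒other : ∀ {P : E → Set} (P? : Decidable P) → count P? ≡ + 2 → ∀ {e} → P e → ∃ λ x → x ≢ e × P x
  count≡2⇒other P? two {e} pe with Fin.any? (λ x → ¬? (x Fin.≟ e) ×-dec P? x)
  ... | yes found = found
  ... | no ¬found = contradiction (trans (sym two) (trans
    (sum-cong-≗ λ x → indicator-⇔ (P? x) (x Fin.≟ e)
      (λ px → decidable-stable (x Fin.≟ e) λ x≢e → ¬found (x , x≢e , px)) (λ { refl → pe }))
    (count-≟ e))) λ ()

  third : ∀ (a b : Fin 3) → ∃ λ i → i ≢ a × i ≢ b
  third = from-yes (Fin.all? {3} λ a → Fin.all? {3} λ b → Fin.any? {3} λ i → ¬? (i Fin.≟ a) ×-dec ¬? (i Fin.≟ b))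

  abstract
    two-others : ∀ (i a b c : Fin 3) → i ≢ a → i ≢ b → a ≢ b → i ≢ c → c ≡ a ⊎ c ≡ b
    two-others = from-yes (Fin.all? {3} λ i → Fin.all? {3} λ a → Fin.all? {3} λ b → Fin.all? {3} λ c →
      ¬? (i Fin.≟ a) →-dec ¬? (i Fin.≟ b) →-dec ¬? (a Fin.≟ b) →-dec ¬? (i Fin.≟ c) →-dec (c Fin.≟ a ⊎-dec c Fin.≟ b))

  pairs-avoiding : ∀ {i a b c d : Fin 3} → i ≢ a → i ≢ b → a ≢ b → c ≢ d → i ≢ c → i ≢ d → (c ≡ a × d ≡ b) ⊎ (c ≡ b × d ≡ a)
  pairs-avoiding {i} {a} {b} {c} {d} i≢a i≢b a≢b c≢d i≢c i≢d
    with two-others i a b c i≢a i≢b a≢b i≢c | two-others i a b d i≢a i≢b a≢b i≢d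
  ... | inj₁ p | inj₁ q = contradiction (trans p (sym q)) c≢d
  ... | inj₁ p | inj₂ q = inj₁ (p , q)
  ... | inj₂ p | inj₁ q = inj₂ (p , q)
  ... | inj₂ p | inj₂ q = contradiction (trans p (sym q)) c≢d

  extract : ∀ {e : E} {w} → e ∈ w → ∃ λ R → w ↭ e ∷ R
  extract {w = e ∷ w} (here refl) = w , ↭-refl
  extract {w = f ∷ w} (there e∈w) with R , p ← extract e∈w = f ∷ R , Perm.trans (Perm.prep f p) (Perm.swap f _ ↭-refl)

  linked-of-dependent : ∀ {x w} → Acyclic w → ¬ Acyclic (x ∷ w) → Linked w (src x) (tgt x)
  linked-of-dependent {x} {w} a ¬a = decidable-stable (linked? w (src x) (tgt x)) λ ¬x → ¬a (¬x , a)

  -- This finds an edge of the fundamental circuit of `x`. If `x` is independent of the tail, the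
  -- head is such an edge. Otherwise one is found in the tail, and the head can be put back because
  -- `x ∷ R` links nothing that the tail does not.
  exchange : ∀ {x} T → src x ≢ tgt x → Acyclic T → ¬ Acyclic (x ∷ T) → ∃₂ λ e R → T ↭ e ∷ R × Acyclic (x ∷ R)
  exchange {x} [] x≢ _ ¬a = contradiction (x≢ , tt) ¬a
  exchange {x} (e ∷ T) x≢ (¬e , a) ¬a with acyclic? (x ∷ T)
  ... | yes ax = e , T , ↭-refl , ax
  ... | no ¬ax with e′ , R , p , axR ← exchange T x≢ a ¬ax =
    e′ , e ∷ R , Perm.trans (Perm.prep e p) (Perm.swap e e′ ↭-refl) , acyclic-swap e x R (¬e ∘ spanned , axR)
    where
    edge : ∀ {f} → f ∈ x ∷ R → Linked T (src f) (tgt f)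
    edge (here refl) = linked-of-dependent a ¬ax
    edge (there f∈R) = linked-edge (∈-resp-↭ (↭-sym p) (there f∈R))
    spanned : ∀ {u v} → Linked (x ∷ R) u v → Linked T u v
    spanned = linked-universal (kernel-isEquivalence (rep T)) (x ∷ R) edge

  Critical : ℕ → Set
  Critical j = 3 ℕ.+ j ≡ N × (∀ {w} → Acyclic w → length w ≡ j → Tight (form-K w 0) (form-h w 0) (form-q w 0))

  module _ {j : ℕ} (critical : Critical j) where

    private
      len : 3 ℕ.+ j ≡ N
      len = proj₁ critical
      tight : ∀ {w} → Acyclic w → length w ≡ j → Tight (form-K w 0) (form-h w 0) (form-q w 0)
      tight = proj₂ critical

    module _ {w : List E} (a : Acyclic w) (lw : length w ≡ j) where

      open Classes a (labelling w 3 a (trans (ℕ.+-comm (length w) 3) (trans (cong (3 ℕ.+_) lw) len)))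
      open Form using (n₀; n₁; n₂; dot-combine; dot-1)

      balanced : n₀ ≡ n₁ × n₁ ≡ n₂
      balanced = Form.classes-tight (subst (Tight (form-K w 0) (form-h w 0)) form-q-classes (tight a lw))

      extensions-w : extensions 1 w ≡ + 3 * n₀
      extensions-w = trans extensions₁ (trans (cong₂ (λ x y → n₀ + x + y) (sym (proj₁ balanced)) (sym (trans (proj₁ balanced) (proj₂ balanced)))) (triple n₀))
        where
        triple : ∀ x → x + x + x ≡ + 3 * x
        triple = ℤ-Ring.solve-∀

      -- Of the three classes of size `n₀`, contracting `e` destroys its own class and leaves the
      -- other two.
      extensions-∷ : ∀ {e} → Acyclic (e ∷ w) → + 3 * extensions 1 (e ∷ w) ≡ + 2 * extensions 1 w
      extensions-∷ {e} ae = ℤ.*-cancelˡ-≡ (+ 2) _ _ (begin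
        + 2 * (+ 3 * extensions 1 (e ∷ w)) ≡⟨ swap (extensions 1 (e ∷ w)) ⟩
        + 3 * (+ 2 * extensions 1 (e ∷ w)) ≡⟨ cong (+ 3 *_) (sym (form-deg w 0 e)) ⟩
        + 3 * deg (form-K w 0) e           ≡⟨ cong (+ 3 *_) degree ⟩
        + 3 * (+ 2 * (p₁ e + p₂ e) * n₀ + + 2 * (p₀ e + p₂ e) * n₁ + + 2 * (p₀ e + p₁ e) * n₂)
          ≡⟨ equal (sym (proj₁ balanced)) (sym (trans (proj₁ balanced) (proj₂ balanced))) ⟩
        + 2 * (+ 2 * (+ 3 * n₀)) * (p₀ e + p₁ e + p₂ e)
          ≡⟨ cong₂ (λ x y → + 2 * (+ 2 * x) * y) (sym extensions-w) (trans (sym (extension₁ e)) (indicator-true (acyclic? (e ∷ w)) ae)) ⟩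
        + 2 * (+ 2 * extensions 1 w) * 1ℤ  ≡⟨ ℤ.*-identityʳ _ ⟩
        + 2 * (+ 2 * extensions 1 w) ∎)
        where
        open ≡-Reasoning
        swap : ∀ x → + 2 * (+ 3 * x) ≡ + 3 * (+ 2 * x)
        swap = ℤ-Ring.solve-∀
        ring : ∀ p q r n → + 3 * (+ 2 * (q + r) * n + + 2 * (p + r) * n + + 2 * (p + q) * n) ≡ + 2 * (+ 2 * (+ 3 * n)) * (p + q + r)
        ring = ℤ-Ring.solve-∀
        equal : ∀ {x y} → x ≡ n₀ → y ≡ n₀ →
          + 3 * (+ 2 * (p₁ e + p₂ e) * n₀ + + 2 * (p₀ e + p₂ e) * x + + 2 * (p₀ e + p₁ e) * y) ≡
          + 2 * (+ 2 * (+ 3 * n₀)) * (p₀ e + p₁ e + p₂ e)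
        equal refl refl = ring (p₀ e) (p₁ e) (p₂ e) n₀
        ones : ∀ {a b c} → a ≡ n₀ → b ≡ n₁ → c ≡ n₂ →
          + 2 * (p₁ e + p₂ e) * a + + 2 * (p₀ e + p₂ e) * b + + 2 * (p₀ e + p₁ e) * c ≡
          + 2 * (p₁ e + p₂ e) * n₀ + + 2 * (p₀ e + p₂ e) * n₁ + + 2 * (p₀ e + p₁ e) * n₂
        ones refl refl refl = refl
        degree : deg (form-K w 0) e ≡ + 2 * (p₁ e + p₂ e) * n₀ + + 2 * (p₀ e + p₂ e) * n₁ + + 2 * (p₀ e + p₁ e) * n₂
        degree = trans (sym (dot-1 (form-K w 0 e)))
          (trans (dot-combine (+ 2 * (p₁ e + p₂ e)) (+ 2 * (p₀ e + p₂ e)) (+ 2 * (p₀ e + p₁ e)) (form-K-classes e) (const 1ℤ))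
                 (ones (dot-1 p₀) (dot-1 p₁) (dot-1 p₂)))

      -- If the edges of w avoid x and y, then only an edge joining x and y can have the third component as its class.
      isolated-pair⇒extensions≡3 : Spanning (λ _ → ⊤) → ∀ {x y} → x ≢ y →
        (∀ {v} → Linked w v x → v ≡ x) → (∀ {v} → Linked w v y → v ≡ y) →
        (∀ {e f} → (src e ≡ x × tgt e ≡ y) ⊎ (src e ≡ y × tgt e ≡ x) → (src f ≡ x × tgt f ≡ y) ⊎ (src f ≡ y × tgt f ≡ x) → e ≡ f) →
        extensions 1 w ≡ + 3
      isolated-pair⇒extensions≡3 spanning {x} {y} x≢y x-isolated y-isolated simple
        = trans extensions-w (cong (+ 3 *_) n₀≡1)
        where
        L = labelling w 3 a (trans (ℕ.+-comm (length w) 3) (trans (cong (3 ℕ.+_) lw) len))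
        open Labelling L using (label; complete)
        i   = proj₁ (third (label x) (label y))
        i≢x = proj₁ (proj₂ (third (label x) (label y)))
        i≢y = proj₂ (proj₂ (third (label x) (label y)))
        lx≢ly : label x ≢ label y
        lx≢ly p = x≢y (y-isolated (complete p))
        class≤1 : sum (class i) ≤ 1ℤ
        class≤1 = count≤1 (λ e → omits? i (label (src e)) (label (tgt e))) (λ pe pf → simple (joins pe) (joins pf))
          where
          joins : ∀ {e} → (label (src e) ≢ label (tgt e)) × (i ≢ label (src e)) × (i ≢ label (tgt e)) →
            (src e ≡ x × tgt e ≡ y) ⊎ (src e ≡ y × tgt e ≡ x)
          joins (c≢d , i≢c , i≢d) = Sum.map
            (λ (p , q) → x-isolated (complete p) , y-isolated (complete q))
            (λ (p , q) → y-isolated (complete p) , x-isolated (complete q))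
            (pairs-avoiding i≢x i≢y lx≢ly c≢d i≢c i≢d)
        class≡n₀ : ∀ i → sum (class i) ≡ n₀
        class≡n₀ zero             = refl
        class≡n₀ (suc zero)       = sym (proj₁ balanced)
        class≡n₀ (suc (suc zero)) = sym (trans (proj₁ balanced) (proj₂ balanced))
        0<n₀ : 0ℤ < n₀
        0<n₀ = ℤ.*-cancelˡ-<-nonNeg (+ 3) (subst (0ℤ <_) extensions-w
          (extensions-pos spanning 1 a (ℕ.≤-trans (ℕ.+-monoʳ-≤ 2 (ℕ.≤-reflexive lw)) (ℕ.m+n≤o⇒n≤o 1 (ℕ.≤-reflexive len)))))
        n₀≡1 : n₀ ≡ 1ℤ
        n₀≡1 = ℤ.≤-antisym (subst (_≤ 1ℤ) (class≡n₀ i) class≤1) (ℤ.i<j⇒suc[i]≤j 0<n₀)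

    -- Every element of the spanning tree T lies on the fundamental circuit of every edge outside T.
    module Unicyclic (spanning : Spanning (λ _ → ⊤)) (loopless : ∀ e → src e ≢ tgt e)
      {w : List E} (lw : length w ≡ j) (three : extensions 1 w ≡ + 3) {e₁ e₂ : E} (a₂ : Acyclic (e₂ ∷ e₁ ∷ w)) where

      a₁ : Acyclic (e₁ ∷ w)
      a₁ = proj₂ a₂

      three⇒two : ∀ {e w} → Acyclic (e ∷ w) → length w ≡ j → extensions 1 w ≡ + 3 → extensions 1 (e ∷ w) ≡ + 2
      three⇒two {e} {w} ae l p = ℤ.*-cancelˡ-≡ (+ 3) _ _ (trans (extensions-∷ (proj₂ ae) l ae) (cong (+ 2 *_) p))

      two⇒three : ∀ {e w} → Acyclic (e ∷ w) → length w ≡ j → extensions 1 (e ∷ w) ≡ + 2 → extensions 1 w ≡ + 3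
      two⇒three {e} {w} ae l p = ℤ.*-cancelˡ-≡ (+ 2) _ _ (trans (sym (extensions-∷ (proj₂ ae) l ae)) (cong (+ 3 *_) p))

      T : List E
      T = e₂ ∷ e₁ ∷ w

      remaining-length : ∀ {e f R} → T ↭ e ∷ f ∷ R → length R ≡ j
      remaining-length p = trans (ℕ.suc-injective (ℕ.suc-injective (sym (↭-length p)))) lw

      -- For `e` other than `e₂` the ratio is applied three times: `T` without `e₂` has two
      -- extensions, so `T` without both has three, so `T` without `e` has two.
      two-links : ∀ {e R} → T ↭ e ∷ R → extensions 1 R ≡ + 2
      two-links p with ∈-resp-↭ (↭-sym p) (here refl)
      ... | here refl = trans (extensions-↭ 1 (↭-sym (drop-∷ p))) (three⇒two a₁ lw three)
      ... | there e∈ with w′ , q ← extract e∈ =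
        trans (extensions-↭ 1 (↭-sym (drop-∷ (Perm.trans p′ p))))
              (three⇒two (proj₂ (acyclic-↭ (↭-sym p′) a₂)) l (two⇒three (proj₂ a₂′) l two))
        where
        p′ = Perm.trans (Perm.swap _ e₂ ↭-refl) (Perm.prep e₂ (↭-sym q))
        a₂′ = acyclic-↭ (Perm.prep e₂ q) a₂
        l = remaining-length (Perm.prep e₂ q)
        two = trans (extensions-↭ 1 (↭-sym q)) (three⇒two a₁ lw three)

      outside-dependent : ∀ x → ¬ Acyclic (x ∷ T)
      outside-dependent x ax = ℕ.<-irrefl (trans (cong (3 ℕ.+_) lw) len) (acyclic-length< (src x) ax)

      all-circuit : ∀ {x} → x ∉ T → ∀ {e R} → T ↭ e ∷ R → Acyclic (x ∷ R)
      all-circuit {x} x∉T {e} {R} p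
        with e₀ , R₀ , q , ax ← exchange T (loopless x) a₂ (outside-dependent x)
        with ∈-resp-↭ q (∈-resp-↭ (↭-sym p) (here refl))
      ... | here refl = acyclic-↭ (Perm.prep x (drop-∷ (Perm.trans (↭-sym q) p))) ax
      ... | there e∈R₀
        with w′ , r ← extract e∈R₀ = acyclic-↭ (Perm.prep x R↭) (subst (λ y → Acyclic (y ∷ e₀ ∷ w′)) y≡x ay)
        where
        q′ : T ↭ e₀ ∷ e ∷ w′
        q′ = Perm.trans q (Perm.prep e₀ r)
        q″ : T ↭ e ∷ e₀ ∷ w′
        q″ = Perm.trans q′ (Perm.swap e₀ e ↭-refl)
        R↭ : e₀ ∷ w′ ↭ R
        R↭ = drop-∷ (Perm.trans (↭-sym q″) p)
        aT : Acyclic (e ∷ e₀ ∷ w′)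
        aT = acyclic-↭ q″ a₂
        axe : Acyclic (e ∷ x ∷ w′)
        axe = acyclic-swap x e w′ (acyclic-↭ (Perm.prep x r) ax)
        l = remaining-length q″
        other = count≡2⇒other (λ y → acyclic? (y ∷ e₀ ∷ w′)) (two-links q″) aT
        y   = proj₁ other
        y≢e = proj₁ (proj₂ other)
        ay  = proj₂ (proj₂ other)
        ∉T : ∀ {z} → z ∈ T → z ≢ x
        ∉T z∈T refl = x∉T z∈T
        e∈T  = ∈-resp-↭ (↭-sym p) (here refl)
        e₀∈T = ∈-resp-↭ (↭-sym q) (here refl)
        -- Otherwise `y`, `x`, `e` and `e₀` are four distinct letters extending `w′`. But `w′` is
        -- `T` without two letters and has only three extensions.
        y≡x : y ≡ x
        y≡x = decidable-stable (y Fin.≟ x) λ y≢x → case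
          (subst (+ 4 ≤_) (two⇒three (proj₂ aT) l (two-links q″))
            (length≤count (λ z → acyclic? (z ∷ w′)) {y ∷ x ∷ e ∷ e₀ ∷ []}
              ((y≢x ∷ y≢e ∷ (λ y≡e₀ → acyclic⇒∉ ay (here y≡e₀)) ∷ []) ∷
               (∉T e∈T ∘ sym ∷ ∉T e₀∈T ∘ sym ∷ []) ∷
               ((λ e≡e₀ → acyclic⇒∉ aT (here e≡e₀)) ∷ []) ∷ [] ∷ [])
              (proj₂ (acyclic-swap y e₀ w′ ay) ∷ proj₂ axe ∷ proj₂ (acyclic-swap e e₀ w′ aT) ∷ proj₂ aT ∷ []))) of
          λ { (+≤+ (ℕ.s≤s (ℕ.s≤s (ℕ.s≤s ())))) }

      g-exists : ∃ λ g → g ≢ e₂ × Acyclic (g ∷ e₁ ∷ w)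
      g-exists = count≡2⇒other (λ y → acyclic? (y ∷ e₁ ∷ w)) (two-links ↭-refl) a₂

      g : E
      g = proj₁ g-exists

      g∉T : g ∉ T
      g∉T (here g≡e₂) = proj₁ (proj₂ g-exists) g≡e₂
      g∉T (there g∈)  = acyclic⇒∉ (proj₂ (proj₂ g-exists)) g∈

      -- Any further edge would, by `all-circuit`, be a third extension of `e₁ ∷ w` besides `g` and
      -- `e₂`.
      everything : ∀ x → x ∈ g ∷ T
      everything x = decidable-stable (x ∈? g ∷ T) λ x∉ → case
        (subst (+ 3 ≤_) (two-links ↭-refl)
          (length≤count (λ z → acyclic? (z ∷ e₁ ∷ w)) {x ∷ g ∷ e₂ ∷ []}
            (((x∉ ∘ here) ∷ (x∉ ∘ there ∘ here) ∷ []) ∷ (proj₁ (proj₂ g-exists) ∷ []) ∷ [] ∷ [])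
            (all-circuit (x∉ ∘ there) ↭-refl ∷ proj₂ (proj₂ g-exists) ∷ a₂ ∷ []))) of
        λ { (+≤+ (ℕ.s≤s (ℕ.s≤s ()))) }

      unique-g∷T : Unique (g ∷ T)
      unique-g∷T = All.tabulate (λ x∈T g≡x → g∉T (subst (_∈ T) (sym g≡x) x∈T)) ∷ acyclic⇒unique a₂

      -- An edge of `T` can be exchanged for `g`, since `g` has all of `T` on its circuit; an edge
      -- outside `T` is `g` itself, and then `T` serves.
      all-but-one-acyclic : ∀ e → ∃ λ W → Acyclic W × (∀ {x} → x ≢ e → x ∈ W)
      all-but-one-acyclic e = [ exchanged , tree ]′ (toSum (e ∈? T))
        where
        tree : e ∉ T → ∃ λ W → Acyclic W × (∀ {x} → x ≢ e → x ∈ W)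
        tree e∉T = T , a₂ , λ {x} x≢e → Any.tail (λ x≡g → x≢e (trans x≡g (sym e≡g))) (everything x)
          where
          e≡g : e ≡ g
          e≡g = decidable-stable (e Fin.≟ g) λ e≢g → e∉T (Any.tail e≢g (everything e))
        exchanged : e ∈ T → ∃ λ W → Acyclic W × (∀ {x} → x ≢ e → x ∈ W)
        exchanged e∈T = g ∷ proj₁ (extract e∈T) , all-circuit g∉T (proj₂ (extract e∈T)) ,
          λ {x} x≢e → [ here , (λ x≢g → there (Any.tail x≢e (∈-resp-↭ (proj₂ (extract e∈T)) (Any.tail x≢g (everything x))))) ]′ (toSum (x Fin.≟ g))

-- From words to subsets

module _ where

  open import Data.Integer.Base using (_+_; _*_)
  open import Algebra.Properties.Semiring.Sum ℤ.+-*-semiring using (sum; sum-cong-≗; ∑-distrib-+)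

  -- The sum over the subsets of size k, by Pascal's recursion on the first element; both `subsets`
  -- and `up` unfold along the same recursion.
  layer-sum : ∀ {m} → ℕ → (Subset m → ℤ) → ℤ
  layer-sum {zero}  zero    f = f []
  layer-sum {zero}  (suc k) f = 0ℤ
  layer-sum {suc m} zero    f = layer-sum zero (f ∘ (outside ∷_))
  layer-sum {suc m} (suc k) f = layer-sum (suc k) (f ∘ (outside ∷_)) + layer-sum k (f ∘ (inside ∷_))

  layer-sum-cong : ∀ {m} k {f g : Subset m → ℤ} → f ≗ g → layer-sum k f ≡ layer-sum k g
  layer-sum-cong {zero}  zero    eq = eq []
  layer-sum-cong {zero}  (suc k) eq = refl
  layer-sum-cong {suc m} zero    eq = layer-sum-cong zero (eq ∘ (outside ∷_))
  layer-sum-cong {suc m} (suc k) eq = cong₂ _+_ (layer-sum-cong (suc k) (eq ∘ (outside ∷_))) (layer-sum-cong k (eq ∘ (inside ∷_)))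

  layer-sum-+ : ∀ {m} k (f g : Subset m → ℤ) → layer-sum k (λ S → f S + g S) ≡ layer-sum k f + layer-sum k g
  layer-sum-+ {zero}  zero    f g = refl
  layer-sum-+ {zero}  (suc k) f g = refl
  layer-sum-+ {suc m} zero    f g = layer-sum-+ zero (f ∘ (outside ∷_)) (g ∘ (outside ∷_))
  layer-sum-+ {suc m} (suc k) f g = trans
    (cong₂ _+_ (layer-sum-+ (suc k) (f ∘ (outside ∷_)) (g ∘ (outside ∷_))) (layer-sum-+ k (f ∘ (inside ∷_)) (g ∘ (inside ∷_))))
    (interchange (layer-sum (suc k) (f ∘ (outside ∷_))) _ _ _)
    where
    interchange : ∀ a b c d → (a + b) + (c + d) ≡ (a + c) + (b + d)
    interchange = ℤ-Ring.solve-∀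

  layer-sum-⊥ : ∀ {m} (f : Subset m → ℤ) → layer-sum zero f ≡ f ⊥
  layer-sum-⊥ {zero}  f = refl
  layer-sum-⊥ {suc m} f = layer-sum-⊥ (f ∘ (outside ∷_))

  up : ∀ {m} → (Subset m → ℤ) → Subset m → ℤ
  up f S = sum (λ e → if lookup S e then 0ℤ else f (S [ e ]≔ inside))

  -- Double counting: a set with k + 1 elements arises from k + 1 sets by adding one element.
  layer-sum-up : ∀ {m} k (f : Subset m → ℤ) → layer-sum k (up f) ≡ + suc k * layer-sum (suc k) f
  layer-sum-up {zero}  zero    f = refl
  layer-sum-up {zero}  (suc k) f = sym (ℤ.*-zeroʳ (+ suc (suc k)))
  layer-sum-up {suc m} zero    f = begin
    layer-sum zero (λ S → f (inside ∷ S) + up (f ∘ (outside ∷_)) S)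
      ≡⟨ layer-sum-+ zero (f ∘ (inside ∷_)) (up (f ∘ (outside ∷_))) ⟩
    layer-sum zero (f ∘ (inside ∷_)) + layer-sum zero (up (f ∘ (outside ∷_)))
      ≡⟨ cong (λ x → layer-sum zero (f ∘ (inside ∷_)) + x) (layer-sum-up zero (f ∘ (outside ∷_))) ⟩
    layer-sum zero (f ∘ (inside ∷_)) + 1ℤ * layer-sum 1 (f ∘ (outside ∷_))
      ≡⟨ swap (layer-sum zero (f ∘ (inside ∷_))) _ ⟩
    1ℤ * (layer-sum 1 (f ∘ (outside ∷_)) + layer-sum zero (f ∘ (inside ∷_))) ∎
    where
    open ≡-Reasoning
    swap : ∀ a b → a + 1ℤ * b ≡ 1ℤ * (b + a)
    swap = ℤ-Ring.solve-∀
  layer-sum-up {suc m} (suc k) f = begin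
    layer-sum (suc k) (λ S → f (inside ∷ S) + up (f ∘ (outside ∷_)) S) + layer-sum k (λ S → 0ℤ + up (f ∘ (inside ∷_)) S)
      ≡⟨ cong₂ _+_ (trans (layer-sum-+ (suc k) (f ∘ (inside ∷_)) (up (f ∘ (outside ∷_))))
                          (cong (λ y → x + y) (layer-sum-up (suc k) (f ∘ (outside ∷_)))))
                   (trans (layer-sum-cong k (λ S → ℤ.+-identityˡ (up (f ∘ (inside ∷_)) S))) (layer-sum-up k (f ∘ (inside ∷_)))) ⟩
    x + (1ℤ + + suc k) * layer-sum (suc (suc k)) (f ∘ (outside ∷_)) + + suc k * x
      ≡⟨ collect x (layer-sum (suc (suc k)) (f ∘ (outside ∷_))) (+ suc k) ⟩
    (1ℤ + + suc k) * (layer-sum (suc (suc k)) (f ∘ (outside ∷_)) + x) ∎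
    where
    open ≡-Reasoning
    x = layer-sum (suc k) (f ∘ (inside ∷_))
    collect : ∀ x y k → x + (1ℤ + k) * y + k * x ≡ (1ℤ + k) * (y + x)
    collect = ℤ-Ring.solve-∀

  up^ : ∀ {m} → ℕ → (Subset m → ℤ) → Subset m → ℤ
  up^ zero    f = f
  up^ (suc k) f = up (up^ k f)

  -- The factor is (k + l)! / l!, written without division. The layer `l` is arbitrary because each
  -- step of the induction on `k` raises it.
  layer-sum-up^ : ∀ {m} l k (f : Subset m → ℤ) →
    + (l !) * layer-sum l (up^ k f) ≡ + ((k ℕ.+ l) !) * layer-sum (k ℕ.+ l) f
  layer-sum-up^ l zero    f = refl
  layer-sum-up^ l (suc k) f = begin
    + (l !) * layer-sum l (up (up^ k f))              ≡⟨ cong (+ (l !) *_) (layer-sum-up l (up^ k f)) ⟩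
    + (l !) * (+ suc l * layer-sum (suc l) (up^ k f)) ≡⟨ rotate (+ (l !)) (+ suc l) _ ⟩
    + suc l * + (l !) * layer-sum (suc l) (up^ k f)   ≡⟨ cong (_* layer-sum (suc l) (up^ k f)) (sym (ℤ.pos-* (suc l) (l !))) ⟩
    + (suc l !) * layer-sum (suc l) (up^ k f)         ≡⟨ layer-sum-up^ (suc l) k f ⟩
    + ((k ℕ.+ suc l) !) * layer-sum (k ℕ.+ suc l) f   ≡⟨ cong (λ i → + (i !) * layer-sum i f) (ℕ.+-suc k l) ⟩
    + ((suc k ℕ.+ l) !) * layer-sum (suc k ℕ.+ l) f   ∎
    where
    open ≡-Reasoning
    rotate : ∀ a b c → a * (b * c) ≡ b * a * c
    rotate = ℤ-Ring.solve-∀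

  up^-⊥ : ∀ {m} k (f : Subset m → ℤ) → up^ k f ⊥ ≡ + (k !) * layer-sum k f
  up^-⊥ k f = begin
    up^ k f ⊥                          ≡⟨ sym (layer-sum-⊥ (up^ k f)) ⟩
    layer-sum 0 (up^ k f)              ≡⟨ sym (ℤ.*-identityˡ _) ⟩
    1ℤ * layer-sum 0 (up^ k f)         ≡⟨ layer-sum-up^ 0 k f ⟩
    + ((k ℕ.+ 0) !) * layer-sum (k ℕ.+ 0) f ≡⟨ cong (λ i → + (i !) * layer-sum i f) (ℕ.+-identityʳ k) ⟩
    + (k !) * layer-sum k f ∎
    where open ≡-Reasoning

  length-filter-cong : ∀ {A : Set} {P Q : A → Set} (P? : Decidable P) (Q? : Decidable Q) →
    (∀ x → does (P? x) ≡ does (Q? x)) → ∀ xs → length (filter P? xs) ≡ length (filter Q? xs)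
  length-filter-cong P? Q? eq [] = refl
  length-filter-cong P? Q? eq (x ∷ xs) with does (P? x) | does (Q? x) | eq x
  ... | true  | true  | refl = cong suc (length-filter-cong P? Q? eq xs)
  ... | false | false | refl = length-filter-cong P? Q? eq xs

  length-filter-map : ∀ {A B : Set} {P : B → Set} (P? : Decidable P) (f : A → B) xs →
    length (filter P? (map f xs)) ≡ length (filter (P? ∘ f) xs)
  length-filter-map P? f [] = refl
  length-filter-map P? f (x ∷ xs) with does (P? (f x))
  ... | true  = cong suc (length-filter-map P? f xs)
  ... | false = length-filter-map P? f xs

  length-filter-none : ∀ {A : Set} {P : A → Set} (P? : Decidable P) → (∀ x → does (P? x) ≡ false) → ∀ xs → length (filter P? xs) ≡ 0
  length-filter-none P? none [] = refl
  length-filter-none P? none (x ∷ xs) rewrite none x = length-filter-none P? none xs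

  count-layer : ∀ m k {P : Subset m → Set} (P? : Decidable P) →
    + length (filter (λ S → ∣ S ∣ ℕ.≟ k ×-dec P? S) (subsets m)) ≡ layer-sum k (indicator ∘ P?)
  count-layer zero zero P? with does (P? [])
  ... | true  = refl
  ... | false = refl
  count-layer zero (suc k) P? = refl
  count-layer (suc m) zero P? = begin
    + length (filter Q? (map (outside ∷_) (subsets m) ++ map (inside ∷_) (subsets m)))
      ≡⟨ cong (+_ ∘ length) (filter-++ Q? (map (outside ∷_) (subsets m)) _) ⟩
    + length (filter Q? (map (outside ∷_) (subsets m)) ++ filter Q? (map (inside ∷_) (subsets m)))
      ≡⟨ cong +_ (length-++ (filter Q? (map (outside ∷_) (subsets m)))) ⟩
    + (length (filter Q? (map (outside ∷_) (subsets m))) ℕ.+ length (filter Q? (map (inside ∷_) (subsets m))))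
      ≡⟨ cong₂ (λ a b → + (a ℕ.+ b)) (length-filter-map Q? (outside ∷_) (subsets m))
           (trans (length-filter-map Q? (inside ∷_) (subsets m)) (length-filter-none (Q? ∘ (inside ∷_)) (λ _ → refl) (subsets m))) ⟩
    + (length (filter (Q? ∘ (outside ∷_)) (subsets m)) ℕ.+ 0)
      ≡⟨ cong +_ (ℕ.+-identityʳ _) ⟩
    + length (filter (Q? ∘ (outside ∷_)) (subsets m))
      ≡⟨ count-layer m zero (P? ∘ (outside ∷_)) ⟩
    layer-sum zero (indicator ∘ P? ∘ (outside ∷_)) ∎
    where
    open ≡-Reasoning
    Q? = λ S → ∣ S ∣ ℕ.≟ zero ×-dec P? S
  count-layer (suc m) (suc k) P? = begin
    + length (filter Q? (map (outside ∷_) (subsets m) ++ map (inside ∷_) (subsets m)))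
      ≡⟨ cong (+_ ∘ length) (filter-++ Q? (map (outside ∷_) (subsets m)) _) ⟩
    + length (filter Q? (map (outside ∷_) (subsets m)) ++ filter Q? (map (inside ∷_) (subsets m)))
      ≡⟨ cong +_ (length-++ (filter Q? (map (outside ∷_) (subsets m)))) ⟩
    + (length (filter Q? (map (outside ∷_) (subsets m))) ℕ.+ length (filter Q? (map (inside ∷_) (subsets m))))
      ≡⟨ cong₂ (λ a b → + (a ℕ.+ b)) (length-filter-map Q? (outside ∷_) (subsets m))
           (trans (length-filter-map Q? (inside ∷_) (subsets m))
                  (length-filter-cong (Q? ∘ (inside ∷_)) (λ S → ∣ S ∣ ℕ.≟ k ×-dec P? (inside ∷ S)) (λ _ → refl) (subsets m))) ⟩
    + (length (filter (Q? ∘ (outside ∷_)) (subsets m)) ℕ.+ length (filter (λ S → ∣ S ∣ ℕ.≟ k ×-dec P? (inside ∷ S)) (subsets m)))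
      ≡⟨ cong₂ _+_ (count-layer m (suc k) (P? ∘ (outside ∷_))) (count-layer m k (P? ∘ (inside ∷_))) ⟩
    layer-sum (suc k) (indicator ∘ P?) ∎
    where
    open ≡-Reasoning
    Q? = λ S → ∣ S ∣ ℕ.≟ suc k ×-dec P? S

-- Cycles of a simple graph

toℕ-next : ∀ {l} (i : Fin (suc l)) → toℕ (next i) ≡ suc (toℕ i) % suc l
toℕ-next i = Fin.toℕ-fromℕ< _

next-inject₁ : ∀ {l} (i : Fin l) → next (inject₁ i) ≡ suc i
next-inject₁ i = Fin.toℕ-injective (trans (toℕ-next (inject₁ i))
  (trans (m<n⇒m%n≡m (s≤s (subst (ℕ._< _) (sym (Fin.toℕ-inject₁ i)) (Fin.toℕ<n i)))) (cong suc (Fin.toℕ-inject₁ i))))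

next-fromℕ : ∀ l → next (fromℕ l) ≡ zero
next-fromℕ l = Fin.toℕ-injective (trans (toℕ-next (fromℕ l)) (trans (cong (λ k → suc k % suc l) (Fin.toℕ-fromℕ l)) (n%n≡0 (suc l))))

-- With length at least three a cycle cannot traverse an edge back and forth, so an edge has only
-- one position on it.
next-next : ∀ {l} → 3 ℕ.≤ l → (i : Fin l) → next (next i) ≢ i
next-next {suc (suc (suc l))} (s≤s (s≤s (s≤s z≤n))) i p with view i
... | ‵fromℕ = contradiction (trans (sym p) (trans (cong next (next-fromℕ (suc (suc l)))) (next-inject₁ zero))) λ ()
... | ‵inject₁ i with view i
...   | ‵fromℕ = contradiction (trans (sym p) (trans (cong next (next-inject₁ (fromℕ (suc l)))) (next-fromℕ (suc (suc l))))) λ ()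
...   | ‵inject₁ i = ℕ.<⇒≢ (ℕ.<-trans (ℕ.n<1+n _) (ℕ.n<1+n _))
  (trans (sym (trans (Fin.toℕ-inject₁ (inject₁ i)) (Fin.toℕ-inject₁ i)))
    (cong toℕ (trans (sym p) (trans (cong next (next-inject₁ (inject₁ i))) (next-inject₁ (suc i))))))

module _ {A : Set} where

  constant-from-zero : ∀ {l} (d : Fin (suc l) → A) j →
    (∀ k → toℕ k ℕ.< toℕ j → d (inject₁ k) ≡ d (suc k)) → d zero ≡ d j
  constant-from-zero {l}     d zero    step = refl
  constant-from-zero {suc l} d (suc j) step = trans
    (step zero (s≤s z≤n)) (constant-from-zero (d ∘ suc) j (λ k lt → step (suc k) (s≤s lt)))

  constant-to-last : ∀ {l} (d : Fin (suc l) → A) j →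
    (∀ k → toℕ j ℕ.≤ toℕ k → d (inject₁ k) ≡ d (suc k)) → d j ≡ d (fromℕ l)
  constant-to-last {l}     d zero    step = constant-from-zero d (fromℕ l) (λ k _ → step k z≤n)
  constant-to-last {suc l} d (suc j) step = constant-to-last (d ∘ suc) j (λ k le → step (suc k) (s≤s le))

  -- A cycle with one edge removed is connected.
  constant-off-one : ∀ {l} (d : Fin l → A) i → (∀ j → j ≢ i → d j ≡ d (next j)) → ∀ j k → d j ≡ d k
  constant-off-one {suc l} d i step j k = trans (sym (from-zero j)) (from-zero k)
    where
    step′ : ∀ k → inject₁ k ≢ i → d (inject₁ k) ≡ d (suc k)
    step′ k ≢i = trans (step (inject₁ k) ≢i) (cong d (next-inject₁ k))
    -- Positions up to `i` are reached from 0 before the missing step. Later ones run on to the last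
    -- position, whose successor is 0.
    from-zero : ∀ j → d zero ≡ d j
    from-zero j with toℕ j ℕ.≤? toℕ i
    ... | yes j≤i = constant-from-zero d j λ k k<j → step′ k λ eq →
      ℕ.<⇒≢ (ℕ.<-≤-trans k<j j≤i) (trans (sym (Fin.toℕ-inject₁ k)) (cong toℕ eq))
    ... | no j≰i = sym (trans
      (constant-to-last d j λ k j≤k → step′ k λ eq →
        ℕ.<⇒≢ (ℕ.<-≤-trans (ℕ.≰⇒> j≰i) j≤k) (sym (trans (sym (Fin.toℕ-inject₁ k)) (cong toℕ eq))))
      (trans (step (fromℕ l) λ eq → ℕ.<⇒≱ (ℕ.≰⇒> j≰i)
                (subst (toℕ j ℕ.≤_) (cong toℕ eq) (Fin.≤fromℕ j)))
             (cong d (next-fromℕ l))))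

lookup-unique : ∀ {A : Set} {xs : List A} → Unique xs → ∀ i j → List.lookup xs i ≡ List.lookup xs j → i ≡ j
lookup-unique (_ ∷ _)  zero    zero    eq = refl
lookup-unique {xs = x ∷ xs} (x∉ ∷ _) zero    (suc j) eq = contradiction eq (All.lookup x∉ (∈-lookup {xs = xs} j))
lookup-unique {xs = x ∷ xs} (x∉ ∷ _) (suc i) zero    eq = contradiction (sym eq) (All.lookup x∉ (∈-lookup {xs = xs} i))
lookup-unique (_ ∷ u)  (suc i) (suc j) eq = cong suc (lookup-unique u i j eq)

module Paths {V : Set} (_≟_ : ∀ (u v : V) → Dec (u ≡ v)) (J : V → V → Set) where

  Chain : ∀ {k} → V → Vec V k → V → Set
  Chain u []      v = u ≡ v
  Chain u (x ∷ c) v = J u x × Chain x c v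

  cut : ∀ {k x v u} {c : Vec V k} → Chain x c v → VecUnique.Unique (x ∷ c) → u Vec.∈ x ∷ c →
    ∃₂ λ k (c : Vec V k) → Chain u c v × VecUnique.Unique (u ∷ c)
  cut chain uniq (Vec.here refl) = _ , _ , chain , uniq
  cut {c = _ ∷ _} (_ , chain) (_ ∷ uniq) (Vec.there u∈c) = cut chain uniq u∈c

  simple-path : ∀ {u v} → Star J u v → ∃₂ λ k (c : Vec V k) → Chain u c v × VecUnique.Unique (u ∷ c)
  simple-path ε = 0 , [] , refl , VecAll.[] ∷ []
  simple-path {u} (j ◅ js) with k , c , chain , uniq ← simple-path js
    with VecAll.decide (λ x → Sum.swap (toSum (u ≟ x))) (_ ∷ c)
  ... | inj₁ u∉ = suc k , _ ∷ c , (j , chain) , u∉ ∷ uniq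
  ... | inj₂ u∈ = cut chain uniq u∈

  chain-step : ∀ {k u v} (c : Vec V k) → Chain u c v → ∀ i → J (lookup (u ∷ c) (inject₁ i)) (lookup (u ∷ c) (suc i))
  chain-step (x ∷ c) (j , chain) zero    = j
  chain-step (x ∷ c) (j , chain) (suc i) = chain-step c chain i

  chain-last : ∀ {k u v} (c : Vec V k) → Chain u c v → lookup (u ∷ c) (fromℕ k) ≡ v
  chain-last []      eq          = eq
  chain-last (x ∷ c) (_ , chain) = chain-last c chain

-- Edges of a simple graph as letters; acyclic words and cycles

module Edges {N} (G : SimpleGraph N) where

  m : ℕ
  m = length (edges G)

  E V : Set
  E = Fin m
  V = Fin N

  src tgt : E → V
  src e = proj₁ (List.lookup (edges G) e)
  tgt e = proj₂ (List.lookup (edges G) e)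

  open Multigraph src tgt public

  edge-spec : ∀ e → src e Fin.< tgt e × Adj G (src e) (tgt e)
  edge-spec e = proj₂ (∈-filter⁻ (λ (u , v) → u Fin.<? v ×-dec adj? G u v)
    {xs = cartesianProduct (allFin N) (allFin N)} (∈-lookup {xs = edges G} e))

  edge-injective : ∀ {e f} → src e ≡ src f → tgt e ≡ tgt f → e ≡ f
  edge-injective p q = lookup-unique
    (Unique.filter⁺ (λ (u , v) → u Fin.<? v ×-dec adj? G u v) (Unique.cartesianProduct⁺ (Unique.allFin⁺ N) (Unique.allFin⁺ N)))
    _ _ (cong₂ _,_ p q)

  Joins : E → V → V → Set
  Joins e u v = List.lookup (edges G) e ≡ (u , v) ⊎ List.lookup (edges G) e ≡ (v , u)

  joins-self : ∀ e → Joins e (src e) (tgt e)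
  joins-self e = inj₁ refl

  joins-unique : ∀ {e f u v} → Joins e u v → Joins f u v → e ≡ f
  joins-unique {e} {f} (inj₁ p) (inj₁ q) = edge-injective (cong proj₁ (trans p (sym q))) (cong proj₂ (trans p (sym q)))
  joins-unique {e} {f} (inj₂ p) (inj₂ q) = edge-injective (cong proj₁ (trans p (sym q))) (cong proj₂ (trans p (sym q)))
  joins-unique {e} {f} (inj₁ p) (inj₂ q) = contradiction (subst₂ Fin._<_ (cong proj₁ q) (cong proj₂ q) (proj₁ (edge-spec f)))
    (Fin.<-asym (subst₂ Fin._<_ (cong proj₁ p) (cong proj₂ p) (proj₁ (edge-spec e))))
  joins-unique {e} {f} (inj₂ p) (inj₁ q) = contradiction (subst₂ Fin._<_ (cong proj₁ q) (cong proj₂ q) (proj₁ (edge-spec f)))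
    (Fin.<-asym (subst₂ Fin._<_ (cong proj₁ p) (cong proj₂ p) (proj₁ (edge-spec e))))

  joins-same : ∀ {e u v x y} → Joins e u v → Joins e x y → (u ≡ x × v ≡ y) ⊎ (u ≡ y × v ≡ x)
  joins-same (inj₁ p) (inj₁ q) with refl ← trans (sym p) q = inj₁ (refl , refl)
  joins-same (inj₁ p) (inj₂ q) with refl ← trans (sym p) q = inj₂ (refl , refl)
  joins-same (inj₂ p) (inj₁ q) with refl ← trans (sym p) q = inj₂ (refl , refl)
  joins-same (inj₂ p) (inj₂ q) with refl ← trans (sym p) q = inj₁ (refl , refl)

  joins⇒adj : ∀ {e u v} → Joins e u v → Adj G u v
  joins⇒adj {e} (inj₁ p) = subst₂ (Adj G) (cong proj₁ p) (cong proj₂ p) (proj₂ (edge-spec e))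
  joins⇒adj {e} (inj₂ p) = symm G (subst₂ (Adj G) (cong proj₁ p) (cong proj₂ p) (proj₂ (edge-spec e)))

  adj⇒joins : ∀ {u v} → Adj G u v → ∃ λ e → Joins e u v
  adj⇒joins {u} {v} uv with Fin.<-cmp u v
  ... | tri≈ _ u≡v _ = contradiction uv (irrefl G u≡v)
  ... | tri< u<v _ _ = Any.index u∈ , inj₁ (sym (lookup-index u∈))
    where
    u∈ : (u , v) ∈ edges G
    u∈ = ∈-filter⁺ (λ (u , v) → u Fin.<? v ×-dec adj? G u v) (∈-cartesianProduct⁺ (∈-allFin u) (∈-allFin v)) (u<v , uv)
  ... | tri> _ _ v<u = Any.index v∈ , inj₂ (sym (lookup-index v∈))
    where
    v∈ : (v , u) ∈ edges G
    v∈ = ∈-filter⁺ (λ (u , v) → u Fin.<? v ×-dec adj? G u v) (∈-cartesianProduct⁺ (∈-allFin v) (∈-allFin u)) (v<u , symm G uv)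

  connected⇒spanning : Connected G → Spanning (λ _ → ⊤)
  connected⇒spanning conn f edge u v = along (conn u v)
    where
    along : ∀ {u v} → Star (Adj G) u v → f u ≡ f v
    along ε = refl
    along (uv ◅ rest) with adj⇒joins uv
    ... | e , inj₁ p = trans (trans (cong f (sym (cong proj₁ p))) (trans (edge e tt) (cong f (cong proj₂ p)))) (along rest)
    ... | e , inj₂ p = trans (trans (cong f (sym (cong proj₂ p))) (trans (sym (edge e tt)) (cong f (cong proj₁ p)))) (along rest)

  JoinedBy : List E → Rel V 0ℓ
  JoinedBy w u v = ∃ λ e → e ∈ w × Joins e u v

  joinedBy-linked : ∀ {w u v} → JoinedBy w u v → Linked w u v
  joinedBy-linked {w} (e , e∈w , inj₁ p) = subst₂ (Linked w) (cong proj₁ p) (cong proj₂ p) (linked-edge e∈w)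
  joinedBy-linked {w} (e , e∈w , inj₂ p) = sym (subst₂ (Linked w) (cong proj₁ p) (cong proj₂ p) (linked-edge e∈w))

  open Paths {V} Fin._≟_ using (Chain; simple-path; chain-step; chain-last)

  linked⇒star : ∀ w {u v} → Linked w u v → Star (JoinedBy w) u v
  linked⇒star w = linked-universal
    (record { refl = ε ; sym = Star.reverse (λ (e , e∈ , j) → e , e∈ , Sum.swap j) ; trans = _◅◅_ }) w
    (λ {e} e∈w → (e , e∈w , inj₁ refl) ◅ ε)

  CycleBy : List E → ∀ {l} → Vec V l → Set
  CycleBy w c = VecUnique.Unique c × (∀ i → JoinedBy w (lookup c i) (lookup c (next i)))

  acyclic⇒no-cycle : ∀ w → Acyclic w → ∀ {l} → 3 ℕ.≤ l → (c : Vec V l) → ¬ CycleBy w c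
  acyclic⇒no-cycle [] _ {suc l} _ c (_ , join) with () ← proj₁ (proj₂ (join zero))
  acyclic⇒no-cycle (e ∷ w) (¬e , aw) {l} 3≤l c (uniq , join)
    with Fin.all? (λ i → ¬? (proj₁ (join i) Fin.≟ e))
  ... | yes none = acyclic⇒no-cycle w aw 3≤l c (uniq , λ i → keep i (none i))
    where
    keep : ∀ i → proj₁ (join i) ≢ e → JoinedBy w (lookup c i) (lookup c (next i))
    keep i ≢e with join i
    ... | f , here refl , j = contradiction refl ≢e
    ... | f , there f∈w , j = f , f∈w , j
  ... | no some with i , ¬¬≡e ← Fin.¬∀⟶∃¬ l _ (λ i → ¬? (proj₁ (join i) Fin.≟ e)) some =
    ¬e (link (subst (λ f → Joins f _ _) i≡e (proj₂ (proj₂ (join i)))))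
    where
    i≡e : proj₁ (join i) ≡ e
    i≡e = decidable-stable (proj₁ (join i) Fin.≟ e) ¬¬≡e
    only : ∀ j → proj₁ (join j) ≡ e → j ≡ i
    only j j≡e with joins-same (subst (λ f → Joins f _ _) j≡e (proj₂ (proj₂ (join j)))) (subst (λ f → Joins f _ _) i≡e (proj₂ (proj₂ (join i))))
    ... | inj₁ (p , _) = lookup-injective uniq j i p
    -- A second traversal of `e`, in the opposite direction, would give `next (next i) ≡ i`.
    ... | inj₂ (p , q) = contradiction (trans (cong next (sym (lookup-injective uniq _ _ p))) (lookup-injective uniq _ _ q)) (next-next 3≤l i)
    step : ∀ j → j ≢ i → Linked w (lookup c j) (lookup c (next j))
    step j j≢i with join j | only j
    ... | f , here refl , _ | o = contradiction (o refl) j≢i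
    ... | f , there f∈w , b | _ = joinedBy-linked (f , f∈w , b)
    link : Joins e (lookup c i) (lookup c (next i)) → Linked w (src e) (tgt e)
    link (inj₁ p) = subst₂ (Linked w) (sym (cong proj₁ p)) (sym (cong proj₂ p)) (constant-off-one (rep w ∘ lookup c) i step i (next i))
    link (inj₂ p) = subst₂ (Linked w) (sym (cong proj₁ p)) (sym (cong proj₂ p)) (constant-off-one (rep w ∘ lookup c) i step (next i) i)

  -- The letter that first closes a cycle completes a simple path between its ends. A path of length
  -- 0 would make it a loop, and one of length 1 would be a parallel edge or a second copy of the
  -- letter; these are what simplicity and `Unique` exclude.
  cyclic⇒cycle : ∀ w → Unique w → ¬ Acyclic w → ∃[ l ] 3 ℕ.≤ l × Σ[ c ∈ Vec V l ] CycleBy w c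
  cyclic⇒cycle [] _ ¬a = contradiction tt ¬a
  cyclic⇒cycle (e ∷ w) (e∉w ∷ uniq) ¬a with acyclic? w
  ... | no ¬aw with l , 3≤l , c , u , join ← cyclic⇒cycle w uniq ¬aw =
    l , 3≤l , c , u , λ i → let f , f∈ , j = join i in f , there f∈ , j
  ... | yes aw with simple-path (JoinedBy w) (linked⇒star w {src e} {tgt e}
                      (decidable-stable (linked? w _ _) λ ¬l → ¬a (¬l , aw)))
  ... | 0 , [] , p , _ = contradiction (proj₁ (edge-spec e)) (Fin.<-irrefl p)
  ... | 1 , x ∷ [] , ((f , f∈w , j) , refl) , _ =
    contradiction (joins-unique (joins-self e) j) (All.lookup e∉w f∈w)
  ... | suc (suc k) , c , chain , u = 3 ℕ.+ k , s≤s (s≤s (s≤s z≤n)) , src e ∷ c , u , joined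
    where
    joined : ∀ i → JoinedBy (e ∷ w) (lookup (src e ∷ c) i) (lookup (src e ∷ c) (next i))
    joined i with view i
    ... | ‵fromℕ = e , here refl , subst₂ (Joins e) (sym (chain-last (JoinedBy w) c chain))
                     (cong (lookup (src e ∷ c)) (sym (next-fromℕ (2 ℕ.+ k)))) (inj₂ refl)
    ... | ‵inject₁ i with f , f∈w , j ← chain-step (JoinedBy w) c chain i =
      f , there f∈w , subst (Joins f (lookup (src e ∷ c) (inject₁ i))) (cong (lookup (src e ∷ c)) (sym (next-inject₁ i))) j

  acyclic⇒forest : ∀ {w} {S : EdgeSet G} → (∀ {e} → e Subset.∈ S → e ∈ w) → Acyclic w → IsForest G S
  acyclic⇒forest S⊆w a (l , 3≤l , c , u , join) =
    acyclic⇒no-cycle _ a 3≤l c (u , λ i → let e , e∈ , j = join i in e , S⊆w e∈ , j)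

  forest⇒acyclic : ∀ {w} {S : EdgeSet G} → (∀ {e} → e ∈ w → e Subset.∈ S) → Unique w → IsForest G S → Acyclic w
  forest⇒acyclic w⊆S uniq forest = decidable-stable (acyclic? _) λ ¬a →
    let l , 3≤l , c , u , join = cyclic⇒cycle _ uniq ¬a
    in forest (l , 3≤l , c , u , λ i → let e , e∈ , j = join i in e , w⊆S e∈ , j)

-- Words of edges against edge sets of a simple graph

module _ where

  open import Data.Integer.Base using (_+_; _*_)
  open import Algebra.Properties.AbelianGroup ℤ.+-0-abelianGroup using (∙-cancelʳ)
  open import Algebra.Properties.Semiring.Sum ℤ.+-*-semiring using (sum; sum-cong-≗; ∑-distrib-+)

  module Counting {N} (G : SimpleGraph N) where
    open Edges G
    open Extensions src tgt public

    toSet : List E → EdgeSet G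
    toSet []      = Subset.⊥
    toSet (e ∷ w) = toSet w [ e ]≔ Subset.inside

    ∈⇒∈toSet : ∀ {e w} → e ∈ w → e Subset.∈ toSet w
    ∈⇒∈toSet {w = f ∷ w} (here refl) = Vec.[]≔-updates (toSet w) f
    ∈⇒∈toSet {e} {f ∷ w} (there e∈w) with e Fin.≟ f
    ... | yes refl = Vec.[]≔-updates (toSet w) e
    ... | no e≢f   = Vec.lookup⇒[]= e (toSet w [ f ]≔ Subset.inside)
      (trans (Vec.lookup∘update′ e≢f (toSet w) Subset.inside) (Vec.[]=⇒lookup (∈⇒∈toSet e∈w)))

    ∈toSet⇒∈ : ∀ {e} w → e Subset.∈ toSet w → e ∈ w
    ∈toSet⇒∈ []      e∈ = contradiction e∈ Subset.∉⊥
    ∈toSet⇒∈ {e} (f ∷ w) e∈ with e Fin.≟ f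
    ... | yes refl = here refl
    ... | no e≢f   = there (∈toSet⇒∈ w (Vec.lookup⇒[]= e (toSet w)
      (trans (sym (Vec.lookup∘update′ e≢f (toSet w) Subset.inside)) (Vec.[]=⇒lookup e∈))))

    forest-indicator : EdgeSet G → ℤ
    forest-indicator = indicator ∘ isForest? G

    -- A letter already present closes a cycle and contributes nothing, which matches the zero terms
    -- of `up`.
    extensions-up^ : ∀ j w → Unique w → extensions j w ≡ up^ j forest-indicator (toSet w)
    extensions-up^ zero w uniq = indicator-⇔ (acyclic? w) (isForest? G (toSet w))
      (acyclic⇒forest (∈toSet⇒∈ w)) (forest⇒acyclic ∈⇒∈toSet uniq)
    extensions-up^ (suc j) w uniq = sum-cong-≗ term
      where
      term : ∀ e → extensions j (e ∷ w) ≡ (if lookup (toSet w) e then 0ℤ else up^ j forest-indicator (toSet w [ e ]≔ Subset.inside))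
      term e with lookup (toSet w) e in eq
      ... | true  = extensions-cyclic j (e ∷ w) λ a → acyclic⇒∉ a (∈toSet⇒∈ w (Vec.lookup⇒[]= e (toSet w) eq))
      ... | false = extensions-up^ j (e ∷ w) (All.tabulate (λ {x} x∈w e≡x → contradiction
        (trans (sym eq) (Vec.[]=⇒lookup (∈⇒∈toSet (subst (_∈ w) (sym e≡x) x∈w)))) λ ()) ∷ uniq)

    extensions-I : ∀ k → extensions k [] ≡ + (k ! ℕ.* I G k)
    extensions-I k = begin
      extensions k []                          ≡⟨ extensions-up^ k [] [] ⟩
      up^ k forest-indicator Subset.⊥          ≡⟨ up^-⊥ k forest-indicator ⟩
      + (k !) * layer-sum k forest-indicator   ≡⟨ cong (+ (k !) *_) (sym (count-layer m k (isForest? G))) ⟩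
      + (k !) * + I G k                        ≡⟨ sym (ℤ.pos-* (k !) (I G k)) ⟩
      + (k ! ℕ.* I G k)                        ∎
      where open ≡-Reasoning

  module _ {n : ℕ} where
    open DecMembership (Fin._≟_ {n}) using (_∈?_)

    missing-element : ∀ (xs : List (Fin n)) → length xs ℕ.< n → ∃ λ x → x ∉ xs
    missing-element xs lt with Fin.any? (λ x → ¬? (x ∈? xs))
    ... | yes found = found
    ... | no ¬found = contradiction (Fin.injective⇒≤ {f = Any.index ∘ member} λ {x} {y} eq →
        trans (lookup-index (member x)) (trans (cong (List.lookup xs) eq) (sym (lookup-index (member y))))) (ℕ.<⇒≱ lt)
      where
      member : ∀ x → x ∈ xs
      member x = decidable-stable (x ∈? xs) λ x∉ → ¬found (x , x∉)

    unique-length≤ : ∀ {xs : List (Fin n)} → Unique xs → length xs ℕ.≤ n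
    unique-length≤ {xs} uniq = Fin.injective⇒≤ {f = List.lookup xs} λ {i} {k} → lookup-unique uniq i k

  -- Equality forces a cycle

  module Extremal {N} (G : SimpleGraph N) (connected : Connected G) where
    open Edges G
    open Counting G
    open Equality src tgt
    open DecMembership (Fin._≟_ {N}) using (_∈?_)

    spanning : Spanning (λ _ → ⊤)
    spanning = connected⇒spanning connected

    -- Being equal to `y` is constant along the edges of `w`, so its kernel contains `Linked w`.
    isolated : ∀ {w y} → (∀ {e} → e ∈ w → src e ≢ y × tgt e ≢ y) → ∀ {v} → Linked w v y → v ≡ y
    isolated {w} {y} avoid {v} p with v Fin.≟ y | linked-universal (kernel-isEquivalence (λ u → does (u Fin.≟ y))) w same p
      where
      same : ∀ {e} → e ∈ w → does (src e Fin.≟ y) ≡ does (tgt e Fin.≟ y)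
      same {e} e∈w with src e Fin.≟ y | tgt e Fin.≟ y | avoid e∈w
      ... | yes q | _     | (≢y , _) = contradiction q ≢y
      ... | no _  | yes q | (_ , ≢y) = contradiction q ≢y
      ... | no _  | no _  | _        = refl
    ... | yes q | _  = q
    ... | no _  | eq = contradiction (trans eq (dec-true (y Fin.≟ y) refl)) λ ()

    Supported : List E → List V → Set
    Supported w us = ∀ {e} → e ∈ w → src e ∈ us × tgt e ∈ us

    avoids : ∀ {w us y} → Supported w us → y ∉ us → ∀ {e} → e ∈ w → src e ≢ y × tgt e ≢ y
    avoids {us = us} supp y∉ e∈w =
      (λ p → y∉ (subst (_∈ us) p (proj₁ (supp e∈w)))) , (λ p → y∉ (subst (_∈ us) p (proj₂ (supp e∈w))))

    boundary-edge : ∀ us → ∃ (_∈ us) → ∃ (_∉ us) →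
      ∃ λ e → (src e ∈ us × tgt e ∉ us) ⊎ (tgt e ∈ us × src e ∉ us)
    boundary-edge us (x , x∈) (y , y∉)
      with Fin.any? (λ e → (src e ∈? us ×-dec ¬? (tgt e ∈? us)) ⊎-dec (tgt e ∈? us ×-dec ¬? (src e ∈? us)))
    ... | yes found = found
    ... | no ¬found = contradiction (side x∈ (spanning side-of same x y)) y∉
      where
      side-of : V → Fin 2
      side-of v with v ∈? us
      ... | yes _ = zero
      ... | no  _ = suc zero
      side : x ∈ us → side-of x ≡ side-of y → y ∈ us
      side x∈ eq with x ∈? us | y ∈? us
      ... | _      | yes y∈ = y∈
      ... | yes _  | no _   = contradiction eq λ ()
      ... | no x∉  | no _   = contradiction x∈ x∉
      same : ∀ e → ⊤ → side-of (src e) ≡ side-of (tgt e)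
      same e _ with src e ∈? us | tgt e ∈? us
      ... | yes _ | yes _ = refl
      ... | no _  | no _  = refl
      ... | yes p | no q  = contradiction (e , inj₁ (p , q)) ¬found
      ... | no q  | yes p = contradiction (e , inj₂ (p , q)) ¬found

    -- The forest is grown as a single tree, so that its k edges touch only k + 1 vertices. With k =
    -- N - 3 this spares two vertices, which become the isolated pair.
    grow : V → ∀ k → suc k ℕ.≤ N → ∃₂ λ w us → Acyclic w × length w ≡ k × length us ≡ suc k × Supported w us
    grow v zero    _  = [] , v ∷ [] , tt , refl , refl , λ ()
    grow v (suc k) lt with w , us@(u ∷ _) , a , lw , lus , supp ← grow v k (ℕ.<⇒≤ lt)
      with boundary-edge us (u , here refl) (missing-element us (subst (ℕ._< N) (sym lus) lt))
    ... | e , inj₁ (s∈ , t∉) = e ∷ w , tgt e ∷ us ,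
          ((λ p → t∉ (subst (_∈ us) (isolated (avoids supp t∉) p) s∈)) , a) , cong suc lw , cong suc lus ,
          λ { (here refl) → there s∈ , here refl ; (there f∈) → there (proj₁ (supp f∈)) , there (proj₂ (supp f∈)) }
    ... | e , inj₂ (t∈ , s∉) = e ∷ w , src e ∷ us ,
          ((λ p → s∉ (subst (_∈ us) (isolated (avoids supp s∉) (sym p)) t∈)) , a) , cong suc lw , cong suc lus ,
          λ { (here refl) → here refl , there t∈ ; (there f∈) → there (proj₁ (supp f∈)) , there (proj₂ (supp f∈)) }

    loopless : ∀ e → src e ≢ tgt e
    loopless e p = Fin.<-irrefl p (proj₁ (edge-spec e))

    incident : ∀ {u v} → u ≢ v → ∃₂ λ e x → Joins e u x
    incident {u} {v} u≢v with connected u v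
    ... | ε      = contradiction refl u≢v
    ... | ux ◅ _ = let e , j = adj⇒joins ux in e , _ , j

    joins-ends : ∀ {e x y} → (src e ≡ x × tgt e ≡ y) ⊎ (src e ≡ y × tgt e ≡ x) → Joins e x y
    joins-ends (inj₁ (p , q)) = inj₁ (cong₂ _,_ p q)
    joins-ends (inj₂ (p , q)) = inj₂ (cong₂ _,_ p q)

    hamiltonian⇒cycle : ∀ {l} (c : Vec V l) → l ≡ N → VecUnique.Unique c → (∀ v → ∃ λ i → lookup c i ≡ v) →
      (∀ i → ∃ λ e → Joins e (lookup c i) (lookup c (next i))) →
      (∀ e → ∃ λ i → Joins e (lookup c i) (lookup c (next i))) → IsCycleGraph G
    hamiltonian⇒cycle c refl uniq position step on-cycle =
      permutation index (lookup c) index-lookup (proj₂ ∘ position) , λ u v → mk⇔ to from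
      where
      index : V → Fin N
      index v = proj₁ (position v)

      index-lookup : ∀ i → index (lookup c i) ≡ i
      index-lookup i = lookup-injective uniq _ _ (proj₂ (position (lookup c i)))

      to : ∀ {u v} → Adj G u v → CycleAdj N (index u) (index v)
      to uv with e , juv ← adj⇒joins uv with i , ji ← on-cycle e with joins-same juv ji
      ... | inj₁ (refl , refl) = inj₁ (trans (index-lookup (next i)) (cong next (sym (index-lookup i))))
      ... | inj₂ (refl , refl) = inj₂ (trans (index-lookup (next i)) (cong next (sym (index-lookup i))))

      adjacent : ∀ {u v} → index v ≡ next (index u) → Adj G u v
      adjacent {u} {v} p = subst₂ (Adj G) (proj₂ (position u)) (trans (cong (lookup c) (sym p)) (proj₂ (position v)))
        (joins⇒adj (proj₂ (step (index u))))

      from : ∀ {u v} → CycleAdj N (index u) (index v) → Adj G u v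
      from (inj₁ p) = adjacent p
      from (inj₂ p) = symm G (adjacent p)

    module _ {j : ℕ} (critical : Critical j) where

      private
        len = proj₁ critical
        j+2<N : suc (suc j) ℕ.< N
        j+2<N = ℕ.≤-reflexive len

      extremal-word : ∃ λ w → Acyclic w × length w ≡ j × extensions 1 w ≡ + 3
      extremal-word
        with w , us , a , lw , lus , supp ← grow (proj₁ (missing-element [] (ℕ.≤-trans (s≤s z≤n) j+2<N))) j (ℕ.<⇒≤ (ℕ.<⇒≤ j+2<N))
        with x , x∉ ← missing-element us (subst (ℕ._< N) (sym lus) (ℕ.<⇒≤ j+2<N))
        with y , y∉ ← missing-element (x ∷ us) (subst (λ l → suc l ℕ.< N) (sym lus) j+2<N) =
        w , a , lw , isolated-pair⇒extensions≡3 critical a lw spanning {x} {y} (λ x≡y → y∉ (here (sym x≡y)))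
          (isolated (avoids supp x∉)) (isolated (avoids supp (y∉ ∘ there)))
          (λ p q → joins-unique (joins-ends p) (joins-ends q))

      -- A cycle missing an edge `e` would lie in the acyclic word that contains all other edges. So
      -- it passes through every edge, and through every vertex because each has an incident edge.
      no-avoiding-cycle⇒cycle : ∀ {l w} (c : Vec V l) → 3 ℕ.≤ l → CycleBy w c →
        (∀ e → ∃ λ W → Acyclic W × (∀ {x} → x ≢ e → x ∈ W)) → IsCycleGraph G
      no-avoiding-cycle⇒cycle {l} c 3≤l (uniq , join) all-but-one =
        hamiltonian⇒cycle c l≡N uniq position (λ i → proj₁ (join i) , proj₂ (proj₂ (join i))) on-cycle
        where
        on-cycle : ∀ e → ∃ λ i → Joins e (lookup c i) (lookup c (next i))
        on-cycle e with Fin.any? (λ i → proj₁ (join i) Fin.≟ e)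
        ... | yes (i , refl) = i , proj₂ (proj₂ (join i))
        ... | no ¬i with W , aW , W⊇ ← all-but-one e =
          contradiction (uniq , λ i → proj₁ (join i) , W⊇ (λ p → ¬i (i , p)) , proj₂ (proj₂ (join i))) (acyclic⇒no-cycle W aW 3≤l c)

        position : ∀ v → ∃ λ i → lookup c i ≡ v
        position v
          with u , u∉ ← missing-element (v ∷ []) (ℕ.≤-trans (s≤s (s≤s z≤n)) j+2<N)
          with e , x , jv ← incident {v} {u} (λ v≡u → u∉ (here (sym v≡u)))
          with i , ji ← on-cycle e
          with joins-same ji jv
        ... | inj₁ (p , _) = i , p
        ... | inj₂ (_ , p) = next i , p

        l≡N : l ≡ N
        l≡N = ℕ.≤-antisym (Fin.injective⇒≤ λ {i} {k} → lookup-injective uniq i k)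
                          (surjection⇒≤ (lookup c) position)

      critical⇒cycle : IsCycleGraph G
      critical⇒cycle = from-word extremal-word
        where
        from-tree : ∀ {w e₁} → length w ≡ j → extensions 1 w ≡ + 3 → (∃ λ e₂ → Acyclic (e₂ ∷ e₁ ∷ w)) → IsCycleGraph G
        from-tree lw three (e₂ , a₂) = from-cycle (cyclic⇒cycle (g ∷ T) unique-g∷T (outside-dependent g))
          where
          open Unicyclic critical spanning loopless lw three a₂
          from-cycle : (∃ λ l → 3 ℕ.≤ l × Σ[ c ∈ Vec V l ] CycleBy (g ∷ T) c) → IsCycleGraph G
          from-cycle (l , 3≤l , c , cycle) = no-avoiding-cycle⇒cycle c 3≤l cycle all-but-one-acyclic

        from-forest : ∀ {w} → length w ≡ j → extensions 1 w ≡ + 3 → (∃ λ e₁ → Acyclic (e₁ ∷ w)) → IsCycleGraph G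
        from-forest lw three (e₁ , a₁) =
          from-tree lw three (extend spanning a₁ (subst (λ l → suc (suc l) ℕ.< N) (sym lw) j+2<N))

        from-word : (∃ λ w → Acyclic w × length w ≡ j × extensions 1 w ≡ + 3) → IsCycleGraph G
        from-word (w , a , lw , three) =
          from-forest lw three (extend spanning a (subst (λ l → suc l ℕ.< N) (sym lw) (ℕ.<⇒≤ j+2<N)))

    -- A cycle attains equality

    module CycleGraph {j : ℕ} (len : 3 ℕ.+ j ≡ N) (cycle : IsCycleGraph G) where
      private
        σ   = proj₁ cycle
        iso = proj₂ cycle
        3≤N : 3 ℕ.≤ N
        3≤N = ℕ.m+n≤o⇒m≤o 3 (ℕ.≤-reflexive len)

      vertex : Fin N → V
      vertex i = σ ⟨$⟩ˡ i

      vertex-injective : ∀ {i k} → vertex i ≡ vertex k → i ≡ k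
      vertex-injective p = trans (sym (inverseʳ σ)) (trans (cong (σ ⟨$⟩ʳ_) p) (inverseʳ σ))

      side : Fin N → E
      side i = proj₁ (adj⇒joins (Equivalence.from (iso (vertex i) (vertex (next i)))
        (inj₁ (trans (inverseʳ σ) (cong next (sym (inverseʳ σ)))))))

      side-joins : ∀ i → Joins (side i) (vertex i) (vertex (next i))
      side-joins i = proj₂ (adj⇒joins (Equivalence.from (iso (vertex i) (vertex (next i)))
        (inj₁ (trans (inverseʳ σ) (cong next (sym (inverseʳ σ)))))))

      start : ∀ e → ∃ λ i → Joins e (vertex i) (vertex (next i))
      start e with Equivalence.to (iso (src e) (tgt e)) (joins⇒adj (joins-self e))
      ... | inj₁ p = σ ⟨$⟩ʳ src e , inj₁ (cong₂ _,_ (sym (inverseˡ σ)) (trans (sym (inverseˡ σ)) (cong vertex p)))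
      ... | inj₂ p = σ ⟨$⟩ʳ tgt e , inj₂ (cong₂ _,_ (trans (sym (inverseˡ σ)) (cong vertex p)) (sym (inverseˡ σ)))

      m≤N : m ℕ.≤ N
      m≤N = Fin.injective⇒≤ {f = proj₁ ∘ start} λ {e} {f} p →
        joins-unique (subst (λ i → Joins e (vertex i) (vertex (next i))) p (proj₂ (start e))) (proj₂ (start f))

      spanning-without : ∀ e → Spanning (_≢ e)
      spanning-without e f same u v = trans (cong f (sym (inverseˡ σ))) (trans
        (constant-off-one (f ∘ vertex) (proj₁ (start e)) step (σ ⟨$⟩ʳ u) (σ ⟨$⟩ʳ v)) (cong f (inverseˡ σ)))
        where
        step : ∀ i → i ≢ proj₁ (start e) → f (vertex i) ≡ f (vertex (next i))
        step i i≢ with side i Fin.≟ e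
        ... | no ≢e = along (side-joins i)
          where
          along : ∀ {x y} → Joins (side i) x y → f x ≡ f y
          along (inj₁ p) = trans (cong f (sym (cong proj₁ p))) (trans (same (side i) ≢e) (cong f (cong proj₂ p)))
          along (inj₂ p) = trans (cong f (sym (cong proj₂ p))) (trans (sym (same (side i) ≢e)) (cong f (cong proj₁ p)))
        ... | yes p with joins-same (subst (λ e → Joins e _ _) p (side-joins i)) (proj₂ (start e))
        ...   | inj₁ (q , _) = contradiction (vertex-injective q) i≢
        ...   | inj₂ (q , r) = contradiction (trans (cong next (sym (vertex-injective q))) (vertex-injective r)) (next-next 3≤N (proj₁ (start e)))

      TreeWithout : E → Set
      TreeWithout e = ∃ λ T → length T ≡ 2 ℕ.+ j × All (_≢ e) T × Acyclic T

      tree-without : ∀ e → TreeWithout e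
      tree-without e = strip (acyclic-extend-by (λ f → ¬? (f Fin.≟ e)) (spanning-without e) (2 ℕ.+ j) {[]} [] tt
        (ℕ.≤-reflexive (trans (cong (3 ℕ.+_) (ℕ.+-identityʳ j)) len)))
        where
        strip : (∃ λ T → length T ≡ 2 ℕ.+ j ℕ.+ 0 × All (_≢ e) T × Acyclic T × [] ⊆ T) → TreeWithout e
        strip (T , lT , ≢e , aT , _) = T , trans lT (ℕ.+-identityʳ _) , ≢e , aT

      unique-∷tree : ∀ {e} ((T , _) : TreeWithout e) → Unique (e ∷ T)
      unique-∷tree (T , _ , ≢e , aT) = All.map (λ ≢e → ≢e ∘ sym) ≢e ∷ acyclic⇒unique aT

      N≤m : ∀ {e} → TreeWithout e → N ℕ.≤ m
      N≤m tree@(T , lT , _) = subst (ℕ._≤ m) (trans (cong suc lT) len) (unique-length≤ (unique-∷tree tree))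

      N≡m : N ≡ m
      N≡m = ℕ.≤-antisym (N≤m (tree-without (side (subst Fin len zero)))) m≤N

      open DecMembership (Fin._≟_ {m}) using () renaming (_∈?_ to _∈E?_)

      tree-contains : ∀ {e} ((T , _) : TreeWithout e) → ∀ {f} → f ≢ e → f ∈ T
      tree-contains {e} tree@(T , lT , _) {f} f≢e = decidable-stable (f ∈E? T) λ f∉T → ℕ.<⇒≱ (ℕ.n<1+n N)
        (ℕ.≤-trans (subst (ℕ._≤ m) (cong suc (trans (cong suc lT) len)) (unique-length≤ {xs = f ∷ e ∷ T}
          ((f≢e ∷ All.tabulate (λ x∈T f≡x → f∉T (subst (_∈ T) (sym f≡x) x∈T))) ∷ unique-∷tree tree))) m≤N)

      -- `w` lies in the tree consisting of all edges but `e`. Passing through edge sets turns this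
      -- inclusion into acyclicity, whatever the order of the letters.
      missing⇒acyclic : ∀ {w e} → Unique w → e ∉ w → Acyclic w
      missing⇒acyclic {w} {e} uniq e∉w = forest⇒acyclic ∈⇒∈toSet uniq (tree-forest (tree-without e))
        where
        tree-forest : TreeWithout e → IsForest G (toSet w)
        tree-forest tree@(T , _ , _ , aT) = acyclic⇒forest (λ {f} f∈ →
          tree-contains tree λ f≡e → e∉w (subst (_∈ w) f≡e (∈toSet⇒∈ w f∈))) aT

      -- With fewer than m - 1 letters in `w`, any new letter still leaves some edge missing, so
      -- every letter outside `w` extends it.
      extensions-count : ∀ w → Acyclic w → suc (length w) ℕ.< m → extensions 1 w + + length w ≡ + m
      extensions-count w a lt = begin
        extensions 1 w + + length w ≡⟨ cong (λ x → extensions 1 w + x) (sym (count-∈ (acyclic⇒unique a))) ⟩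
        extensions 1 w + count (_∈E? w) ≡⟨ sym (∑-distrib-+ (λ e → extensions 0 (e ∷ w)) (λ e → indicator (e ∈E? w))) ⟩
        sum (λ e → extensions 0 (e ∷ w) + indicator (e ∈E? w)) ≡⟨ sum-cong-≗ each ⟩
        sum (λ (_ : E) → 1ℤ) ≡⟨ ones m ⟩
        + m ∎
        where
        open ≡-Reasoning
        ones : ∀ k → sum (λ (_ : Fin k) → 1ℤ) ≡ + k
        ones zero    = refl
        ones (suc k) = cong (λ x → 1ℤ + x) (ones k)
        each : ∀ e → extensions 0 (e ∷ w) + indicator (e ∈E? w) ≡ 1ℤ
        each e with e ∈E? w
        ... | yes e∈w = cong (_+ 1ℤ) (extensions-cyclic 0 (e ∷ w) (λ a → acyclic⇒∉ a e∈w))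
        ... | no e∉w with f , f∉ ← missing-element (e ∷ w) lt =
          trans (ℤ.+-identityʳ _) (indicator-true (acyclic? (e ∷ w))
            (missing⇒acyclic (All.tabulate (λ x∈ e≡x → e∉w (subst (_∈ w) (sym e≡x) x∈)) ∷ acyclic⇒unique a) f∉))

      -- The letter chosen last has `c` options, whatever the earlier choices.
      extensions-ratio : ∀ {l c} → (∀ w → Acyclic w → length w ≡ l → extensions 1 w ≡ c) →
        ∀ k w → k ℕ.+ length w ≡ l → extensions (suc k) w ≡ c * extensions k w
      extensions-ratio {c = c} ratio zero w lw =
        [ (λ a → trans (ratio w a lw) (trans (sym (ℤ.*-identityʳ c)) (cong (λ x → c * x) (sym (indicator-true (acyclic? w) a)))))
        , (λ ¬a → trans (extensions-cyclic 1 w ¬a) (trans (sym (ℤ.*-zeroʳ c)) (cong (λ x → c * x) (sym (indicator-false (acyclic? w) ¬a)))))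
        ]′ (toSum (acyclic? w))
      extensions-ratio {c = c} ratio (suc k) w lw = trans
        (sum-cong-≗ λ e → extensions-ratio ratio k (e ∷ w) (trans (ℕ.+-suc k (length w)) lw))
        (∑-*ˡ c (λ e → extensions k (e ∷ w)))

      codimension₂ : ∀ w → Acyclic w → length w ≡ j → extensions 1 w ≡ + 3
      codimension₂ w a refl = ∙-cancelʳ (+ length w) _ _
        (trans (extensions-count w a (ℕ.≤-trans (ℕ.n≤1+n _) (ℕ.≤-reflexive (trans len N≡m)))) (cong +_ (sym (trans len N≡m))))

      codimension₁ : ∀ w → Acyclic w → length w ≡ suc j → extensions 1 w ≡ + 2
      codimension₁ w a lw = ∙-cancelʳ (+ length w) _ _
        (trans (extensions-count w a (ℕ.≤-reflexive (trans (cong (2 ℕ.+_) lw) (trans len N≡m))))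
               (cong +_ (sym (trans (cong (2 ℕ.+_) lw) (trans len N≡m)))))

      cycle⇒tight : Tight (form-K [] j) (form-h [] j) (form-q [] j)
      cycle⇒tight = begin
        form-q [] j * sum (deg (form-K [] j))   ≡⟨ cong (form-q [] j *_) (form-deg-sum [] j) ⟩
        + 3 * A * (+ 2 * extensions (2 ℕ.+ j) []) ≡⟨ cong (λ x → + 3 * A * (+ 2 * x)) (trans A₂ (cong (+ 2 *_) A₁)) ⟩
        + 3 * A * (+ 2 * (+ 2 * (+ 3 * A)))     ≡⟨ ring A ⟩
        + 2 * (+ 3 * A) * (+ 2 * (+ 3 * A))     ≡⟨ cong (λ x → + 2 * x * (+ 2 * x)) (sym A₁) ⟩
        + 2 * extensions (suc j) [] * (+ 2 * extensions (suc j) []) ≡⟨ sym (cong (λ x → x * x) (form-h-sum [] j)) ⟩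
        sum (form-h [] j) * sum (form-h [] j) ∎
        where
        open ≡-Reasoning
        A = extensions j []
        A₁ : extensions (suc j) [] ≡ + 3 * A
        A₁ = extensions-ratio codimension₂ j [] (ℕ.+-identityʳ j)
        A₂ : extensions (2 ℕ.+ j) [] ≡ + 2 * extensions (suc j) []
        A₂ = extensions-ratio codimension₁ (suc j) [] (ℕ.+-identityʳ (suc j))
        ring : ∀ x → + 3 * x * (+ 2 * (+ 2 * (+ 3 * x))) ≡ + 2 * (+ 3 * x) * (+ 2 * (+ 3 * x))
        ring = ℤ-Ring.solve-∀

-- Fractions and the final statement

open import Data.Nat.Base using (_+_; _≤_; _∸_; _*_; _^_)
open import Algebra.Properties.Semiring.Sum ℤ.+-*-semiring using (sum)

/-mono-≤ : ∀ a b c d .{{_ : NonZero b}} .{{_ : NonZero d}} → a * d ≤ c * b → (+ a / b) ℚ.≤ (+ c / d)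
/-mono-≤ a (suc b) c (suc d) le = ℚ.toℚᵘ-cancel-≤
  (ℚᵘ.≤-respˡ-≃ (ℚᵘ.≃-sym (ℚ.toℚᵘ-fromℚᵘ (mkℚᵘ (+ a) b))) (ℚᵘ.≤-respʳ-≃ (ℚᵘ.≃-sym (ℚ.toℚᵘ-fromℚᵘ (mkℚᵘ (+ c) d)))
    (*≤* (subst₂ ℤ._≤_ (ℤ.pos-* a (suc d)) (ℤ.pos-* c (suc b)) (ℤ.+≤+ le)))))

/-≡⁺ : ∀ a b c d .{{_ : NonZero b}} .{{_ : NonZero d}} → a * d ≡ c * b → + a / b ≡ + c / d
/-≡⁺ a (suc b) c (suc d) eq = ℚ.fromℚᵘ-cong {mkℚᵘ (+ a) b} {mkℚᵘ (+ c) d}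
  (*≡* (trans (sym (ℤ.pos-* a (suc d))) (trans (cong +_ eq) (ℤ.pos-* c (suc b)))))

/-≡⁻ : ∀ a b c d .{{_ : NonZero b}} .{{_ : NonZero d}} → + a / b ≡ + c / d → a * d ≡ c * b
/-≡⁻ a (suc b) c (suc d) eq = ℤ.+-injective (trans (ℤ.pos-* a (suc d)) (trans (ℚᵘ.drop-*≡* equiv) (sym (ℤ.pos-* c (suc b)))))
  where
  equiv : mkℚᵘ (+ a) b ≃ mkℚᵘ (+ c) d
  equiv = ℚᵘ.≃-trans (ℚᵘ.≃-sym (ℚ.toℚᵘ-fromℚᵘ (mkℚᵘ (+ a) b)))
    (ℚᵘ.≃-trans (ℚ.toℚᵘ-cong eq) (ℚ.toℚᵘ-fromℚᵘ (mkℚᵘ (+ c) d)))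

bound-fraction : ∀ j → (+ 3 / 2) ℚ.* (1ℚ ℚ.+ + 1 / suc j) ≡ + (3 * (2 + j)) / (2 * suc j)
bound-fraction j = ℚ.toℚᵘ-injective (begin
  toℚᵘ ((+ 3 / 2) ℚ.* (1ℚ ℚ.+ + 1 / suc j))      ≈⟨ ℚ.toℚᵘ-homo-* (+ 3 / 2) (1ℚ ℚ.+ + 1 / suc j) ⟩
  toℚᵘ (+ 3 / 2) ℚᵘ.* toℚᵘ (1ℚ ℚ.+ + 1 / suc j)
    ≈⟨ ℚᵘ.*-congˡ {toℚᵘ (+ 3 / 2)} (ℚᵘ.≃-trans (ℚ.toℚᵘ-homo-+ 1ℚ (+ 1 / suc j)) (ℚᵘ.+-congʳ (toℚᵘ 1ℚ) (ℚ.toℚᵘ-fromℚᵘ (mkℚᵘ (+ 1) j)))) ⟩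
  toℚᵘ (+ 3 / 2) ℚᵘ.* (toℚᵘ 1ℚ ℚᵘ.+ mkℚᵘ (+ 1) j) ≈⟨ *≡* cross ⟩
  -- `mkℚᵘ` takes the denominator minus one, and `2 * suc j` unfolds to `suc (j + 1 * suc j)`.
  mkℚᵘ (+ (3 * (2 + j))) (j + 1 * suc j)          ≈⟨ ℚᵘ.≃-sym (ℚ.toℚᵘ-fromℚᵘ (mkℚᵘ (+ (3 * (2 + j))) (j + 1 * suc j))) ⟩
  toℚᵘ (+ (3 * (2 + j)) / (2 * suc j)) ∎)
  where
  open ℚᵘ.≃-Reasoning
  cross : + 3 ℤ.* (1ℤ ℤ.* + suc j ℤ.+ 1ℤ ℤ.* 1ℤ) ℤ.* + (2 * suc j) ≡ + (3 * (2 + j)) ℤ.* + (2 * (1 * suc j))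
  cross = trans (cong (λ x → + 3 ℤ.* (1ℤ ℤ.* + suc j ℤ.+ 1ℤ ℤ.* 1ℤ) ℤ.* x) (ℤ.pos-* 2 (suc j)))
    (trans (ring (+ suc j)) (sym (cong₂ ℤ._*_ (ℤ.pos-* 3 (2 + j)) (trans (ℤ.pos-* 2 (1 * suc j)) (cong (+ 2 ℤ.*_) (ℤ.pos-* 1 (suc j)))))))
    where
    ring : ∀ x → + 3 ℤ.* (1ℤ ℤ.* x ℤ.+ 1ℤ ℤ.* 1ℤ) ℤ.* (+ 2 ℤ.* x) ≡ + 3 ℤ.* (1ℤ ℤ.+ x) ℤ.* (+ 2 ℤ.* (1ℤ ℤ.* x))
    ring = ℤ-Ring.solve-∀

ratio-statement : ∀ j (X Y Z : ℕ) (P : Set) → NonZero X → NonZero Z → .(nz : NonZero (suc j)) →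
  3 * (2 + j) * (X * Z) ≤ 2 * suc j * (Y * Y) →
  (3 * (2 + j) * (X * Z) ≡ 2 * suc j * (Y * Y) → P) → (P → 3 * (2 + j) * (X * Z) ≡ 2 * suc j * (Y * Y)) →
  Σ[ denominator≢0 ∈ NonZero (X * Z) ]
    (let ratio = _/_ (+ (Y ^ 2)) (X * Z) {{denominator≢0}}
         bound = (+ 3 / 2) ℚ.* (1ℚ ℚ.+ _/_ (+ 1) (suc j) {{nz}})
     in (ratio ≥ bound) × ((ratio ≡ bound) ⇔ P))
ratio-statement j X Y Z P X≢0 Z≢0 _ inequality to from = XZ≢0 ,
  subst (ℚ._≤ + (Y ^ 2) / (X * Z)) (sym (bound-fraction j))
    (/-mono-≤ (3 * (2 + j)) (2 * suc j) (Y ^ 2) (X * Z) (subst (3 * (2 + j) * (X * Z) ≤_) square inequality)) ,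
  mk⇔ (λ eq → to (trans (sym (/-≡⁻ (Y ^ 2) (X * Z) (3 * (2 + j)) (2 * suc j) (trans eq (bound-fraction j)))) (sym square)))
      (λ p → trans (/-≡⁺ (Y ^ 2) (X * Z) (3 * (2 + j)) (2 * suc j) (sym (trans (from p) square))) (sym (bound-fraction j)))
  where
  instance
    XZ≢0 : NonZero (X * Z)
    XZ≢0 = ℕ.m*n≢0 X Z {{X≢0}} {{Z≢0}}
  square : 2 * suc j * (Y * Y) ≡ Y ^ 2 * (2 * suc j)
  square = trans (cong (λ y → 2 * suc j * (Y * y)) (sym (ℕ.*-identityʳ Y))) (ℕ.*-comm (2 * suc j) (Y ^ 2))

module ForestCounts {j : ℕ} (G : SimpleGraph (3 + j)) (connected : Connected G) where
  open Edges G
  open Counting G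
  open Extremal G connected
  open Equality src tgt using (Critical)

  X Y Z C : ℕ
  X = I G j
  Y = I G (1 + j)
  Z = I G (2 + j)
  -- The common factor of the two sides 3 j! X · 2 (j+2)! Z and (2 (j+1)! Y)² of the bound for the
  -- empty word.
  C = 2 * suc j * j ! * j !

  instance
    C-nonZero : NonZero C
    C-nonZero = ℕ.m*n≢0 (2 * suc j * j !) (j !) {{ℕ.m*n≢0 (2 * suc j) (j !) {{_}} {{ℕ._!≢0 j}}}} {{ℕ._!≢0 j}}

  extensions-positive : ∀ k → k ≤ 2 + j → 0ℤ ℤ.< extensions k []
  extensions-positive k k≤ = extensions-pos spanning k tt (s≤s (subst (_≤ 2 + j) (sym (ℕ.+-identityʳ k)) k≤))

  I-positive : ∀ k → k ≤ 2 + j → NonZero (I G k)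
  I-positive k k≤ = ℕ.≢-nonZero λ I≡0 → ℤ.<-irrefl (sym (trans (extensions-I k)
    (cong +_ (trans (cong (k ! *_) I≡0) (ℕ.*-zeroʳ (k !)))))) (extensions-positive k k≤)

  top-left : form-q [] j ℤ.* sum (deg (form-K [] j)) ≡ + (C * (3 * (2 + j) * (X * Z)))
  top-left = begin
    + 3 ℤ.* extensions j [] ℤ.* sum (deg (form-K [] j))
      ≡⟨ cong₂ (λ x y → + 3 ℤ.* x ℤ.* y) (extensions-I j) (trans (form-deg-sum [] j) (cong (+ 2 ℤ.*_) (extensions-I (2 + j)))) ⟩
    + 3 ℤ.* + (j ! * X) ℤ.* (+ 2 ℤ.* + ((2 + j) ! * Z))
      ≡⟨ sym (trans (ℤ.pos-* (3 * (j ! * X)) (2 * ((2 + j) ! * Z))) (cong₂ ℤ._*_ (ℤ.pos-* 3 (j ! * X)) (ℤ.pos-* 2 ((2 + j) ! * Z)))) ⟩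
    + (3 * (j ! * X) * (2 * ((2 + j) * (suc j * j !) * Z)))
      ≡⟨ cong +_ (ring (suc j) (2 + j) (j !) X Z) ⟩
    + (C * (3 * (2 + j) * (X * Z))) ∎
    where
    open ≡-Reasoning
    ring : ∀ a b f x z → 3 * (f * x) * (2 * (b * (a * f) * z)) ≡ 2 * a * f * f * (3 * b * (x * z))
    ring = ℕ-Ring.solve-∀

  top-right : sum (form-h [] j) ℤ.* sum (form-h [] j) ≡ + (C * (2 * suc j * (Y * Y)))
  top-right = begin
    sum (form-h [] j) ℤ.* sum (form-h [] j)
      ≡⟨ cong (λ x → x ℤ.* x) (trans (form-h-sum [] j) (trans (cong (+ 2 ℤ.*_) (extensions-I (1 + j))) (sym (ℤ.pos-* 2 (suc j ! * Y))))) ⟩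
    + (2 * (suc j ! * Y)) ℤ.* + (2 * (suc j ! * Y))  ≡⟨ sym (ℤ.pos-* (2 * (suc j ! * Y)) (2 * (suc j ! * Y))) ⟩
    + (2 * (suc j * j ! * Y) * (2 * (suc j * j ! * Y))) ≡⟨ cong +_ (ring (suc j) (j !) Y) ⟩
    + (C * (2 * suc j * (Y * Y))) ∎
    where
    open ≡-Reasoning
    ring : ∀ a f y → 2 * (a * f * y) * (2 * (a * f * y)) ≡ 2 * a * f * f * (2 * a * (y * y))
    ring = ℕ-Ring.solve-∀

  hyperbolic : Hyperbolic (form-K [] j) (form-h [] j) (form-q [] j)
  hyperbolic = form-hyperbolic spanning j tt (ℕ.+-identityʳ (3 + j))

  inequality : 3 * (2 + j) * (X * Z) ≤ 2 * suc j * (Y * Y)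
  inequality = ℕ.*-cancelˡ-≤ C (ℤ.drop‿+≤+ (subst₂ ℤ._≤_ top-left top-right
    (hyperbolic⇒bound (form-K-sym [] j) hyperbolic
      (subst (0ℤ ℤ.<_) (sym (form-deg-sum [] j)) (*-pos {+ 2} (ℤ.+<+ (s≤s z≤n)) (extensions-positive (2 + j) ℕ.≤-refl))))))

  equality⇒cycle : 3 * (2 + j) * (X * Z) ≡ 2 * suc j * (Y * Y) → IsCycleGraph G
  equality⇒cycle eq = critical⇒cycle critical
    where
    top : Tight (form-K [] j) (form-h [] j) (form-q [] j)
    top = trans top-left (trans (cong (λ x → + (C * x)) eq) (sym top-right))
    critical : Critical j
    critical = refl , λ {w} a lw → form-tight spanning 0 w a (cong (λ l → 3 + l) lw) (λ { _ refl → top })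

  cycle⇒equality : IsCycleGraph G → 3 * (2 + j) * (X * Z) ≡ 2 * suc j * (Y * Y)
  cycle⇒equality cycle = ℕ.*-cancelˡ-≡ _ _ C (ℤ.+-injective
    (trans (sym top-left) (trans (CycleGraph.cycle⇒tight refl cycle) top-right)))

proposition1p11 :
    (N : ℕ) (N≥3 : 3 ≤ N) (G : SimpleGraph N) → Connected G →
    Σ[ denominator≢0 ∈ NonZero (I G (N ∸ 3) * I G (N ∸ 1)) ]
      (let ratio = _/_ (+ (I G (N ∸ 2) ^ 2)) (I G (N ∸ 3) * I G (N ∸ 1)) {{denominator≢0}}
           bound = (+ 3 / 2) ℚ.* (1ℚ ℚ.+ _/_ (+ 1) (N ∸ 2) {{∸-nonZero N≥3}})
       in (ratio ≥ bound) × ((ratio ≡ bound) ⇔ IsCycleGraph G))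
proposition1p11 (suc (suc (suc j))) N≥3@(s≤s (s≤s (s≤s _))) G connected =
  ratio-statement j (I G j) (I G (1 + j)) (I G (2 + j)) (IsCycleGraph G)
    (I-positive j (ℕ.m≤n+m j 2)) (I-positive (2 + j) ℕ.≤-refl) (∸-nonZero N≥3)
    inequality equality⇒cycle cycle⇒equality
  where open ForestCounts G connected
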